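{- Let $k\ge 2$ and $t\ge 4$ be integers. Let $H$ be a $3$-uniform hypergraph that admits a $k$-coloring of its edges with no monochromatic copy of $K^{(3)}_t$, and let $c:E(H)\to[k]$ be such a coloring. Then there exists a $3$-uniform hypergraph $\mathcal{H}$ with the following properties: (1) there is a $k$-coloring of $E(\mathcal{H})$ with no monochromatic copy of $K^{(3)}_t$; (2) $\mathcal{H}$ contains $H$ as an induced subhypergraph; (3) for every coloring $\varphi:E(\mathcal{H})\to[k]$ with no monochromatic copy of $K^{(3)}_t$, the restriction of $\varphi$ to $E(H)$ agrees with $c$ up to a permutation of the $k$ colors; (4) if $a,b\in V(H)$ satisfy $\deg_H(a,b)=0$, then $\deg_{\mathcal{H}}(a,b)=0$; (5) if $|V(H)|\ge 4$, then for every vertex $x\in V(\mathcal{H})\setminus V(H)$ there exists a vertex $y\in V(H)$ with $\deg_{\mathcal{H}}(x,y)=0$.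
   Context: $K^{(3)}_t$ denotes the complete $3$-uniform hypergraph on $t$ vertices. For vertices $u,v$, the codegree $\deg_H(u,v)$ is the number of edges of $H$ containing both $u$ and $v$. -}

module Defs where

open import Data.Nat using (ℕ; _+_)
open import Data.Bool using (Bool; true; false; T; if_then_else_)
open import Data.Fin using (Fin)
open import Data.List using (map; allFin)
open import Data.Nat.ListAction using (sum)
open import Data.Empty using (⊥)
open import Data.Product using (Σ; _×_)
open import Relation.Binary.PropositionalEquality using (_≡_; _≢_)
open import Function.Definitions using (Injective)

-- A (finite) 3-uniform hypergraph on the vertex set Fin n.
-- An edge {a,b,c} is recorded by E a b c ≡ true; E is invariant under all
-- permutations of its arguments (generated by the two transpositions below),
-- and only sets of three distinct vertices can be edges.
record Hyp3 (n : ℕ) : Set where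
  field
    E      : Fin n → Fin n → Fin n → Bool
    sym₁₂  : ∀ a b c → E a b c ≡ E b a c
    sym₂₃  : ∀ a b c → E a b c ≡ E a c b
    irrefl : ∀ a b → E a a b ≡ false
open Hyp3 public

-- An edge colouring with colours Fin k: a function on triples whose value on an
-- edge does not depend on the order of its vertices (values on non-edges are
-- irrelevant).
IsColoring : ∀ {n} (H : Hyp3 n) (k : ℕ) → (Fin n → Fin n → Fin n → Fin k) → Set
IsColoring H k col =
  ∀ a b c → T (E H a b c) → (col a b c ≡ col b a c) × (col a b c ≡ col a c b)

MonoClique : ∀ {n k} (H : Hyp3 n) → (Fin n → Fin n → Fin n → Fin k) → ℕ → Set
MonoClique {n} {k} H col t =
  Σ (Fin t → Fin n) λ g → Injective _≡_ _≡_ g × Σ (Fin k) λ α →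
    ∀ i j l → i ≢ j → j ≢ l → i ≢ l →
      T (E H (g i) (g j) (g l)) × (col (g i) (g j) (g l) ≡ α)

GoodColoring : ∀ {n} (H : Hyp3 n) (k t : ℕ) → (Fin n → Fin n → Fin n → Fin k) → Set
GoodColoring H k t col = IsColoring H k col × (MonoClique H col t → ⊥)

codeg : ∀ {n} (H : Hyp3 n) → Fin n → Fin n → ℕ
codeg {n} H u v = sum (map (λ w → if E H u v w then 1 else 0) (allFin n))

{-# OPTIONS --safe #-}

-- A rooted partite construction. Small coloured 3-graphs ("shapes"), all containing H on the common roots V(H) and
-- none containing a monochromatic K_t, are glued along the roots and then amalgamated along Hales–Jewett lines.
-- Every K_t of the result lies in a single shape, so the colouring of the shapes is good. On the other hand, for
-- every colouring φ the result contains a copy of the system of shapes in which the colour of a triple depends only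
-- on its labels and on the coloured 3-graph it induces together with the roots; by Ramsey's theorem the labels do
-- not matter either. If φ is good and δ i denotes the φ-colour of an ordinary triple of colour i, consider a K_t all
-- of whose triples have φ-colour δ i, except those of one type, of colour j ≢ i. The φ-colour of that type is not
-- δ i; letting i vary, it is δ j. Successively this shows that δ is injective and that φ = δ ∘ (given colour) on
-- triples with one, two and three special vertices, then with one and two roots, and finally on the edges of H.
-- A special vertex sees only the three roots of one edge of H, which yields the codegree conditions.
module Submission where

open import Defs
open import Data.Nat.ListAction using (sum)
open import Data.Fin.Permutation using (Permutation′; _⟨$⟩ʳ_; permutation)
open import Data.Nat using (ℕ; zero; suc; _+_; _*_; _∸_; _≤_; _<_; z≤n; s≤s; _≤?_; _<?_)
import Data.Nat.Properties as ℕ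
open import Data.Bool using (Bool; true; false; T; if_then_else_)
import Data.Bool.Properties as Bool
open import Data.Fin as Fin using (Fin; zero; suc; toℕ; fromℕ<)
import Data.Fin.Properties as Fin
open import Data.Maybe as Maybe using (Maybe; just; nothing; fromMaybe)
import Data.Maybe.Properties as Maybe
open import Data.List as List using (List; []; _∷_; length; allFin; cartesianProductWith; filter)
import Data.List.Properties as List
open import Data.List.Membership.Propositional using (_∈_; lose; find)
open import Data.List.Membership.Propositional.Properties as ∈
  using (∈-allFin; ∈-map⁺; ∈-++⁺ˡ; ∈-++⁺ʳ; ∈-cartesianProductWith⁺; ∈-lookup)
open import Data.List.Relation.Unary.Any as Any using (here; there; index)
import Data.List.Relation.Unary.Any.Properties as Any
open import Data.List.Relation.Unary.All as All using (All; []; _∷_)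
import Data.List.Relation.Unary.All.Properties as All
open import Data.List.Relation.Unary.AllPairs using ([]; _∷_)
open import Data.List.Relation.Unary.Unique.Propositional using (Unique)
open import Data.List.Relation.Binary.Sublist.Propositional as Sub using (_⊆_; []; _∷_; _∷ʳ_; ⊆-refl; ⊆-trans)
import Data.List.Relation.Binary.Sublist.Propositional.Properties as Sub
open import Data.Vec as Vec using (Vec; []; _∷_; lookup; _++_)
import Data.Vec.Properties as Vec
open import Data.Product as Prod using (Σ; ∃; _×_; _,_; proj₁; proj₂)
import Data.Product.Properties as Prod
open import Data.Sum as Sum using (_⊎_; inj₁; inj₂; [_,_]′)
import Data.Sum.Properties as Sum
open import Data.Empty using (⊥; ⊥-elim)
open import Data.Unit using (⊤; tt)
open import Function using (_∘_; id; Injective)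
open import Relation.Binary.Definitions using (DecidableEquality; tri<; tri≈; tri>)
open import Relation.Binary.PropositionalEquality
open import Relation.Nullary using (Dec; yes; no; ¬_; does; contradiction)
open import Relation.Nullary.Decidable using (map′; _×-dec_; _⊎-dec_; ¬?)
open import Relation.Unary using (Decidable)
import Data.List.Relation.Unary.Unique.Propositional.Properties as Unique

-- Gluing copies threatens to create new monochromatic cliques. Two copies share only roots and
-- vertices of three parts, and a clique has at most one vertex per part, since the labels in an
-- edge are distinct. A clique without a vertex private to some copy thus has at most three non-root
-- vertices; being in a common edge, they lie in one copy, and the roots lie in every copy. This
-- matches the edge size with the three parts of a step, and it is why the roots stay outside the
-- partition. Types compare a triple together with all roots, so one Hales-Jewett line fixes the
-- colours of edges with any number of roots at once. The permutation is not known before the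
-- colouring is given, so the union contains shapes for all choices of colours; `Valid` selects
-- those without a monochromatic clique. Which roots a vertex may see has to survive the
-- amalgamation, so the host is stored in the label, and `Adm` speaks of labels only. The tight case
-- is t = 4: a clique with two roots then has only two special vertices and no triple of special
-- vertices. This is the origin of the alternatives in `Valid`.

unique-lookup : ∀ {A : Set} {xs : List A} → Unique xs → ∀ i j → List.lookup xs i ≡ List.lookup xs j → i ≡ j
unique-lookup (_ ∷ _)  zero    zero    _  = refl
unique-lookup (p ∷ _)  zero    (suc j) eq = contradiction eq (All.lookup p (∈-lookup j))
unique-lookup (p ∷ _)  (suc i) zero    eq = contradiction (sym eq) (All.lookup p (∈-lookup i))
unique-lookup (_ ∷ ps) (suc i) (suc j) eq = cong suc (unique-lookup ps i j eq)

cong₃ : ∀ {A B C D : Set} (f : A → B → C → D) {x x′ y y′ z z′} → x ≡ x′ → y ≡ y′ → z ≡ z′ → f x y z ≡ f x′ y′ z′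
cong₃ f refl refl refl = refl

-- Finite types given by complete enumerations

record Finite (A : Set) : Set where
  field
    elems : List A
    complete : ∀ a → a ∈ elems
    _≟_ : DecidableEquality A
  size : ℕ
  size = length elems
open Finite using (elems; complete; size)

finite-Fin : ∀ n → Finite (Fin n)
finite-Fin n = record { elems = allFin n ; complete = ∈-allFin ; _≟_ = Fin._≟_ }

finite-⊎ : ∀ {A B} → Finite A → Finite B → Finite (A ⊎ B)
finite-⊎ FA FB = record
  { elems = List.map inj₁ (elems FA) List.++ List.map inj₂ (elems FB)
  ; complete = λ { (inj₁ a) → ∈-++⁺ˡ (∈-map⁺ inj₁ (complete FA a))
                 ; (inj₂ b) → ∈-++⁺ʳ _ (∈-map⁺ inj₂ (complete FB b)) }
  ; _≟_ = Sum.≡-dec (Finite._≟_ FA) (Finite._≟_ FB) }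

finite-× : ∀ {A B} → Finite A → Finite B → Finite (A × B)
finite-× FA FB = record
  { elems = cartesianProductWith _,_ (elems FA) (elems FB)
  ; complete = λ (a , b) → ∈-cartesianProductWith⁺ _,_ (complete FA a) (complete FB b)
  ; _≟_ = Prod.≡-dec (Finite._≟_ FA) (Finite._≟_ FB) }

finite-Maybe : ∀ {A} → Finite A → Finite (Maybe A)
finite-Maybe FA = record
  { elems = nothing ∷ List.map just (elems FA)
  ; complete = λ { nothing → here refl ; (just a) → there (∈-map⁺ just (complete FA a)) }
  ; _≟_ = Maybe.≡-dec (Finite._≟_ FA) }

finite-Vec : ∀ {A} → Finite A → ∀ n → Finite (Vec A n)
finite-Vec {A} FA n = record { elems = vecs n ; complete = vecs-complete ; _≟_ = Vec.≡-dec (Finite._≟_ FA) }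
  where
  vecs : ∀ n → List (Vec A n)
  vecs zero    = [] ∷ []
  vecs (suc n) = cartesianProductWith _∷_ (elems FA) (vecs n)
  vecs-complete : ∀ {n} (v : Vec A n) → v ∈ vecs n
  vecs-complete []      = here refl
  vecs-complete (a ∷ v) = ∈-cartesianProductWith⁺ _∷_ (complete FA a) (vecs-complete v)

module _ {A : Set} (FA : Finite A) where

  opaque
    any? : ∀ {p} {P : A → Set p} → Decidable P → Dec (∃ P)
    any? P? = map′ (λ p → let (a , _ , pa) = find p in a , pa) (λ (a , pa) → lose (complete FA a) pa)
                   (Any.any? P? (elems FA))

    all? : ∀ {p} {P : A → Set p} → Decidable P → Dec (∀ a → P a)
    all? P? = map′ (λ ps a → All.lookup ps (complete FA a)) (λ f → All.universal f _) (All.all? P? (elems FA))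

  -- Functions out of a finite type, up to pointwise equality, form a finite type of vectors.
  opaque
    table : ∀ {C : Set} → (A → C) → Vec C (size FA)
    table f = Vec.map f (Vec.fromList (elems FA))

    table-injective : ∀ {C : Set} {f g : A → C} → table f ≡ table g → ∀ a → f a ≡ g a
    table-injective {f = f} {g} eq a = go (elems FA) eq (complete FA a)
      where
      go : ∀ xs → Vec.map f (Vec.fromList xs) ≡ Vec.map g (Vec.fromList xs) → a ∈ xs → f a ≡ g a
      go (x ∷ xs) eq (here refl) = Vec.∷-injectiveˡ eq
      go (x ∷ xs) eq (there p)   = go xs (Vec.∷-injectiveʳ eq) p

  unique-length : ∀ {xs} → Unique xs → length xs ≤ size FA
  unique-length {xs} u = Fin.injective⇒≤ {f = λ i → index (complete FA (List.lookup xs i))} λ {i} {j} eq →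
    unique-lookup u i j (trans (Any.lookup-index (complete FA (List.lookup xs i)))
      (trans (cong (List.lookup (elems FA)) eq) (sym (Any.lookup-index (complete FA (List.lookup xs j))))))

-- The Hales–Jewett theorem

-- A combinatorial line is a word over Maybe A in which the moving coordinates are nothing.
Moving : ∀ {A : Set} {n} → Vec (Maybe A) n → Set
Moving {n = n} l = Σ (Fin n) λ x → lookup l x ≡ nothing

point : ∀ {A : Set} {n} → Vec (Maybe A) n → A → Vec A n
point l a = Vec.map (fromMaybe a) l

constant : ∀ {A : Set} {n} → Vec A n → Vec (Maybe A) n
constant = Vec.map just

point-constant : ∀ {A : Set} {n} (v : Vec A n) a → point (constant v) a ≡ v
point-constant v a = trans (sym (Vec.map-∘ _ just v)) (Vec.map-id v)

point-++ : ∀ {A : Set} {m n} (l : Vec (Maybe A) m) (l′ : Vec (Maybe A) n) a →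
           point (l ++ l′) a ≡ point l a ++ point l′ a
point-++ l l′ a = Vec.map-++ (fromMaybe a) l l′

point-map : ∀ {A B : Set} {n} (f : A → B) (l : Vec (Maybe A) n) a →
            point (Vec.map (Maybe.map f) l) (f a) ≡ Vec.map f (point l a)
point-map f l a = trans (sym (Vec.map-∘ _ _ l)) (trans (Vec.map-cong lemma l) (Vec.map-∘ f _ l))
  where
  lemma : ∀ x → fromMaybe (f a) (Maybe.map f x) ≡ f (fromMaybe a x)
  lemma nothing  = refl
  lemma (just _) = refl

moving-++ˡ : ∀ {A : Set} {m n} (l : Vec (Maybe A) m) (l′ : Vec (Maybe A) n) → Moving l → Moving (l ++ l′)
moving-++ˡ l l′ (x , eq) = x Fin.↑ˡ _ , trans (Vec.lookup-++ˡ l l′ x) eq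

moving-++ʳ : ∀ {A : Set} {m n} (l : Vec (Maybe A) m) (l′ : Vec (Maybe A) n) → Moving l′ → Moving (l ++ l′)
moving-++ʳ {m = m} l l′ (x , eq) = m Fin.↑ʳ x , trans (Vec.lookup-++ʳ l l′ x) eq

moving-map : ∀ {A B : Set} {n} (f : A → B) (l : Vec (Maybe A) n) → Moving l → Moving (Vec.map (Maybe.map f) l)
moving-map f l (x , eq) = x , trans (Vec.lookup-map x _ l) (cong (Maybe.map f) eq)

MonoLine : ∀ {q n} {C : Set} → (Vec (Fin q) n → C) → Set
MonoLine {q} {n} {C} Φ = Σ (Vec (Maybe (Fin q)) n) λ l → Moving l × Σ C λ α → ∀ e → Φ (point l e) ≡ α

HJ : ℕ → Set₁
HJ q = ∀ {C} → Finite C → Σ ℕ λ n → (Φ : Vec (Fin q) n → C) → MonoLine Φ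

-- Colour focusing: the lines are monochromatic off the letter zero, in different colours,
-- and they all meet in the point f.
Focused : ∀ {q n} {C : Set} → (Vec (Fin (suc q)) n → C) → ℕ → Set
Focused {q} {n} {C} Φ s =
  Σ (Vec (Fin (suc q)) n) λ f → Σ (List C) λ cs → length cs ≡ s × Unique cs ×
    All (λ α → Σ (Vec (Maybe (Fin (suc q))) n) λ l →
           Moving l × point l zero ≡ f × (∀ e → Φ (point l (suc e)) ≡ α)) cs

-- A word in the second block is coloured by the function it induces on the first block. The theorem
-- for the smaller alphabet makes this function constant along the nonzero letters of a line `l₁`,
-- and the induction hypothesis is applied to it. If the colour of the focus is already that of a
-- focused line, this line becomes monochromatic at the letter zero too; otherwise
-- `constant f ++ l₁` is a further line, with a new colour.
focusing : ∀ {q} → HJ (suc q) → ∀ {C} → Finite C → ∀ s →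
           Σ ℕ λ n → (Φ : Vec (Fin (suc (suc q))) n → C) → MonoLine Φ ⊎ Focused Φ s
focusing hj FC zero = 0 , λ Φ → inj₂ ([] , [] , refl , [] , [])
focusing {q} hj {C} FC (suc s) = m + n , step
  where
  m = proj₁ (focusing hj FC s)
  Words = finite-Vec (finite-Fin (suc (suc q))) m
  n = proj₁ (hj (finite-Vec FC (size Words)))
  step : (Φ : Vec (Fin (suc (suc q))) (m + n) → C) → MonoLine Φ ⊎ Focused Φ (suc s)
  step Φ with proj₂ (hj (finite-Vec FC (size Words))) (λ v → table Words (λ u → Φ (u ++ Vec.map suc v)))
  ... | l₀ , mv₀ , β , mono₀ = result (proj₂ (focusing hj FC s) Φ′)
    where
    l₁ = Vec.map (Maybe.map suc) l₀
    w₁ = point l₁ (suc zero)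
    Φ′ : Vec (Fin (suc (suc q))) m → C
    Φ′ u = Φ (u ++ w₁)
    indep : ∀ u e → Φ (u ++ point l₁ (suc e)) ≡ Φ′ u
    indep u e = trans (cong (Φ ∘ (u ++_)) (point-map suc l₀ e))
      (trans (table-injective Words (trans (mono₀ e) (sym (mono₀ zero))) u)
             (cong (Φ ∘ (u ++_)) (sym (point-map suc l₀ zero))))
    result : MonoLine Φ′ ⊎ Focused Φ′ s → MonoLine Φ ⊎ Focused Φ (suc s)
    result (inj₁ (l , mv , α , mono)) =
      inj₁ (l ++ constant w₁ , moving-++ˡ l _ mv , α , λ e →
        trans (cong Φ (trans (point-++ l (constant w₁) e) (cong (point l e ++_) (point-constant w₁ e)))) (mono e))
    result (inj₂ (f , cs , len , uniq , lines)) with Any.any? (Finite._≟_ FC (Φ′ f)) cs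
    ... | yes Φf∈cs with All.lookup lines Φf∈cs
    ...   | l , mv , l0 , mono = inj₁ (l ++ constant w₁ , moving-++ˡ l _ mv , Φ′ f , λ e →
        trans (cong Φ (trans (point-++ l (constant w₁) e) (cong (point l e ++_) (point-constant w₁ e)))) (mono′ e))
      where
      mono′ : ∀ e → Φ′ (point l e) ≡ Φ′ f
      mono′ zero    = cong Φ′ l0
      mono′ (suc e) = mono e
    result (inj₂ (f , cs , len , uniq , lines)) | no Φf∉cs =
      inj₂ (f ++ point l₁ zero , Φ′ f ∷ cs , cong suc len , All.¬Any⇒All¬ cs Φf∉cs ∷ uniq ,
        (constant f ++ l₁ , moving-++ʳ (constant f) l₁ (moving-map suc l₀ mv₀) ,
          trans (point-++ (constant f) l₁ zero) (cong (_++ point l₁ zero) (point-constant f zero)) ,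
          λ e → trans (cong Φ (trans (point-++ (constant f) l₁ (suc e))
                                     (cong (_++ point l₁ (suc e)) (point-constant f (suc e))))) (indep f e))
        ∷ All.map (λ (l , mv , l0 , mono) → l ++ l₁ , moving-++ˡ l l₁ mv ,
            trans (point-++ l l₁ zero) (cong (_++ point l₁ zero) l0) ,
            λ e → trans (cong Φ (point-++ l l₁ (suc e))) (trans (indep (point l (suc e)) e) (mono e))) lines)

-- More focused lines than colours cannot have pairwise different colours, so focusing must end in a
-- monochromatic line.
hales-jewett : ∀ q → HJ (suc q)
hales-jewett zero FC = 1 , λ Φ → nothing ∷ [] , (zero , refl) , Φ (zero ∷ []) , λ { zero → refl }
hales-jewett (suc q) {C} FC = proj₁ foc , λ Φ → [ id , (λ F → ⊥-elim (absurd {Φ = Φ} F)) ]′ (proj₂ foc Φ)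
  where
  foc = focusing (hales-jewett q) FC (suc (size FC))
  absurd : ∀ {n} {Φ : Vec (Fin (suc (suc q))) n → C} → ¬ Focused Φ (suc (size FC))
  absurd (f , cs , len , uniq , _) = ℕ.<-irrefl refl (subst (_≤ size FC) len (unique-length FC uniq))

-- Ramsey's theorem for r-element sublists

module _ {C : Set} (FC : Finite C) where

  Homogeneous : ∀ {A : Set} → ℕ → (List A → C) → List A → Set
  Homogeneous r χ ys = Σ C λ α → ∀ zs → zs ⊆ ys → length zs ≡ r → χ zs ≡ α

  -- The colour of a sublist of length `suc r` is decided by its first entry, and this colour is
  -- stored beside the entry.
  EndHomogeneous : ∀ {A : Set} → ℕ → (List A → C) → List (A × C) → Set
  EndHomogeneous r χ []             = ⊤
  EndHomogeneous r χ ((x , α) ∷ ps) =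
    (∀ zs → zs ⊆ List.map proj₁ ps → length zs ≡ r → χ (x ∷ zs) ≡ α) × EndHomogeneous r χ ps

  endHomogeneous-⊆ : ∀ {A : Set} r (χ : List A → C) {ps qs} → qs ⊆ ps → EndHomogeneous r χ ps → EndHomogeneous r χ qs
  endHomogeneous-⊆ r χ []         _       = tt
  endHomogeneous-⊆ r χ (_ ∷ʳ s)   (_ , h) = endHomogeneous-⊆ r χ s h
  endHomogeneous-⊆ r χ (refl ∷ s) (e , h) =
    (λ zs zs⊆ → e zs (⊆-trans zs⊆ (Sub.map⁺ proj₁ s))) , endHomogeneous-⊆ r χ s h

  endHomogeneous-mono : ∀ {A : Set} r (χ : List A → C) {α} ps → EndHomogeneous r χ ps → All (λ p → proj₂ p ≡ α) ps →
                        ∀ zs → zs ⊆ List.map proj₁ ps → length zs ≡ suc r → χ zs ≡ α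
  endHomogeneous-mono r χ []       _       _           []       []         ()
  endHomogeneous-mono r χ (_ ∷ ps) (_ , h) (_ ∷ cs)    zs       (_ ∷ʳ s)   len  = endHomogeneous-mono r χ ps h cs zs s len
  endHomogeneous-mono r χ (_ ∷ ps) (e , _) (refl ∷ cs) (z ∷ zs) (refl ∷ s) len = e zs s (ℕ.suc-injective len)

  majority : ∀ {A : Set} s es (ps : List (A × C)) → All (λ p → proj₂ p ∈ es) ps → length es * s < length ps →
             Σ C λ α → s ≤ length (filter (λ p → Finite._≟_ FC (proj₂ p) α) ps)
  majority s [] (p ∷ ps) (() ∷ _) lt
  majority s (α ∷ es) ps ps∈ lt with s ≤? length (filter (λ p → Finite._≟_ FC (proj₂ p) α) ps)
  ... | yes s≤ = α , s≤
  ... | no s≰ = let (β , s≤) = majority s es rest rest∈ rest-long in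
                β , ℕ.≤-trans s≤ (Sub.length-mono-≤ (Sub.filter⁺ _ _ (λ { refl q → q }) (Sub.filter-⊆ (¬? ∘ α?) ps)))
    where
    α? = λ p → Finite._≟_ FC (proj₂ p) α
    rest = filter (¬? ∘ α?) ps
    split : ∀ ps → length (filter α? ps) + length (filter (¬? ∘ α?) ps) ≡ length ps
    split [] = refl
    split (p ∷ ps) with α? p
    ... | yes _ = cong suc (split ps)
    ... | no _  = trans (ℕ.+-suc _ _) (cong suc (split ps))
    rest∈ : All (λ p → proj₂ p ∈ es) rest
    rest∈ = All.zipWith (λ { (here eq , ne) → ⊥-elim (ne eq) ; (there q , _) → q })
              (All.filter⁺ (¬? ∘ α?) ps∈ , All.all-filter (¬? ∘ α?) ps)
    rest-long : length es * s < length rest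
    rest-long = ℕ.+-cancelˡ-< s _ _ (ℕ.<-≤-trans lt
      (ℕ.≤-trans (ℕ.≤-reflexive (sym (split ps))) (ℕ.+-monoˡ-≤ _ (ℕ.<⇒≤ (ℕ.≰⇒> s≰)))))

  -- The case `r`, applied to the tail after each chosen entry, yields an end-homogeneous list. Once
  -- it is longer than `size FC * s`, by pigeonhole `s` of its entries carry the same colour.
  ramsey : ∀ r s → Σ ℕ λ n → ∀ {A : Set} (xs : List A) → n ≤ length xs → (χ : List A → C) →
           Σ (List A) λ ys → ys ⊆ xs × s ≤ length ys × Homogeneous r χ ys
  ramsey zero s = s , λ xs s≤ χ → xs , ⊆-refl , s≤ , χ [] , λ { [] _ _ → refl }
  ramsey (suc r) s = n , λ xs n≤ χ → homogenise χ xs (proj₂ (pre (suc (size FC * s))) xs n≤ χ)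
    where
    pre : ∀ L → Σ ℕ λ n → ∀ {A : Set} (xs : List A) → n ≤ length xs → (χ : List A → C) →
          Σ (List (A × C)) λ ps → List.map proj₁ ps ⊆ xs × L ≤ length ps × EndHomogeneous r χ ps
    pre zero = 0 , λ xs _ χ → [] , Sub.[]⊆-universal xs , z≤n , tt
    pre (suc L) = suc (proj₁ (ramsey r (proj₁ (pre L)))) , λ where
      (x ∷ xs) (s≤s n≤) χ →
        let (ys , ys⊆ , long , α , hom) = proj₂ (ramsey r (proj₁ (pre L))) xs n≤ (χ ∘ (x ∷_))
            (ps , ps⊆ , L≤ , end) = proj₂ (pre L) ys long χ
        in (x , α) ∷ ps , refl ∷ ⊆-trans ps⊆ ys⊆ , s≤s L≤ , (λ zs zs⊆ → hom zs (⊆-trans zs⊆ ps⊆)) , end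
    n = proj₁ (pre (suc (size FC * s)))
    homogenise : ∀ {A : Set} (χ : List A → C) xs →
                 (Σ (List (A × C)) λ ps → List.map proj₁ ps ⊆ xs × suc (size FC * s) ≤ length ps × EndHomogeneous r χ ps) →
                 Σ (List A) λ ys → ys ⊆ xs × s ≤ length ys × Homogeneous (suc r) χ ys
    homogenise χ xs (ps , ps⊆ , long , end) =
      let (α , s≤) = majority s (elems FC) ps (All.universal (complete FC ∘ proj₂) ps) long
          qs = filter (λ p → Finite._≟_ FC (proj₂ p) α) ps
          qs⊆ = Sub.filter-⊆ (λ p → Finite._≟_ FC (proj₂ p) α) ps
      in List.map proj₁ qs , ⊆-trans (Sub.map⁺ proj₁ qs⊆) ps⊆ ,
         subst (s ≤_) (sym (List.length-map proj₁ qs)) s≤ , α ,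
         endHomogeneous-mono r χ qs (endHomogeneous-⊆ r χ qs⊆ end) (All.all-filter (λ p → Finite._≟_ FC (proj₂ p) α) ps)

-- Decisions, and choices of indices in a clique

does⇒ : ∀ {P : Set} (d : Dec P) → does d ≡ true → P
does⇒ (yes p) _ = p

⇒does : ∀ {P : Set} (d : Dec P) → P → does d ≡ true
⇒does (yes _) _ = refl
⇒does (no ¬p) p = ⊥-elim (¬p p)

true⇔⇒≡ : ∀ {b c : Bool} → (b ≡ true → c ≡ true) → (c ≡ true → b ≡ true) → b ≡ c
true⇔⇒≡ {true}  {_}     f g = sym (f refl)
true⇔⇒≡ {false} {true}  f g = g refl
true⇔⇒≡ {false} {false} f g = refl

opaque
  avoid : ∀ {t} (xs : List (Fin t)) → length xs < t → Σ (Fin t) λ i → ¬ i ∈ xs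
  avoid {t} xs xs<t with any? (finite-Fin t) (λ i → ¬? (Any.any? (i Fin.≟_) xs))
  ... | yes found = found
  ... | no none = ⊥-elim (ℕ.<⇒≱ xs<t (Fin.injective⇒≤ {f = λ i → index (mem i)} λ {i} {j} eq →
          trans (Any.lookup-index (mem i)) (trans (cong (List.lookup xs) eq) (sym (Any.lookup-index (mem j))))))
    where
    mem : ∀ i → i ∈ xs
    mem i with Any.any? (i Fin.≟_) xs
    ... | yes p = p
    ... | no ¬p = ⊥-elim (none (i , ¬p))

Distinct : ∀ {t} → Fin t → Fin t → Fin t → Set
Distinct i j l = i ≢ j × j ≢ l × i ≢ l

another : ∀ {t} → 3 < t → ∀ i → Σ (Fin t) λ j → i ≢ j
another 3<t i = let (j , j∉) = avoid (i ∷ []) (ℕ.≤-trans (s≤s (s≤s z≤n)) 3<t) in j , λ eq → j∉ (here (sym eq))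

third : ∀ {t} → 3 < t → ∀ i j → i ≢ j → Σ (Fin t) λ h → Distinct i j h
third 3<t i j i≢j = let (h , h∉) = avoid (i ∷ j ∷ []) (ℕ.≤-trans (s≤s (s≤s (s≤s z≤n))) 3<t)
                    in h , i≢j , (λ eq → h∉ (there (here (sym eq)))) , (λ eq → h∉ (here (sym eq)))

module _ {t} (3<t : 3 < t) {Q : Fin t → Set} (Q? : Decidable Q) (pos : ∀ {i} → Q i → Fin 3)
         (pos-inj : ∀ {i j} (p : Q i) (q : Q j) → i ≢ j → pos p ≢ pos q) where

  -- A greedy choice: by the last component, `i` fails `Q` only if `xs` already exhausts `Q`.
  pick : ∀ xs → length xs < t → Σ (Fin t) λ i → ¬ i ∈ xs × (∀ x → Q x → ¬ x ∈ xs → Q i)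
  pick xs xs<t with any? (finite-Fin t) (λ i → Q? i ×-dec ¬? (Any.any? (i Fin.≟_) xs))
  ... | yes (i , qi , i∉) = i , i∉ , λ _ _ _ → qi
  ... | no none = let (i , i∉) = avoid xs xs<t in i , i∉ , λ x qx x∉ → ⊥-elim (none (x , qx , x∉))

  no-four : ∀ {i j l x} → Distinct i j l → ¬ x ∈ i ∷ j ∷ l ∷ [] → Q i → Q j → Q l → Q x → ⊥
  no-four {i} {j} {l} {x} (i≢j , j≢l , i≢l) x∉ qi qj ql qx = ℕ.<-irrefl refl (unique-length (finite-Fin 3)
      {pos qi ∷ pos qj ∷ pos ql ∷ pos qx ∷ []}
      ((pos-inj qi qj i≢j ∷ pos-inj qi ql i≢l ∷ pos-inj qi qx (λ eq → x∉ (here (sym eq))) ∷ [])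
     ∷ (pos-inj qj ql j≢l ∷ pos-inj qj qx (λ eq → x∉ (there (here (sym eq)))) ∷ [])
     ∷ (pos-inj ql qx (λ eq → x∉ (there (there (here (sym eq))))) ∷ []) ∷ [] ∷ []))

  opaque
    -- `pos` allows at most three indices with `Q`. Padding them to three distinct indices matters
    -- because it is a triple of indices that spans an edge of the clique.
    three-cover : Σ (Fin t) λ i → Σ (Fin t) λ j → Σ (Fin t) λ l → Distinct i j l × (∀ x → Q x → x ∈ i ∷ j ∷ l ∷ [])
    three-cover with pick [] (ℕ.≤-trans (s≤s z≤n) 3<t)
    ... | i , _ , qi with pick (i ∷ []) (ℕ.≤-trans (s≤s (s≤s z≤n)) 3<t)
    ... | j , j∉ , qj with pick (j ∷ i ∷ []) (ℕ.≤-trans (s≤s (s≤s (s≤s z≤n))) 3<t)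
    ... | l , l∉ , ql = i , j , l , distinct , covered
      where
      distinct : Distinct i j l
      distinct = (λ eq → j∉ (here (sym eq))) , (λ eq → l∉ (here (sym eq))) , (λ eq → l∉ (there (here (sym eq))))
      covered : ∀ x → Q x → x ∈ i ∷ j ∷ l ∷ []
      covered x qx with Any.any? (x Fin.≟_) (i ∷ j ∷ l ∷ [])
      ... | yes p = p
      ... | no x∉ = ⊥-elim (no-four distinct x∉ (qi x qx λ ()) (qj x qx λ { (here eq) → x∉ (here eq) })
                      (ql x qx λ { (here eq) → x∉ (there (here eq)) ; (there (here eq)) → x∉ (here eq) }) qx)

-- The partite construction

module Partite (n k t : ℕ) (4≤t : 4 ≤ t) {Λ : Set} (_≟Λ_ : DecidableEquality Λ)
               (Adm : Fin n ⊎ Λ → Fin n ⊎ Λ → Set) (adm-irrefl : ∀ {x} → ¬ Adm x x) where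

  -- A coloured 3-graph on roots (the Fin n) and further labelled vertices: R u v w m says that uvw is
  -- an edge of colour m. Adm constrains which labels may occur together in an edge.
  record System : Set₁ where
    field
      W : Set
      finite-W : Finite W
      label : W → Λ
    V : Set
    V = Fin n ⊎ W
    labelV : V → Fin n ⊎ Λ
    labelV = Sum.map₂ label
    field
      R : V → V → V → Fin k → Bool
      R-sym₁₂ : ∀ u v w m → R u v w m ≡ R v u w m
      R-sym₂₃ : ∀ u v w m → R u v w m ≡ R u w v m
      R-functional : ∀ {u v w m m′} → R u v w m ≡ true → R u v w m′ ≡ true → m ≡ m′
      R-adm : ∀ {u v w m} → R u v w m ≡ true → Adm (labelV u) (labelV v)
      R-free : (g : Fin t → V) (m : Fin k) →
               (∀ i j l → Distinct i j l → R (g i) (g j) (g l) m ≡ true) → ⊥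
    finite-V : Finite V
    finite-V = finite-⊎ (finite-Fin n) finite-W
    vertex : Vec W 3 → Fin 3 ⊎ Fin n → V
    vertex e (inj₁ p) = inj₂ (lookup e p)
    vertex e (inj₂ r) = inj₁ r
  open System

  record Embedding (P Q : System) : Set where
    field
      emb : W P → W Q
      emb-label : ∀ w → label Q (emb w) ≡ label P w
    hat : V P → V Q
    hat = Sum.map₂ emb
    field
      emb-R : ∀ u v w m → R Q (hat u) (hat v) (hat w) m ≡ R P u v w m
    hat-vertex : ∀ e a → vertex Q (Vec.map emb e) a ≡ hat (vertex P e a)
    hat-vertex e (inj₁ p) = cong inj₂ (Vec.lookup-map p emb e)
    hat-vertex e (inj₂ r) = refl
  open Embedding

  -- The places `a`, `b`, `c` run over the three entries and all roots: this is isomorphism over the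
  -- roots, entry by entry.
  Alike : (P Q : System) → Vec (W P) 3 → Vec (W Q) 3 → Set
  Alike P Q e f = (∀ p → label P (lookup e p) ≡ label Q (lookup f p)) ×
    (∀ a b c m → R P (vertex P e a) (vertex P e b) (vertex P e c) m ≡ R Q (vertex Q f a) (vertex Q f b) (vertex Q f c) m)

  -- One step: the triples E span parts ℓ 0, ℓ 1, ℓ 2 and look alike together with the roots. The new system
  -- consists of one copy of P for each Hales–Jewett line over E, any two glued along the roots and along
  -- the powers of the three parts. Since the triples are alike, each copy is induced.
  module Step (P : System) (ℓ : Fin 3 → Λ) (ℓ-inj : ∀ p p′ → ℓ p ≡ ℓ p′ → p ≡ p′)
              {q : ℕ} (E : Fin (suc q) → Vec (W P) 3)
              (E-label : ∀ i p → label P (lookup (E i) p) ≡ ℓ p)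
              (E-alike : ∀ i j a b c m →
                R P (vertex P (E i) a) (vertex P (E i) b) (vertex P (E i) c) m ≡
                R P (vertex P (E j) a) (vertex P (E j) b) (vertex P (E j) c) m)
              {C : Set} (FC : Finite C) where

    N : ℕ
    N = proj₁ (hales-jewett q FC)

    Line : Set
    Line = Vec (Maybe (Fin (suc q))) N

    -- The words provide the powers of the three parts; all other vertices are duplicated, one
    -- private copy for each line. Words that mix parts and vertices of lines without a moving
    -- coordinate are present as well, but lie in no edge.
    W′ V′ : Set
    W′ = Vec (W P) N ⊎ (Line × W P)
    V′ = Fin n ⊎ W′

    finite-Line : Finite Line
    finite-Line = finite-Vec (finite-Maybe (finite-Fin (suc q))) N

    finite-W′ : Finite W′
    finite-W′ = finite-⊎ (finite-Vec (finite-W P) N) (finite-× finite-Line (finite-W P))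

    part? : ∀ w → Dec (∃ λ p → label P w ≡ ℓ p)
    part? w = any? (finite-Fin 3) (λ p → label P w ≟Λ ℓ p)

    fill : W P → Fin 3 → Maybe (Fin (suc q)) → W P
    fill w p nothing  = w
    fill w p (just i) = lookup (E i) p

    place : Line → (w : W P) → Dec (∃ λ p → label P w ≡ ℓ p) → W′
    place l w (yes (p , _)) = inj₁ (Vec.map (fill w p) l)
    place l w (no _)        = inj₂ (l , w)

    copy : Line → W P → W′
    copy l w = place l w (part? w)

    copyV : Line → V P → V′
    copyV l = Sum.map₂ (copy l)

    head-label : ∀ {N} → Vec (W P) N → Λ
    -- A default for the empty word; a moving line has at least one coordinate.
    head-label []      = ℓ zero
    head-label (w ∷ _) = label P w

    label′ : W′ → Λ
    label′ (inj₁ v)       = head-label v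
    label′ (inj₂ (_ , w)) = label P w

    labelV′ : V′ → Fin n ⊎ Λ
    labelV′ = Sum.map₂ label′

    label-fill : ∀ w p x → label P w ≡ ℓ p → label P (fill w p x) ≡ ℓ p
    label-fill w p nothing  eq = eq
    label-fill w p (just i) eq = E-label i p

    label-copy : ∀ l → Moving l → ∀ w → label′ (copy l w) ≡ label P w
    label-copy l mv w with part? w
    ... | no _ = refl
    ... | yes (p , eq) = go l mv
      where
      go : ∀ {N} (l : Vec (Maybe (Fin (suc q))) N) → Moving l → head-label (Vec.map (fill w p) l) ≡ label P w
      go (x ∷ l) _ = trans (label-fill w p x eq) (sym eq)

    label-copyV : ∀ l → Moving l → ∀ u → labelV′ (copyV l u) ≡ labelV P u
    label-copyV l mv (inj₁ r) = refl
    label-copyV l mv (inj₂ w) = cong inj₂ (label-copy l mv w)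

    fillV : V P → Fin 3 ⊎ Fin n → Maybe (Fin (suc q)) → V P
    fillV u a nothing  = u
    fillV u a (just i) = vertex P (E i) a

    -- A vertex common to two copies is private, which determines line and vertex, or a root, or a
    -- word. In the last two cases `a` is the root or the part, and equality can be read off at each
    -- coordinate.
    copy-overlap : ∀ l l′ → Moving l → ∀ u u′ → copyV l u ≡ copyV l′ u′ →
      (l ≡ l′ × u ≡ u′) ⊎ (Σ (Fin 3 ⊎ Fin n) λ a → ∀ x → fillV u a (lookup l x) ≡ fillV u′ a (lookup l′ x))
    copy-overlap l l′ mv (inj₁ r) (inj₁ .r) refl = inj₂ (inj₂ r , λ x → trans (root (lookup l x)) (sym (root (lookup l′ x))))
      where
      root : ∀ y → fillV (inj₁ r) (inj₂ r) y ≡ inj₁ r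
      root nothing  = refl
      root (just _) = refl
    copy-overlap l l′ (x₀ , _) (inj₂ w) (inj₂ w′) eq with part? w | part? w′
    ... | yes (p , lp) | yes (p′ , lp′) =
      inj₂ (inj₁ p , λ x → trans (word w (lookup l x)) (trans (cong inj₂ (trans (fills x) (cong (λ p → fill w′ p (lookup l′ x)) (sym p≡p′))))
                                                              (sym (word w′ (lookup l′ x)))))
      where
      fills : ∀ x → fill w p (lookup l x) ≡ fill w′ p′ (lookup l′ x)
      fills x = trans (sym (Vec.lookup-map x _ l))
        (trans (cong (λ v → lookup v x) (Sum.inj₁-injective (Sum.inj₂-injective eq))) (Vec.lookup-map x _ l′))
      -- The moving coordinate `x₀` ensures that the words are nonempty; the labels there identify
      -- the part.
      p≡p′ : p ≡ p′
      p≡p′ = ℓ-inj p p′ (trans (sym (label-fill w p (lookup l x₀) lp))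
                               (trans (cong (label P) (fills x₀)) (label-fill w′ p′ (lookup l′ x₀) lp′)))
      word : ∀ w y → fillV (inj₂ w) (inj₁ p) y ≡ inj₂ (fill w p y)
      word w nothing  = refl
      word w (just _) = refl
    ... | no _ | no _ with refl ← eq = inj₁ (refl , refl)
    copy-overlap l l′ _ (inj₂ w) (inj₂ w′) () | yes _ | no _
    copy-overlap l l′ _ (inj₂ w) (inj₂ w′) () | no _  | yes _

    copyV-injective : ∀ l → Moving l → ∀ {u u′} → copyV l u ≡ copyV l u′ → u ≡ u′
    copyV-injective l (x , lx) {u} {u′} eq with copy-overlap l l (x , lx) u u′ eq
    ... | inj₁ (_ , u≡u′) = u≡u′
    ... | inj₂ (a , fills) = subst (λ y → fillV u a y ≡ fillV u′ a y) lx (fills x)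

    -- A private vertex forces `l ≡ l′`. Otherwise take a coordinate where `l` moves: either `l′`
    -- moves there too and the vertices coincide, or `l′` has a letter `i` and `u`, `v`, `w` are
    -- places of the triple `E i`. In the same way `u′`, `v′`, `w′` are the same places of some
    -- `E j`, and `E i`, `E j` are alike.
    copies-agree : ∀ l l′ → Moving l → Moving l′ → ∀ {u u′ v v′ w w′} →
      copyV l u ≡ copyV l′ u′ → copyV l v ≡ copyV l′ v′ → copyV l w ≡ copyV l′ w′ →
      ∀ m → R P u v w m ≡ R P u′ v′ w′ m
    copies-agree l l′ mv mv′ {u} {u′} {v} {v′} {w} {w′} eu ev ew m
      with copy-overlap l l′ mv u u′ eu | copy-overlap l l′ mv v v′ ev | copy-overlap l l′ mv w w′ ew
    ... | inj₁ (refl , refl) | _ | _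
      rewrite copyV-injective l mv {v} {v′} ev | copyV-injective l mv {w} {w′} ew = refl
    ... | inj₂ _ | inj₁ (refl , refl) | _
      rewrite copyV-injective l mv {u} {u′} eu | copyV-injective l mv {w} {w′} ew = refl
    ... | inj₂ _ | inj₂ _ | inj₁ (refl , refl)
      rewrite copyV-injective l mv {u} {u′} eu | copyV-injective l mv {v} {v′} ev = refl
    ... | inj₂ (a , fa) | inj₂ (b , fb) | inj₂ (c , fc) = compare mv mv′
      where
      R-m = λ u v w → R P u v w m
      compare : Moving l → Moving l′ → R P u v w m ≡ R P u′ v′ w′ m
      compare (x , lx) (x′ , lx′) with lookup l x | lookup l′ x | lx | fa x | fb x | fc x
      ... | .nothing | nothing | refl | ea | eb | ec rewrite ea | eb | ec = refl
      ... | .nothing | just i  | refl | ea | eb | ec with lookup l′ x′ | lookup l x′ | lx′ | fa x′ | fb x′ | fc x′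
      ...   | .nothing | nothing | refl | ea′ | eb′ | ec′ rewrite ea′ | eb′ | ec′ = refl
      ...   | .nothing | just j  | refl | ea′ | eb′ | ec′ =
        trans (cong₃ R-m ea eb ec) (trans (E-alike i j a b c m) (cong₃ R-m ea′ eb′ ec′))

    Edge : V′ → V′ → V′ → Fin k → Set
    Edge u v w m = Σ Line λ l → Moving l × Σ (V P) λ u₀ → Σ (V P) λ v₀ → Σ (V P) λ w₀ →
      (copyV l u₀ ≡ u × copyV l v₀ ≡ v × copyV l w₀ ≡ w) × R P u₀ v₀ w₀ m ≡ true

    edge? : ∀ u v w m → Dec (Edge u v w m)
    edge? u v w m = any? finite-Line λ l → any? (finite-Fin N) (λ x → Maybe.≡-dec Fin._≟_ (lookup l x) nothing) ×-dec
      any? (finite-V P) λ u₀ → any? (finite-V P) λ v₀ → any? (finite-V P) λ w₀ →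
        ((copyV l u₀ ≟ u) ×-dec (copyV l v₀ ≟ v) ×-dec (copyV l w₀ ≟ w)) ×-dec (R P u₀ v₀ w₀ m Bool.≟ true)
      where open Finite (finite-⊎ (finite-Fin n) finite-W′) using (_≟_)

    opaque
      R′ : V′ → V′ → V′ → Fin k → Bool
      R′ u v w m = does (edge? u v w m)

      R′⇒ : ∀ {u v w m} → R′ u v w m ≡ true → Edge u v w m
      R′⇒ {u} {v} {w} {m} = does⇒ (edge? u v w m)

      ⇒R′ : ∀ {u v w m} → Edge u v w m → R′ u v w m ≡ true
      ⇒R′ {u} {v} {w} {m} = ⇒does (edge? u v w m)

    swap₁₂ : ∀ u v w m → R′ u v w m ≡ true → R′ v u w m ≡ true
    swap₁₂ u v w m r with R′⇒ {u} {v} {w} {m} r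
    ... | l , mv , u₀ , v₀ , w₀ , (eu , ev , ew) , r₀ =
      ⇒R′ {v} {u} {w} {m} (l , mv , v₀ , u₀ , w₀ , (ev , eu , ew) , trans (sym (R-sym₁₂ P u₀ v₀ w₀ m)) r₀)

    swap₂₃ : ∀ u v w m → R′ u v w m ≡ true → R′ u w v m ≡ true
    swap₂₃ u v w m r with R′⇒ {u} {v} {w} {m} r
    ... | l , mv , u₀ , v₀ , w₀ , (eu , ev , ew) , r₀ =
      ⇒R′ {u} {w} {v} {m} (l , mv , u₀ , w₀ , v₀ , (eu , ew , ev) , trans (sym (R-sym₂₃ P u₀ v₀ w₀ m)) r₀)

    adm′ : ∀ {u v w m} → R′ u v w m ≡ true → Adm (labelV′ u) (labelV′ v)
    adm′ {u} {v} {w} {m} r with R′⇒ {u} {v} {w} {m} r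
    ... | l , mv , u₀ , v₀ , w₀ , (eu , ev , ew) , r₀ =
      subst₂ Adm (trans (sym (label-copyV l mv u₀)) (cong labelV′ eu))
                 (trans (sym (label-copyV l mv v₀)) (cong labelV′ ev)) (R-adm P r₀)

    functional′ : ∀ {u v w m m′} → R′ u v w m ≡ true → R′ u v w m′ ≡ true → m ≡ m′
    functional′ {u} {v} {w} {m} {m′} r r′ with R′⇒ {u} {v} {w} {m} r | R′⇒ {u} {v} {w} {m′} r′
    ... | l , mv , _ , _ , _ , (eu , ev , ew) , r₀ | l′ , mv′ , _ , _ , _ , (eu′ , ev′ , ew′) , r₀′ =
      R-functional P r₀ (trans (copies-agree l l′ mv mv′ (trans eu (sym eu′)) (trans ev (sym ev′)) (trans ew (sym ew′)) m′) r₀′)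

    module Clique (g : Fin t → V′) (m : Fin k)
                  (clique : ∀ i j l → Distinct i j l → R′ (g i) (g j) (g l) m ≡ true) where

      Covers : Line → Fin t → Set
      Covers l i = Σ (V P) λ u → copyV l u ≡ g i

      triple : ∀ {i j h} → Distinct i j h → Σ Line λ l → Moving l × Covers l i × Covers l j × Covers l h
      triple {i} {j} {h} d with R′⇒ {g i} {g j} {g h} {m} (clique i j h d)
      ... | l , mv , u , v , w , (eu , ev , ew) , _ = l , mv , (u , eu) , (v , ev) , (w , ew)

      pair : ∀ {i j} → i ≢ j → Σ Line λ l → Moving l × Covers l i × Covers l j
      pair {i} {j} i≢j = let (h , d) = third 4≤t i j i≢j
                             (l , mv , ci , cj , _) = triple d
                         in l , mv , ci , cj

      private-line : ∀ {i l w} → g i ≡ inj₂ (inj₂ (l , w)) → ∀ {l′} → Covers l′ i → l′ ≡ l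
      private-line gi (inj₁ r , eq) with () ← trans eq gi
      private-line gi (inj₂ w , eq) with part? w | trans eq gi
      ... | yes _ | ()
      ... | no _  | refl = refl

      Word : Fin t → Set
      Word i = Σ (Vec (W P) N) λ v → g i ≡ inj₂ (inj₁ v)

      shape : ∀ i → (Σ (Fin n) λ r → g i ≡ inj₁ r) ⊎ Word i ⊎ (Σ Line λ l → Σ (W P) λ w → g i ≡ inj₂ (inj₂ (l , w)))
      shape i with g i
      ... | inj₁ r              = inj₁ (r , refl)
      ... | inj₂ (inj₁ v)       = inj₂ (inj₁ (v , refl))
      ... | inj₂ (inj₂ (l , w)) = inj₂ (inj₂ (l , w , refl))

      -- Every vertex of the clique is in an edge, hence in a copy, and the words of a copy stay
      -- inside one part.
      word-part : ∀ {i} → Word i → Σ (Fin 3) λ p → labelV′ (g i) ≡ inj₂ (ℓ p)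
      word-part {i} (v , gi) with pair (proj₂ (another 4≤t i))
      ... | l , mv , (u , eq) , _ = from u (trans eq gi) (trans (sym (label-copyV l mv u)) (cong labelV′ eq))
        where
        from : ∀ u → copyV l u ≡ inj₂ (inj₁ v) → labelV P u ≡ labelV′ (g i) → Σ (Fin 3) λ p → labelV′ (g i) ≡ inj₂ (ℓ p)
        from (inj₂ w) eq lab with part? w
        ... | yes (p , wp) = p , trans (sym lab) (cong inj₂ wp)
        from (inj₂ w) () lab | no _

      word? : Decidable Word
      word? i with shape i
      ... | inj₁ (r , eq)              = no λ (v , eq′) → case-root (trans (sym eq) eq′)
        where
        case-root : ∀ {r v} → inj₁ r ≡ inj₂ (inj₁ v) → ⊥
        case-root ()
      ... | inj₂ (inj₁ w)              = yes w
      ... | inj₂ (inj₂ (l , w , eq)) = no λ (v , eq′) → case-private (trans (sym eq) eq′)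
        where
        case-private : ∀ {x v} → _≡_ {A = V′} (inj₂ (inj₂ x)) (inj₂ (inj₁ v)) → ⊥
        case-private ()

      private? : Decidable (λ i → Σ Line λ l → Σ (W P) λ w → g i ≡ inj₂ (inj₂ (l , w)))
      private? i with shape i
      ... | inj₁ (r , eq)            = no λ (_ , _ , eq′) → case-root (trans (sym eq) eq′)
        where
        case-root : ∀ {r x} → inj₁ r ≡ inj₂ (inj₂ x) → ⊥
        case-root ()
      ... | inj₂ (inj₁ (v , eq))     = no λ (_ , _ , eq′) → case-word (trans (sym eq) eq′)
        where
        case-word : ∀ {x v} → _≡_ {A = V′} (inj₂ (inj₁ v)) (inj₂ (inj₂ x)) → ⊥
        case-word ()
      ... | inj₂ (inj₂ p)            = yes p

      Private : Fin t → Set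
      Private i = Σ Line λ l → Σ (W P) λ w → g i ≡ inj₂ (inj₂ (l , w))

      -- A private vertex lies in one copy only, and every other vertex of the clique shares an edge
      -- with it.
      private-copy : ∀ i₀ → Private i₀ → Σ Line λ l → Moving l × ∀ i → Covers l i
      private-copy i₀ (l , w , gi) = l , proj₁ (joint (proj₂ (another 4≤t i₀))) , λ i → covers i (i₀ Fin.≟ i)
        where
        joint : ∀ {j} → i₀ ≢ j → Moving l × Covers l i₀ × Covers l j
        joint ne = let (l′ , mv , ci , cj) = pair ne in
          subst (λ l → Moving l × Covers l i₀ × Covers l _) (private-line gi ci) (mv , ci , cj)
        covers : ∀ i → Dec (i₀ ≡ i) → Covers l i
        covers i (yes eq) = subst (Covers l) eq (proj₁ (proj₂ (joint (proj₂ (another 4≤t i₀)))))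
        covers i (no ne)  = proj₂ (proj₂ (joint ne))

      parts-differ : ∀ {i j} (p : Word i) (q : Word j) → i ≢ j → proj₁ (word-part p) ≢ proj₁ (word-part q)
      parts-differ {i} {j} p q i≢j eq =
        let (h , d) = third 4≤t i j i≢j
        in adm-irrefl (subst (Adm (labelV′ (g i)))
             (trans (proj₂ (word-part q)) (trans (cong (inj₂ ∘ ℓ) (sym eq)) (sym (proj₂ (word-part p)))))
             (adm′ {g i} {g j} {g h} {m} (clique i j h d)))

      -- The words lie in different parts, so there are at most three of them. An edge of the clique
      -- through all of them belongs to one copy, and the remaining vertices are roots.
      shared-copy : (∀ i → ¬ Private i) → Σ Line λ l → Moving l × ∀ i → Covers l i
      shared-copy none =
        let (i , j , h , d , cover) = three-cover 4≤t word? (λ {i} p → proj₁ (word-part {i} p)) (λ {i} {j} → parts-differ {i} {j})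
            (l , mv , ci , cj , ch) = triple d
        in l , mv , λ x → covers ci cj ch x (cover x) (shape x)
        where
        covers : ∀ {l i j h} → Covers l i → Covers l j → Covers l h → ∀ x → (Word x → x ∈ i ∷ j ∷ h ∷ []) →
                 (Σ (Fin n) λ r → g x ≡ inj₁ r) ⊎ Word x ⊎ Private x → Covers l x
        covers ci cj ch x cover (inj₁ (r , eq))      = inj₁ r , sym eq
        covers ci cj ch x cover (inj₂ (inj₂ priv))   = ⊥-elim (none x priv)
        covers {l} {i} {j} {h} ci cj ch x cover (inj₂ (inj₁ word)) = from (cover word)
          where
          from : x ∈ i ∷ j ∷ h ∷ [] → Covers l x
          from (here eq)                 = subst (Covers l) (sym eq) ci
          from (there (here eq))         = subst (Covers l) (sym eq) cj
          from (there (there (here eq))) = subst (Covers l) (sym eq) ch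

      one-copy : Σ Line λ l → Moving l × ∀ i → Covers l i
      one-copy = from (any? (finite-Fin t) private?)
        where
        from : Dec (∃ Private) → Σ Line λ l → Moving l × ∀ i → Covers l i
        from (yes (i , priv)) = private-copy i priv
        from (no none)        = shared-copy (λ i priv → none (i , priv))

      -- One copy covers all vertices, but the edges between them may stem from other copies;
      -- `copies-agree` moves them into this one.
      contradictory : ⊥
      contradictory with one-copy
      ... | l , mv , cov = R-free P (proj₁ ∘ cov) m λ i j h d → pull-back d
        where
        pull-back : ∀ {i j h} → Distinct i j h → R P (proj₁ (cov i)) (proj₁ (cov j)) (proj₁ (cov h)) m ≡ true
        pull-back {i} {j} {h} d with R′⇒ {g i} {g j} {g h} {m} (clique i j h d)
        ... | l′ , mv′ , _ , _ , _ , (eu , ev , ew) , r₀ =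
          trans (copies-agree l l′ mv mv′ (trans (proj₂ (cov i)) (sym eu)) (trans (proj₂ (cov j)) (sym ev))
                                          (trans (proj₂ (cov h)) (sym ew)) m) r₀

    system : System
    system = record
      { W = W′ ; finite-W = finite-W′ ; label = label′ ; R = R′
      ; R-sym₁₂ = λ u v w m → true⇔⇒≡ (swap₁₂ u v w m) (swap₁₂ v u w m)
      ; R-sym₂₃ = λ u v w m → true⇔⇒≡ (swap₂₃ u v w m) (swap₂₃ u w v m)
      ; R-functional = λ {u} {v} {w} → functional′ {u} {v} {w}
      ; R-adm = λ {u} {v} {w} → adm′ {u} {v} {w}
      ; R-free = Clique.contradictory }

    embedding : ∀ l → Moving l → Embedding P system
    embedding l mv = record { emb = copy l ; emb-label = label-copy l mv ; emb-R = λ u v w m → true⇔⇒≡ (back u v w m)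
      (λ r → ⇒R′ {copyV l u} {copyV l v} {copyV l w} {m} (l , mv , u , v , w , (refl , refl , refl) , r)) }
      where
      back : ∀ u v w m → R′ (copyV l u) (copyV l v) (copyV l w) m ≡ true → R P u v w m ≡ true
      back u v w m r with R′⇒ {copyV l u} {copyV l v} {copyV l w} {m} r
      ... | l′ , mv′ , _ , _ , _ , (eu , ev , ew) , r₀ = trans (copies-agree l l′ mv mv′ (sym eu) (sym ev) (sym ew) m) r₀

    word : Vec (Fin (suc q)) N → Vec W′ 3
    word x = Vec.tabulate λ p → inj₁ (Vec.map (λ i → lookup (E i) p) x)

    -- This is what the words are made for: along `l`, the copies of the triples `E i` run through
    -- the points of the line, so a monochromatic line gives a copy in which all of them have the
    -- same colour.
    copy-E : ∀ l i → Vec.map (copy l) (E i) ≡ word (point l i)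
    copy-E l i = trans (sym (Vec.tabulate∘lookup _)) (Vec.tabulate-cong λ p → trans (Vec.lookup-map p (copy l) (E i)) (entry p))
      where
      entry : ∀ p → copy l (lookup (E i) p) ≡ inj₁ (Vec.map (λ i → lookup (E i) p) (point l i))
      entry p with part? (lookup (E i) p)
      ... | no none = ⊥-elim (none (p , E-label i p))
      ... | yes (p′ , eq) with refl ← ℓ-inj p p′ (trans (sym (E-label i p)) eq) =
        cong inj₁ (trans (Vec.map-cong same l) (Vec.map-∘ _ _ l))
        where
        same : ∀ y → fill (lookup (E i) p) p y ≡ lookup (E (fromMaybe i y)) p
        same nothing  = refl
        same (just _) = refl

    mono-copy : (Φ : Vec W′ 3 → C) → Σ (Embedding P system) λ e → Σ C λ α → ∀ i → Φ (Vec.map (emb e) (E i)) ≡ α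
    mono-copy Φ with proj₂ (hales-jewett q FC) (Φ ∘ word)
    ... | l , mv , α , mono = embedding l mv , α , λ i → trans (cong Φ (copy-E l i)) (mono i)

  embedding-refl : ∀ {P} → Embedding P P
  embedding-refl {P} = record { emb = id ; emb-label = λ _ → refl ; emb-R = λ u v w m → same u v w m }
    where
    id-hat : ∀ (u : Fin n ⊎ W P) → Sum.map₂ id u ≡ u
    id-hat (inj₁ _) = refl
    id-hat (inj₂ _) = refl
    same : ∀ u v w m → R P (Sum.map₂ id u) (Sum.map₂ id v) (Sum.map₂ id w) m ≡ R P u v w m
    same u v w m rewrite id-hat u | id-hat v | id-hat w = refl

  embedding-trans : ∀ {P Q S} → Embedding P Q → Embedding Q S → Embedding P S
  embedding-trans {P} {Q} {S} e f = record
    { emb = emb f ∘ emb e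
    ; emb-label = λ w → trans (emb-label f _) (emb-label e w)
    ; emb-R = λ u v w m → trans (same u v w m) (trans (emb-R f _ _ _ m) (emb-R e u v w m)) }
    where
    hat-∘ : ∀ (u : V P) → Sum.map₂ (emb f ∘ emb e) u ≡ hat f (hat e u)
    hat-∘ (inj₁ _) = refl
    hat-∘ (inj₂ _) = refl
    same : ∀ u v w m → R S (Sum.map₂ (emb f ∘ emb e) u) (Sum.map₂ (emb f ∘ emb e) v) (Sum.map₂ (emb f ∘ emb e) w) m
                     ≡ R S (hat f (hat e u)) (hat f (hat e v)) (hat f (hat e w)) m
    same u v w m rewrite hat-∘ u | hat-∘ v | hat-∘ w = refl

  alike-emb : ∀ {P Q S} (e : Embedding P Q) {x : Vec (W P) 3} {y : Vec (W S) 3} → Alike P S x y → Alike Q S (Vec.map (emb e) x) y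
  alike-emb {P} {Q} {S} e {x} {y} (labels , same) =
    (λ p → trans (cong (label Q) (Vec.lookup-map p (emb e) x)) (trans (emb-label e _) (labels p))) ,
    λ a b c m → trans (moved a b c m) (trans (emb-R e _ _ _ m) (same a b c m))
    where
    moved : ∀ a b c m → R Q (vertex Q (Vec.map (emb e) x) a) (vertex Q (Vec.map (emb e) x) b) (vertex Q (Vec.map (emb e) x) c) m
                      ≡ R Q (hat e (vertex P x a)) (hat e (vertex P x b)) (hat e (vertex P x c)) m
    moved a b c m rewrite hat-vertex e x a | hat-vertex e x b | hat-vertex e x c = refl

  alike? : ∀ P Q x y → Dec (Alike P Q x y)
  alike? P Q x y = all? (finite-Fin 3) (λ p → label P (lookup x p) ≟Λ label Q (lookup y p)) ×-dec
    all? places λ a → all? places λ b → all? places λ c → all? (finite-Fin k) λ m → _ Bool.≟ _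
    where places = finite-⊎ (finite-Fin 3) (finite-Fin n)

  module _ (P₀ : System) {C : Set} (FC : Finite C) where

    DistinctLabels : Vec (W P₀) 3 → Set
    DistinctLabels r = ∀ p p′ → label P₀ (lookup r p) ≡ label P₀ (lookup r p′) → p ≡ p′

    -- The amalgamation is applied to the family of all triples of `P` alike to `r`, so the
    -- monochromatic copy settles this type completely.
    step : (P : System) (r : Vec (W P₀) 3) → DistinctLabels r → Σ System λ Q →
           (Φ : Vec (W Q) 3 → C) → Σ (Embedding P Q) λ e → ∀ x y → Alike P P₀ x r → Alike P P₀ y r →
           Φ (Vec.map (emb e) x) ≡ Φ (Vec.map (emb e) y)
    step P r distinct = go (filter (λ x → alike? P P₀ x r) (elems F)) (All.all-filter (λ x → alike? P P₀ x r) (elems F))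
                           (λ x al → ∈.∈-filter⁺ (λ x → alike? P P₀ x r) (complete F x) al)
      where
      F = finite-Vec (finite-W P) 3
      go : ∀ xs → All (λ x → Alike P P₀ x r) xs → (∀ x → Alike P P₀ x r → x ∈ xs) → Σ System λ Q →
           (Φ : Vec (W Q) 3 → C) → Σ (Embedding P Q) λ e → ∀ x y → Alike P P₀ x r → Alike P P₀ y r →
           Φ (Vec.map (emb e) x) ≡ Φ (Vec.map (emb e) y)
      go [] _ none = P , λ Φ → embedding-refl , λ x y ax ay → ⊥-elim (no-∈ (none x ax))
        where
        no-∈ : ∀ {x : Vec (W P) 3} → ¬ x ∈ []
        no-∈ ()
      go (x₀ ∷ xs) alikes every = S.system , λ Φ →
        let (e , α , mono) = S.mono-copy Φ
            value = λ x (ax : Alike P P₀ x r) → trans (cong (Φ ∘ Vec.map (emb e)) (Any.lookup-index (every x ax))) (mono (index (every x ax)))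
        in e , λ x y ax ay → trans (value x ax) (sym (value y ay))
        where
        triples = List.lookup (x₀ ∷ xs)
        triples-alike : ∀ i → Alike P P₀ (triples i) r
        triples-alike i = All.lookup alikes (∈-lookup i)
        module S = Step P (λ p → label P₀ (lookup r p)) distinct triples (λ i → proj₁ (triples-alike i))
                        (λ i j a b c m → trans (proj₂ (triples-alike i) a b c m) (sym (proj₂ (triples-alike j) a b c m))) FC

    -- One step for each type. For a given `Φ` the copies are selected from the outside inwards:
    -- first a copy of `Q` good for `r`, then inside it a copy of `P₀` good for `rs`. The first gain
    -- is kept, since embeddings preserve being alike.
    iterate : (rs : List (Vec (W P₀) 3)) → Σ System λ Q → (Φ : Vec (W Q) 3 → C) → Σ (Embedding P₀ Q) λ e →
              ∀ r → r ∈ rs → DistinctLabels r → ∀ x → Alike P₀ P₀ x r → Φ (Vec.map (emb e) x) ≡ Φ (Vec.map (emb e) r)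
    iterate [] = P₀ , λ Φ → embedding-refl , λ r ()
    iterate (r ∷ rs) with iterate rs | all? (finite-Fin 3) (λ p → all? (finite-Fin 3) λ p′ → distinct? p p′)
      where
      distinct? : ∀ p p′ → Dec (label P₀ (lookup r p) ≡ label P₀ (lookup r p′) → p ≡ p′)
      distinct? p p′ with p Fin.≟ p′ | label P₀ (lookup r p) ≟Λ label P₀ (lookup r p′)
      ... | yes eq | _      = yes λ _ → eq
      ... | no ne  | yes eq = no λ f → ne (f eq)
      ... | no _   | no ne  = yes λ eq → ⊥-elim (ne eq)
    ... | Q , ramsey-Q | no ¬d = Q , λ Φ → let (e , hom) = ramsey-Q Φ in
      e , λ { _ (here refl) d → ⊥-elim (¬d d) ; r (there r∈) → hom r r∈ }
    ... | Q , ramsey-Q | yes d with step Q r d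
    ...   | S , ramsey-S = S , λ Φ →
      let (f , homf) = ramsey-S Φ
          (e , home) = ramsey-Q (Φ ∘ Vec.map (emb f))
          swap = λ x → cong Φ (Vec.map-∘ (emb f) (emb e) x)
          same : Alike P₀ P₀ r r
          same = (λ _ → refl) , (λ _ _ _ _ → refl)
      in embedding-trans e f , λ where
        _ (here refl) _ x al → trans (swap x) (trans (homf _ _ (alike-emb {P₀} {Q} {P₀} e {x} {r} al) (alike-emb {P₀} {Q} {P₀} e {r} {r} same)) (sym (swap r)))
        r′ (there r∈) d′ x al → trans (swap x) (trans (home r′ r∈ d′ x al) (sym (swap r′)))

    partite : Σ System λ Q → (Φ : Vec (W Q) 3 → C) → Σ (Embedding P₀ Q) λ e →
              ∀ r → DistinctLabels r → ∀ x → Alike P₀ P₀ x r → Φ (Vec.map (emb e) x) ≡ Φ (Vec.map (emb e) r)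
    partite = let (Q , hom) = iterate (elems F) in Q , λ Φ → let (e , h) = hom Φ in e , λ r → h r (complete F r)
      where F = finite-Vec (finite-W P₀) 3

-- Counting on finite sets, and the kinds of positions

finite-retract : ∀ {A B : Set} → Finite A → (f : A → B) (g : B → A) → (∀ b → f (g b) ≡ b) → Finite B
finite-retract FA f g fg = record
  { elems = List.map f (elems FA)
  ; complete = λ b → subst (_∈ List.map f (elems FA)) (fg b) (∈-map⁺ f (complete FA (g b)))
  ; _≟_ = λ b b′ → map′ (λ eq → trans (sym (fg b)) (trans (cong f eq) (fg b′))) (cong g) (Finite._≟_ FA (g b) (g b′)) }

opaque
  injective⇒surjective : ∀ {t} (f : Fin t → Fin t) → (∀ {i j} → i ≢ j → f i ≢ f j) → ∀ y → ∃ λ i → f i ≡ y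
  injective⇒surjective {suc t} f f-inj y with any? (finite-Fin (suc t)) (λ i → f i Fin.≟ y)
  ... | yes found = found
  ... | no none = ⊥-elim (ℕ.<-irrefl refl (Fin.injective⇒≤ {f = λ i → Fin.punchOut (λ eq → none (i , sym eq))} λ {i} {j} eq →
          inj i j (Fin.punchOut-injective {i = y} (λ eq → none (i , sym eq)) (λ eq → none (j , sym eq)) eq)))
    where
    inj : ∀ i j → f i ≡ f j → i ≡ j
    inj i j eq with i Fin.≟ j
    ... | yes i≡j = i≡j
    ... | no i≢j = ⊥-elim (f-inj i≢j eq)

data Kind : Set where
  special ordinary dummy : Kind

-- The weights make the type of a triple depend on the sum of the weights only, hence symmetric.
weight : Kind → ℕ
weight special  = 0
weight ordinary = 1
weight dummy    = 4

weight-0 : ∀ u → weight u ≡ 0 → u ≡ special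
weight-0 special _ = refl

kindℕ : ℕ → ℕ → ℕ → Kind
kindℕ b e p with p <? b | p <? b + e
... | yes _ | _     = special
... | no _  | yes _ = ordinary
... | no _  | no _  = dummy

kindℕ-special : ∀ {b} e {p} → p < b → kindℕ b e p ≡ special
kindℕ-special {b} e {p} p<b with p <? b | p <? b + e
... | yes _  | _ = refl
... | no p≮b | _ = ⊥-elim (p≮b p<b)

kindℕ-ordinary : ∀ {b e p} → b ≤ p → p < b + e → kindℕ b e p ≡ ordinary
kindℕ-ordinary {b} {e} {p} b≤p p<b+e with p <? b | p <? b + e
... | yes p<b | _     = ⊥-elim (ℕ.<⇒≱ p<b b≤p)
... | no _    | yes _ = refl
... | no _    | no ¬p = ⊥-elim (¬p p<b+e)

kindℕ-dummy : ∀ {b e p} → b + e ≤ p → kindℕ b e p ≡ dummy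
kindℕ-dummy {b} {e} {p} b+e≤p with p <? b | p <? b + e
... | yes p<b | _     = ⊥-elim (ℕ.<⇒≱ p<b (ℕ.≤-trans (ℕ.m≤m+n b e) b+e≤p))
... | no _    | yes p<b+e = ⊥-elim (ℕ.<⇒≱ p<b+e b+e≤p)
... | no _    | no _  = refl

special⇒< : ∀ b e p → kindℕ b e p ≡ special → p < b
special⇒< b e p eq with p <? b | p <? b + e
... | yes p<b | _ = p<b
special⇒< b e p () | no _ | yes _
special⇒< b e p () | no _ | no _

¬dummy⇒< : ∀ b e p → kindℕ b e p ≢ dummy → p < b + e
¬dummy⇒< b e p ne with p <? b | p <? b + e
... | yes p<b | _       = ℕ.≤-trans p<b (ℕ.m≤m+n b e)
... | no _    | yes p<  = p<
... | no _    | no _    = ⊥-elim (ne refl)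

-- Shapes

-- A shape is a coloured 3-graph on the roots (the vertices of H) and t + 2 further positions. Special positions
-- see the three roots of host, ordinary positions see no root and dummies lie in no edge. A triple of positions
-- has colour high if it contains all special positions and colour low otherwise; two special positions and a root
-- form an edge of colour colour₁, and a special position and two roots one of colour colour₂.
module Shapes (k t n : ℕ) (4≤t : 4 ≤ t) (H : Hyp3 n) (c : Fin n → Fin n → Fin n → Fin k) (good : GoodColoring H k t c) where

  Host : Set
  Host = Maybe (Fin n × Fin n × Fin n)

  record Shape : Set where
    constructor shape
    field
      host : Host
      specials ordinaries : Fin (suc t)
      low high colour₁ colour₂ : Fin k
    b e : ℕ
    b = toℕ specials
    e = toℕ ordinaries
    top : Fin k
    top = if does (b ≤? 3) then high else low
  open Shape

  finite-Host : Finite Host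
  finite-Host = finite-Maybe (finite-× (finite-Fin n) (finite-× (finite-Fin n) (finite-Fin n)))

  finite-Shape : Finite Shape
  finite-Shape = finite-retract
    (finite-× finite-Host (finite-× (finite-Fin (suc t)) (finite-× (finite-Fin (suc t))
      (finite-× (finite-Fin k) (finite-× (finite-Fin k) (finite-× (finite-Fin k) (finite-Fin k)))))))
    (λ (h , b , e , i , j , p , q) → shape h b e i j p q)
    (λ κ → host κ , specials κ , ordinaries κ , low κ , high κ , colour₁ κ , colour₂ κ) (λ _ → refl)

  Position : Set
  Position = Fin (suc (suc t))

  kind : Shape → Position → Kind
  kind κ p = kindℕ (b κ) (e κ) (toℕ p)

  Sees : Host → Fin n → Set
  Sees nothing            r = ⊥
  Sees (just (x , y , z)) r = r ≡ x ⊎ r ≡ y ⊎ r ≡ z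

  sees? : ∀ h r → Dec (Sees h r)
  sees? nothing            r = no λ ()
  sees? (just (x , y , z)) r = (r Fin.≟ x) ⊎-dec (r Fin.≟ y) ⊎-dec (r Fin.≟ z)

  -- The inequality separates the host edge from the edges with two roots and a special position; a
  -- clique with three roots and a special position contains both.
  ValidHost : Host → Fin k → Set
  ValidHost nothing            q = ⊤
  ValidHost (just (x , y , z)) q = E H x y z ≡ true × q ≢ c x y z

  validHost? : ∀ h q → Dec (ValidHost h q)
  validHost? nothing            q = yes tt
  validHost? (just (x , y , z)) q = (E H x y z Bool.≟ true) ×-dec ¬? (q Fin.≟ c x y z)

  -- The last four conditions exclude a monochromatic K_t with 0, 3, 1 and 2 roots respectively.
  Valid : Shape → Set
  Valid κ = b κ + e κ ≤ t
    × (b κ + e κ < t ⊎ (low κ ≢ high κ × 1 ≤ b κ × b κ ≤ 3))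
    × ValidHost (host κ) (colour₂ κ)
    × (suc (b κ) < t ⊎ top κ ≢ colour₁ κ)
    × (suc (suc (b κ)) < t ⊎ colour₁ κ ≢ colour₂ κ ⊎ (5 ≤ t × top κ ≢ colour₁ κ))

  valid? : ∀ κ → Dec (Valid κ)
  valid? κ = (b κ + e κ ≤? t)
    ×-dec ((b κ + e κ <? t) ⊎-dec (¬? (low κ Fin.≟ high κ) ×-dec (1 ≤? b κ) ×-dec (b κ ≤? 3)))
    ×-dec validHost? (host κ) (colour₂ κ)
    ×-dec ((suc (b κ) <? t) ⊎-dec ¬? (top κ Fin.≟ colour₁ κ))
    ×-dec ((suc (suc (b κ)) <? t) ⊎-dec ¬? (colour₁ κ Fin.≟ colour₂ κ) ⊎-dec ((5 ≤? t) ×-dec ¬? (top κ Fin.≟ colour₁ κ)))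

  when : ∀ {A B : Set} → Dec A → Maybe B → Maybe B
  when d x = if does d then x else nothing

  when-inv : ∀ {A B : Set} (d : Dec A) {x : Maybe B} {y} → when d x ≡ just y → A × x ≡ just y
  when-inv (yes a) eq = a , eq

  when-true : ∀ {A B : Set} (d : Dec A) {x : Maybe B} → A → when d x ≡ x
  when-true (yes _) _ = refl
  when-true (no ¬a) a = ⊥-elim (¬a a)

  colour-HHH : Fin n → Fin n → Fin n → Maybe (Fin k)
  colour-HHH x y z = when (E H x y z Bool.≟ true) (just (c x y z))

  colour-HH : Shape → Fin n → Fin n → ℕ → Maybe (Fin k)
  colour-HH κ x y zero    = when (sees? (host κ) x) (when (sees? (host κ) y) (just (colour₂ κ)))
  colour-HH κ x y (suc _) = nothing

  colour-H : Shape → Fin n → ℕ → Maybe (Fin k)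
  colour-H κ x zero    = when (sees? (host κ) x) (just (colour₁ κ))
  colour-H κ x (suc _) = nothing

  -- A triple of weight `s ≤ 3` has `s` ordinary and `3 ∸ s` special positions, so it contains all
  -- special ones just when `b κ ≤ 3 ∸ s`. A dummy alone weighs 4 and breaks the bound.
  colour-∅ : Shape → ℕ → Maybe (Fin k)
  colour-∅ κ s = when (s ≤? 3) (just (if does (b κ ≤? 3 ∸ s) then high κ else low κ))

  -- An invalid shape keeps only the edges of `H`; thus the union can run over the finite type of
  -- all shapes.
  colour : Shape → Fin n ⊎ Kind → Fin n ⊎ Kind → Fin n ⊎ Kind → Maybe (Fin k)
  colour κ (inj₁ x) (inj₁ y) (inj₁ z) = colour-HHH x y z
  colour κ (inj₁ x) (inj₁ y) (inj₂ u) = when (valid? κ) (colour-HH κ x y (weight u))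
  colour κ (inj₁ x) (inj₂ u) (inj₁ y) = when (valid? κ) (colour-HH κ x y (weight u))
  colour κ (inj₂ u) (inj₁ x) (inj₁ y) = when (valid? κ) (colour-HH κ x y (weight u))
  colour κ (inj₁ x) (inj₂ u) (inj₂ v) = when (valid? κ) (colour-H κ x (weight u + weight v))
  colour κ (inj₂ u) (inj₁ x) (inj₂ v) = when (valid? κ) (colour-H κ x (weight u + weight v))
  colour κ (inj₂ u) (inj₂ v) (inj₁ x) = when (valid? κ) (colour-H κ x (weight u + weight v))
  colour κ (inj₂ u) (inj₂ v) (inj₂ w) = when (valid? κ) (colour-∅ κ (weight u + weight v + weight w))

  when-swap : ∀ {A B C : Set} (d : Dec A) (d′ : Dec B) {x : Maybe C} → when d (when d′ x) ≡ when d′ (when d x)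
  when-swap (yes _) (yes _) = refl
  when-swap (yes _) (no _)  = refl
  when-swap (no _)  (yes _) = refl
  when-swap (no _)  (no _)  = refl

  colour-HH-sym : ∀ κ x y s → colour-HH κ x y s ≡ colour-HH κ y x s
  colour-HH-sym κ x y zero    = when-swap (sees? (host κ) x) (sees? (host κ) y)
  colour-HH-sym κ x y (suc _) = refl

  true⇒T : ∀ {x} → x ≡ true → T x
  true⇒T refl = tt

  T⇒true : ∀ {x} → T x → x ≡ true
  T⇒true {true} _ = refl

  c-sym₁₂ : ∀ {x y z} → E H x y z ≡ true → c x y z ≡ c y x z
  c-sym₁₂ {x} {y} {z} xyz = proj₁ (proj₁ good x y z (true⇒T xyz))

  c-sym₂₃ : ∀ {x y z} → E H x y z ≡ true → c x y z ≡ c x z y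
  c-sym₂₃ {x} {y} {z} xyz = proj₂ (proj₁ good x y z (true⇒T xyz))

  colour-HHH-eq : ∀ {x y z x′ y′ z′} → E H x y z ≡ E H x′ y′ z′ → (E H x y z ≡ true → c x y z ≡ c x′ y′ z′) →
                  colour-HHH x y z ≡ colour-HHH x′ y′ z′
  colour-HHH-eq {x} {y} {z} {x′} {y′} {z′} eq ceq with E H x y z Bool.≟ true | E H x′ y′ z′ Bool.≟ true
  ... | yes p | yes _ = cong just (ceq p)
  ... | yes p | no ¬q = ⊥-elim (¬q (trans (sym eq) p))
  ... | no ¬p | yes q = ⊥-elim (¬p (trans eq q))
  ... | no _  | no _  = refl

  colour-sym₁₂ : ∀ κ u v w → colour κ u v w ≡ colour κ v u w
  colour-sym₁₂ κ (inj₁ x) (inj₁ y) (inj₁ z) = colour-HHH-eq (sym₁₂ H x y z) c-sym₁₂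
  colour-sym₁₂ κ (inj₁ x) (inj₁ y) (inj₂ u) = cong (when (valid? κ)) (colour-HH-sym κ x y (weight u))
  colour-sym₁₂ κ (inj₁ x) (inj₂ u) (inj₁ y) = refl
  colour-sym₁₂ κ (inj₂ u) (inj₁ x) (inj₁ y) = refl
  colour-sym₁₂ κ (inj₁ x) (inj₂ u) (inj₂ v) = refl
  colour-sym₁₂ κ (inj₂ u) (inj₁ x) (inj₂ v) = refl
  colour-sym₁₂ κ (inj₂ u) (inj₂ v) (inj₁ x) = cong (when (valid? κ) ∘ colour-H κ x) (ℕ.+-comm (weight u) (weight v))
  colour-sym₁₂ κ (inj₂ u) (inj₂ v) (inj₂ w) =
    cong (λ s → when (valid? κ) (colour-∅ κ (s + weight w))) (ℕ.+-comm (weight u) (weight v))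

  colour-sym₂₃ : ∀ κ u v w → colour κ u v w ≡ colour κ u w v
  colour-sym₂₃ κ (inj₁ x) (inj₁ y) (inj₁ z) = colour-HHH-eq (sym₂₃ H x y z) c-sym₂₃
  colour-sym₂₃ κ (inj₁ x) (inj₁ y) (inj₂ u) = refl
  colour-sym₂₃ κ (inj₁ x) (inj₂ u) (inj₁ y) = refl
  colour-sym₂₃ κ (inj₂ u) (inj₁ x) (inj₁ y) = cong (when (valid? κ)) (colour-HH-sym κ x y (weight u))
  colour-sym₂₃ κ (inj₁ x) (inj₂ u) (inj₂ v) = cong (when (valid? κ) ∘ colour-H κ x) (ℕ.+-comm (weight u) (weight v))
  colour-sym₂₃ κ (inj₂ u) (inj₁ x) (inj₂ v) = refl
  colour-sym₂₃ κ (inj₂ u) (inj₂ v) (inj₁ x) = refl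
  colour-sym₂₃ κ (inj₂ u) (inj₂ v) (inj₂ w) = cong (when (valid? κ) ∘ colour-∅ κ)
    (trans (ℕ.+-assoc (weight u) (weight v) (weight w)) (trans (cong (weight u +_) (ℕ.+-comm (weight v) (weight w)))
           (sym (ℕ.+-assoc (weight u) (weight w) (weight v)))))

  colour-HH-inv : ∀ κ x y u {m} → when (valid? κ) (colour-HH κ x y (weight u)) ≡ just m →
                  Valid κ × u ≡ special × Sees (host κ) x × Sees (host κ) y × m ≡ colour₂ κ
  colour-HH-inv κ x y special eq =
    let (v , eq₁) = when-inv (valid? κ) eq
        (sx , eq₂) = when-inv (sees? (host κ) x) eq₁
        (sy , eq₃) = when-inv (sees? (host κ) y) eq₂
    in v , refl , sx , sy , sym (Maybe.just-injective eq₃)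
  colour-HH-inv κ x y ordinary eq with when-inv (valid? κ) eq
  ... | _ , ()
  colour-HH-inv κ x y dummy eq with when-inv (valid? κ) eq
  ... | _ , ()

  colour-H-inv : ∀ κ x u v {m} → when (valid? κ) (colour-H κ x (weight u + weight v)) ≡ just m →
                 Valid κ × u ≡ special × v ≡ special × Sees (host κ) x × m ≡ colour₁ κ
  colour-H-inv κ x u v eq with when-inv (valid? κ) eq
  ... | val , eq₁ with weight u + weight v in s
  ...   | zero = let (sx , eq₂) = when-inv (sees? (host κ) x) eq₁ in
    val , weight-0 u (ℕ.m+n≡0⇒m≡0 _ s) , weight-0 v (ℕ.m+n≡0⇒n≡0 (weight u) s) , sx , sym (Maybe.just-injective eq₂)
  ...   | suc _ with () ← eq₁

  colour-∅-inv : ∀ κ s {m} → when (valid? κ) (colour-∅ κ s) ≡ just m →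
                 Valid κ × s ≤ 3 × m ≡ (if does (b κ ≤? 3 ∸ s) then high κ else low κ)
  colour-∅-inv κ s eq = let (v , eq₁) = when-inv (valid? κ) eq
                            (s≤ , eq₂) = when-inv (s ≤? 3) eq₁
                        in v , s≤ , sym (Maybe.just-injective eq₂)

  host-edge : ∀ {h q} → ValidHost h q → ∀ {x y z} → Sees h x → Sees h y → Sees h z → x ≢ y → y ≢ z → x ≢ z →
              E H x y z ≡ true × c x y z ≢ q
  host-edge {just (x , y , z)} (xyz , q≢) = go
    where
    swap₁₂ : ∀ {x y z} → E H x y z ≡ true × c x y z ≢ _ → E H y x z ≡ true × c y x z ≢ _
    swap₁₂ {x} {y} {z} (xyz , ne) = trans (sym (sym₁₂ H x y z)) xyz , λ eq → ne (trans (c-sym₁₂ xyz) eq)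
    swap₂₃ : ∀ {x y z} → E H x y z ≡ true × c x y z ≢ _ → E H x z y ≡ true × c x z y ≢ _
    swap₂₃ {x} {y} {z} (xyz , ne) = trans (sym (sym₂₃ H x y z)) xyz , λ eq → ne (trans (c-sym₂₃ xyz) eq)
    base = xyz , λ eq → q≢ (sym eq)
    go : ∀ {x′ y′ z′} → x′ ≡ x ⊎ x′ ≡ y ⊎ x′ ≡ z → y′ ≡ x ⊎ y′ ≡ y ⊎ y′ ≡ z → z′ ≡ x ⊎ z′ ≡ y ⊎ z′ ≡ z →
         x′ ≢ y′ → y′ ≢ z′ → x′ ≢ z′ → E H x′ y′ z′ ≡ true × c x′ y′ z′ ≢ _
    go (inj₁ refl) (inj₁ refl) _ ne _ _ = ⊥-elim (ne refl)
    go (inj₁ refl) (inj₂ (inj₁ refl)) (inj₁ refl) _ _ ne = ⊥-elim (ne refl)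
    go (inj₁ refl) (inj₂ (inj₁ refl)) (inj₂ (inj₁ refl)) _ ne _ = ⊥-elim (ne refl)
    go (inj₁ refl) (inj₂ (inj₁ refl)) (inj₂ (inj₂ refl)) _ _ _ = base
    go (inj₁ refl) (inj₂ (inj₂ refl)) (inj₁ refl) _ _ ne = ⊥-elim (ne refl)
    go (inj₁ refl) (inj₂ (inj₂ refl)) (inj₂ (inj₁ refl)) _ _ _ = swap₂₃ base
    go (inj₁ refl) (inj₂ (inj₂ refl)) (inj₂ (inj₂ refl)) _ ne _ = ⊥-elim (ne refl)
    go (inj₂ (inj₁ refl)) (inj₁ refl) (inj₁ refl) _ ne _ = ⊥-elim (ne refl)
    go (inj₂ (inj₁ refl)) (inj₁ refl) (inj₂ (inj₁ refl)) _ _ ne = ⊥-elim (ne refl)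
    go (inj₂ (inj₁ refl)) (inj₁ refl) (inj₂ (inj₂ refl)) _ _ _ = swap₁₂ base
    go (inj₂ (inj₁ refl)) (inj₂ (inj₁ refl)) _ ne _ _ = ⊥-elim (ne refl)
    go (inj₂ (inj₁ refl)) (inj₂ (inj₂ refl)) (inj₁ refl) _ _ _ = swap₂₃ (swap₁₂ base)
    go (inj₂ (inj₁ refl)) (inj₂ (inj₂ refl)) (inj₂ (inj₁ refl)) _ _ ne = ⊥-elim (ne refl)
    go (inj₂ (inj₁ refl)) (inj₂ (inj₂ refl)) (inj₂ (inj₂ refl)) _ ne _ = ⊥-elim (ne refl)
    go (inj₂ (inj₂ refl)) (inj₁ refl) (inj₁ refl) _ ne _ = ⊥-elim (ne refl)
    go (inj₂ (inj₂ refl)) (inj₁ refl) (inj₂ (inj₁ refl)) _ _ _ = swap₁₂ (swap₂₃ base)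
    go (inj₂ (inj₂ refl)) (inj₁ refl) (inj₂ (inj₂ refl)) _ _ ne = ⊥-elim (ne refl)
    go (inj₂ (inj₂ refl)) (inj₂ (inj₁ refl)) (inj₁ refl) _ _ _ = swap₁₂ (swap₂₃ (swap₁₂ base))
    go (inj₂ (inj₂ refl)) (inj₂ (inj₁ refl)) (inj₂ (inj₁ refl)) _ ne _ = ⊥-elim (ne refl)
    go (inj₂ (inj₂ refl)) (inj₂ (inj₁ refl)) (inj₂ (inj₂ refl)) _ _ ne = ⊥-elim (ne refl)
    go (inj₂ (inj₂ refl)) (inj₂ (inj₂ refl)) _ ne _ _ = ⊥-elim (ne refl)

  -- Used for the codegrees between roots: two roots together with a special position form an edge
  -- only inside a host, hence only inside an edge of `H`. The third root is whichever vertex of the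
  -- host remains.
  host-pair : ∀ {h q} → ValidHost h q → ∀ {x y} → Sees h x → Sees h y → x ≢ y → ∃ λ z → E H x y z ≡ true
  host-pair {just (x₁ , y₁ , z₁)} {q} v {x} {y} sx sy x≢y with y₁ Fin.≟ x | y₁ Fin.≟ y | x₁ Fin.≟ x | x₁ Fin.≟ y
  ... | no y₁≢x  | no y₁≢y | _ | _  = y₁ , proj₁ (host-edge v sx sy (inj₂ (inj₁ refl)) x≢y (y₁≢y ∘ sym) (y₁≢x ∘ sym))
  ... | _  | _  | no x₁≢x | no x₁≢y = x₁ , proj₁ (host-edge v sx sy (inj₁ refl) x≢y (x₁≢y ∘ sym) (x₁≢x ∘ sym))
  ... | yes refl | _        | yes refl | _        = ⊥-elim (diagonal (proj₁ v))
    where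
    diagonal : ∀ {x z} → E H x x z ≢ true
    diagonal {x} {z} eq with () ← trans (sym eq) (irrefl H x z)
  ... | _        | yes refl | _        | yes refl = ⊥-elim (diagonal (proj₁ v))
    where
    diagonal : ∀ {x z} → E H x x z ≢ true
    diagonal {x} {z} eq with () ← trans (sym eq) (irrefl H x z)
  ... | yes refl | _ | _ | yes refl = z₁ , trans (sym₁₂ H y₁ x₁ z₁) (proj₁ v)
  ... | _ | yes refl | yes refl | _ = z₁ , proj₁ v

  -- The kinds are those of the positions 0 to 3. The triple 0, 1, 2 contains all special positions,
  -- whereas 1, 2, 3 misses the special position 0.
  high-low : ∀ {b} {hi lo m : Fin k} {k₁ k₂ k₃ k₄} → 1 ≤ b → b ≤ 3 →
    (0 < b → k₁ ≡ special) → (1 < b → k₂ ≡ special) → (2 < b → k₃ ≡ special) →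
    (b ≤ 1 → k₂ ≡ ordinary) → (b ≤ 2 → k₃ ≡ ordinary) → (b ≤ 3 → k₄ ≡ ordinary) →
    m ≡ (if does (b ≤? 3 ∸ (weight k₁ + weight k₂ + weight k₃)) then hi else lo) →
    m ≡ (if does (b ≤? 3 ∸ (weight k₂ + weight k₃ + weight k₄)) then hi else lo) → m ≡ hi × m ≡ lo
  high-low {1} _ _ s₁ s₂ s₃ o₂ o₃ o₄ eq₁ eq₂
    rewrite s₁ (s≤s z≤n) | o₂ (s≤s z≤n) | o₃ (s≤s z≤n) | o₄ (s≤s z≤n) = eq₁ , eq₂
  high-low {2} _ _ s₁ s₂ s₃ o₂ o₃ o₄ eq₁ eq₂
    rewrite s₁ (s≤s z≤n) | s₂ (s≤s (s≤s z≤n)) | o₃ (s≤s (s≤s z≤n)) | o₄ (s≤s (s≤s z≤n)) = eq₁ , eq₂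
  high-low {3} _ _ s₁ s₂ s₃ o₂ o₃ o₄ eq₁ eq₂
    rewrite s₁ (s≤s z≤n) | s₂ (s≤s (s≤s z≤n)) | s₃ (s≤s (s≤s (s≤s z≤n))) | o₄ (s≤s (s≤s (s≤s z≤n))) = eq₁ , eq₂
  high-low {suc (suc (suc (suc _)))} _ (s≤s (s≤s (s≤s ())))

  -- No monochromatic clique inside one shape

  module ShapeClique (κ : Shape) (g : Fin t → Fin n ⊎ Position) (g-inj : ∀ {i j} → i ≢ j → g i ≢ g j) (m : Fin k)
    (mono : ∀ i j l → Distinct i j l → colour κ (Sum.map₂ (kind κ) (g i)) (Sum.map₂ (kind κ) (g j)) (Sum.map₂ (kind κ) (g l)) ≡ just m)
    where

    Root Special : Fin t → Set
    Root i = Σ (Fin n) λ x → g i ≡ inj₁ x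
    Special i = Σ Position λ p → g i ≡ inj₂ p × kind κ p ≡ special

    view : ∀ i → Root i ⊎ Σ Position λ p → g i ≡ inj₂ p
    view i with g i
    ... | inj₁ x = inj₁ (x , refl)
    ... | inj₂ p = inj₂ (p , refl)

    root? : ∀ i → Dec (Root i)
    root? i with view i
    ... | inj₁ r        = yes r
    ... | inj₂ (p , eq) = no λ (x , eq′) → absurd (trans (sym eq) eq′)
      where
      absurd : ∀ {p x} → ¬ (_≡_ {A = Fin n ⊎ Position} (inj₂ p) (inj₁ x))
      absurd ()

    coloured : ∀ {i j l u v w} → Distinct i j l → g i ≡ u → g j ≡ v → g l ≡ w →
               colour κ (Sum.map₂ (kind κ) u) (Sum.map₂ (kind κ) v) (Sum.map₂ (kind κ) w) ≡ just m
    coloured {i} {j} {l} d refl refl refl = mono i j l d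

    root-root-special : ∀ {i j l} → Distinct i j l → Root i → Root j → Special l → m ≡ colour₂ κ
    root-root-special d (x , gi) (y , gj) (p , gl , _) =
      let (_ , _ , _ , _ , eq) = colour-HH-inv κ x y (kind κ p) (coloured d gi gj gl) in eq

    root-special-special : ∀ {i j l} → Distinct i j l → Root i → Special j → Special l → m ≡ colour₁ κ
    root-special-special d (x , gi) (p , gj , _) (p′ , gl , _) =
      let (_ , _ , _ , _ , eq) = colour-H-inv κ x (kind κ p) (kind κ p′) (coloured d gi gj gl) in eq

    specials-top : ∀ {i j l} → Distinct i j l → Special i → Special j → Special l → m ≡ top κ
    specials-top {i} {j} {l} d (p₁ , g₁ , k₁) (p₂ , g₂ , k₂) (p₃ , g₃ , k₃) with coloured d g₁ g₂ g₃
    ... | eq rewrite k₁ | k₂ | k₃ = proj₂ (proj₂ (colour-∅-inv κ 0 eq))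

    root-root-root : ∀ {i j l} → Distinct i j l → (ri : Root i) (rj : Root j) (rl : Root l) →
                     E H (proj₁ ri) (proj₁ rj) (proj₁ rl) ≡ true × c (proj₁ ri) (proj₁ rj) (proj₁ rl) ≡ m
    root-root-root d (x , gi) (y , gj) (z , gl) =
      let (xyz , eq) = when-inv (E H x y z Bool.≟ true) (coloured d gi gj gl) in xyz , Maybe.just-injective eq

    -- Two vertices of a clique share an edge, and an edge with both a root and a position has only
    -- special positions, all seeing the root.
    beside-root : ∀ {i j} → i ≢ j → Root i → Root j ⊎ (Special j × Valid κ × (∀ r → g i ≡ inj₁ r → Sees (host κ) r))
    beside-root {i} {j} i≢j (x , gi) with view j
    ... | inj₁ rj = inj₁ rj
    ... | inj₂ (p , gj) with third 4≤t i j i≢j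
    ...   | l , d with view l
    ...     | inj₁ (y , gl) =
      let (v , ks , sx , _ , _) = colour-HH-inv κ x y (kind κ p) (coloured d gi gj gl)
      in inj₂ ((p , gj , ks) , v , λ r gr → subst (Sees (host κ)) (Sum.inj₁-injective (trans (sym gi) gr)) sx)
    ...     | inj₂ (p′ , gl) =
      let (v , ks , _ , sx , _) = colour-H-inv κ x (kind κ p) (kind κ p′) (coloured d gi gj gl)
      in inj₂ ((p , gj , ks) , v , λ r gr → subst (Sees (host κ)) (Sum.inj₁-injective (trans (sym gi) gr)) sx)

    pos-< : ∀ {i} → Special i → Fin (b κ)
    pos-< (p , _ , ks) = fromℕ< (special⇒< (b κ) (e κ) (toℕ p) ks)

    pos-<-injective : ∀ {i j} (s : Special i) (s′ : Special j) → i ≢ j → pos-< s ≢ pos-< s′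
    pos-<-injective (p , gi , ks) (p′ , gj , ks′) i≢j eq = g-inj i≢j (trans gi (trans (cong inj₂
      (Fin.toℕ-injective (Fin.fromℕ<-injective _ _ _ _ eq))) (sym gj)))

    -- No dummy occurs, so the clique injects into the `b κ + e κ ≤ t` other positions. Hence
    -- equality holds and all positions below `t` occur, among them the first four, which show two
    -- colours.
    no-roots : (∀ i → ¬ Root i) → ⊥
    no-roots none = contradict (proj₁ (proj₂ val))
      where
      pos : ∀ i → Σ Position λ p → g i ≡ inj₂ p
      pos i with view i
      ... | inj₁ r = ⊥-elim (none i r)
      ... | inj₂ p = p
      kd : Fin t → Kind
      kd i = kind κ (proj₁ (pos i))
      triple : ∀ {i j l} → Distinct i j l → Valid κ × weight (kd i) + weight (kd j) + weight (kd l) ≤ 3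
                 × m ≡ (if does (b κ ≤? 3 ∸ (weight (kd i) + weight (kd j) + weight (kd l))) then high κ else low κ)
      triple {i} {j} {l} d = colour-∅-inv κ _ (coloured d (proj₂ (pos i)) (proj₂ (pos j)) (proj₂ (pos l)))
      val : Valid κ
      val = let i = proj₁ (avoid [] (ℕ.≤-trans (s≤s z≤n) 4≤t))
                (j , i≢j) = another 4≤t i
            in proj₁ (triple (proj₂ (third 4≤t i j i≢j)))
      b+e≤t = proj₁ val
      below : ∀ i → toℕ (proj₁ (pos i)) < b κ + e κ
      below i = ¬dummy⇒< (b κ) (e κ) _ λ eq → let (j , i≢j) = another 4≤t i
                                                  (_ , s≤3 , _) = triple (proj₂ (third 4≤t i j i≢j))
                                              in too-heavy eq s≤3
        where
        too-heavy : ∀ {u v w} → u ≡ dummy → weight u + v + w ≤ 3 → ⊥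
        too-heavy refl (s≤s (s≤s (s≤s ())))
      f : Fin t → Fin (b κ + e κ)
      f i = fromℕ< (below i)
      f-inj : ∀ {i j} → i ≢ j → f i ≢ f j
      f-inj {i} {j} i≢j eq = g-inj i≢j (trans (proj₂ (pos i)) (trans (cong inj₂
        (Fin.toℕ-injective (Fin.fromℕ<-injective _ _ _ _ eq))) (sym (proj₂ (pos j)))))
      t≤b+e : t ≤ b κ + e κ
      t≤b+e = Fin.injective⇒≤ {f = f} λ {i} {j} eq → decide i j eq (i Fin.≟ j)
        where
        decide : ∀ i j → f i ≡ f j → Dec (i ≡ j) → i ≡ j
        decide i j eq (yes p) = p
        decide i j eq (no ne) = ⊥-elim (f-inj ne eq)
      F : Fin t → Fin t
      F i = fromℕ< (ℕ.<-≤-trans (below i) b+e≤t)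
      F-inj : ∀ {i j} → i ≢ j → F i ≢ F j
      F-inj {i} {j} i≢j eq = g-inj i≢j (trans (proj₂ (pos i)) (trans (cong inj₂
        (Fin.toℕ-injective (Fin.fromℕ<-injective _ _ _ _ eq))) (sym (proj₂ (pos j)))))
      at : ∀ {y} → y < t → Σ (Fin t) λ i → toℕ (proj₁ (pos i)) ≡ y
      at {y} y<t = let (i , eq) = injective⇒surjective F F-inj (fromℕ< y<t) in
        i , trans (sym (Fin.toℕ-fromℕ< (ℕ.<-≤-trans (below i) b+e≤t))) (trans (cong toℕ eq) (Fin.toℕ-fromℕ< y<t))
      at-distinct : ∀ {y y′} (y<t : y < t) (y′<t : y′ < t) → y ≢ y′ → proj₁ (at y<t) ≢ proj₁ (at y′<t)
      at-distinct y<t y′<t ne eq = ne (trans (sym (proj₂ (at y<t))) (trans (cong (toℕ ∘ proj₁ ∘ pos) eq) (proj₂ (at y′<t))))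
      kd-special : ∀ {y} (y<t : y < t) → y < b κ → kd (proj₁ (at y<t)) ≡ special
      kd-special y<t y<b = trans (cong (kindℕ (b κ) (e κ)) (proj₂ (at y<t))) (kindℕ-special (e κ) y<b)
      kd-ordinary : ∀ {y} (y<t : y < t) → b κ ≤ y → kd (proj₁ (at y<t)) ≡ ordinary
      kd-ordinary y<t b≤y = trans (cong (kindℕ (b κ) (e κ)) (proj₂ (at y<t))) (kindℕ-ordinary b≤y (ℕ.<-≤-trans y<t t≤b+e))
      -- As `suc y ≤ t` means `y < t`, the indices `at 1≤t` to `at 4≤t` hold the positions 0 to 3.
      1≤t = ℕ.≤-trans (s≤s z≤n) 4≤t
      2≤t = ℕ.≤-trans (s≤s (s≤s z≤n)) 4≤t
      3≤t = ℕ.≤-trans (s≤s (s≤s (s≤s z≤n))) 4≤t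
      first : Distinct (proj₁ (at 1≤t)) (proj₁ (at 2≤t)) (proj₁ (at 3≤t))
      first = at-distinct 1≤t 2≤t (λ ()) , at-distinct 2≤t 3≤t (λ ()) , at-distinct 1≤t 3≤t (λ ())
      later : Distinct (proj₁ (at 2≤t)) (proj₁ (at 3≤t)) (proj₁ (at 4≤t))
      later = at-distinct 2≤t 3≤t (λ ()) , at-distinct 3≤t 4≤t (λ ()) , at-distinct 2≤t 4≤t (λ ())
      two-colours : 1 ≤ b κ → b κ ≤ 3 → m ≡ high κ × m ≡ low κ
      two-colours 1≤b b≤3 = high-low 1≤b b≤3 (kd-special 1≤t) (kd-special 2≤t) (kd-special 3≤t) (kd-ordinary 2≤t) (kd-ordinary 3≤t) (kd-ordinary 4≤t)
                              (proj₂ (proj₂ (triple first))) (proj₂ (proj₂ (triple later)))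
      contradict : b κ + e κ < t ⊎ (low κ ≢ high κ × 1 ≤ b κ × b κ ≤ 3) → ⊥
      contradict (inj₁ lt) = ℕ.<⇒≱ lt t≤b+e
      contradict (inj₂ (low≢high , 1≤b , b≤3)) = let (h , l) = two-colours 1≤b b≤3 in low≢high (trans (sym l) h)

    all-roots : (∀ i → Root i) → ⊥
    all-roots root = proj₂ good ((proj₁ ∘ root) , inj , m , λ i j l i≢j j≢l i≢l →
        let (xyz , eq) = root-root-root (i≢j , j≢l , i≢l) (root i) (root j) (root l) in true⇒T xyz , eq)
      where
      inj : Injective _≡_ _≡_ (proj₁ ∘ root)
      inj {i} {j} eq with i Fin.≟ j
      ... | yes p = p
      ... | no ne = ⊥-elim (g-inj ne (trans (proj₂ (root i)) (trans (cong inj₁ eq) (sym (proj₂ (root j))))))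

    -- If r indices are roots, then all others are special, so t ≤ r + b.
    module _ (i₀ : Fin t) (root₀ : Root i₀) (j₀ : Fin t) (i₀≢j₀ : i₀ ≢ j₀) (special₀ : Special j₀) (val : Valid κ) where

      others : ∀ i → i₀ ≢ i → Root i ⊎ Special i
      others i ne = Sum.map₂ proj₁ (beside-root ne root₀)

      sees-root : ∀ {i} (r : Root i) → Sees (host κ) (proj₁ r)
      sees-root {i} (x , gi) = go (i Fin.≟ j₀)
        where
        clash : ∀ {y : Fin n} {p : Position} → inj₁ y ≢ inj₂ p
        clash ()
        go : Dec (i ≡ j₀) → Sees (host κ) x
        go (yes refl) = ⊥-elim (clash (trans (sym gi) (proj₁ (proj₂ special₀))))
        go (no ne) with beside-root ne (x , gi)
        ... | inj₁ (y , gj) = ⊥-elim (clash (trans (sym gj) (proj₁ (proj₂ special₀))))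
        ... | inj₂ (_ , _ , s) = s x gi

      validHost = proj₁ (proj₂ (proj₂ val))
      one-root-ok = proj₁ (proj₂ (proj₂ (proj₂ val)))
      two-roots-ok = proj₂ (proj₂ (proj₂ (proj₂ val)))

      -- Since `t ≥ 4`, there are three special vertices: their triple has colour `top κ`, while two
      -- of them with the root give `colour₁ κ`.
      one-root : (∀ i → i₀ ≢ i → Special i) → ⊥
      one-root sp = [ (λ lt → ℕ.<⇒≱ lt t≤) , (λ top≢ → top≢ (trans (sym m-top) m₁)) ]′ one-root-ok
        where
        num : ∀ i → Dec (i₀ ≡ i) → Fin (suc (b κ))
        num i (yes _) = zero
        num i (no ne) = suc (pos-< (sp i ne))
        num-inj : ∀ i j d d′ → num i d ≡ num j d′ → i ≡ j
        num-inj i j (yes p) (yes q) _ = trans (sym p) q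
        num-inj i j (no ne) (no ne′) eq with i Fin.≟ j
        ... | yes p = p
        ... | no i≢j = ⊥-elim (pos-<-injective (sp i ne) (sp j ne′) i≢j (Fin.suc-injective eq))
        t≤ : t ≤ suc (b κ)
        t≤ = Fin.injective⇒≤ {f = λ i → num i (i₀ Fin.≟ i)} λ {i} {j} → num-inj i j (i₀ Fin.≟ i) (i₀ Fin.≟ j)
        j₁ = avoid (i₀ ∷ j₀ ∷ []) (ℕ.≤-trans (s≤s (s≤s (s≤s z≤n))) 4≤t)
        j₂ = avoid (i₀ ∷ j₀ ∷ proj₁ j₁ ∷ []) 4≤t
        s₁ = sp (proj₁ j₁) λ eq → proj₂ j₁ (here (sym eq))
        s₂ = sp (proj₁ j₂) λ eq → proj₂ j₂ (here (sym eq))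
        m₁ : m ≡ colour₁ κ
        m₁ = root-special-special (i₀≢j₀ , (λ eq → proj₂ j₁ (there (here (sym eq)))) , (λ eq → proj₂ j₁ (here (sym eq)))) root₀ special₀ s₁
        m-top : m ≡ top κ
        m-top = specials-top ((λ eq → proj₂ j₁ (there (here (sym eq)))) , (λ eq → proj₂ j₂ (there (there (here (sym eq))))) ,
                              (λ eq → proj₂ j₂ (there (here (sym eq))))) special₀ s₁ s₂

      -- The three roots all see the special vertex, so they form the host edge, whose colour is not
      -- `colour₂ κ`. Further roots need no separate case.
      three-roots : ∀ i₁ i₂ → Distinct i₀ i₁ i₂ → Root i₁ → Root i₂ → i₁ ≢ j₀ → ⊥
      three-roots i₁ i₂ d@(ne₀₁ , ne₁₂ , ne₀₂) r₁ r₂ ne =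
        proj₂ (host-edge validHost (sees-root root₀) (sees-root r₁) (sees-root r₂) (apart root₀ r₁ ne₀₁) (apart r₁ r₂ ne₁₂) (apart root₀ r₂ ne₀₂))
          (trans (proj₂ (root-root-root d root₀ r₁ r₂)) (root-root-special (ne₀₁ , ne , i₀≢j₀) root₀ r₁ special₀))
        where
        apart : ∀ {i j} (r : Root i) (r′ : Root j) → i ≢ j → proj₁ r ≢ proj₁ r′
        apart (x , gi) (y , gj) i≢j eq = g-inj i≢j (trans gi (trans (cong inj₁ eq) (sym gj)))

      -- `colour₁` and `colour₂` occur because two special vertices remain. A third one, needed to
      -- see `top κ`, exists only for `5 ≤ t`.
      two-roots : ∀ i₁ → i₀ ≢ i₁ → i₁ ≢ j₀ → Root i₁ → (∀ i → i₀ ≢ i → i₁ ≢ i → Special i) → ⊥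
      two-roots i₁ i₀≢i₁ i₁≢j₀ r₁ sp = [ (λ lt → ℕ.<⇒≱ lt t≤) , [ (λ ne → ne (trans (sym m₁) m₂)) , (λ (5≤t , ne) → five 5≤t ne) ]′ ]′ two-roots-ok
        where
        num : ∀ i → Dec (i₀ ≡ i) → Dec (i₁ ≡ i) → Fin (suc (suc (b κ)))
        num i (yes _) _ = zero
        num i (no _) (yes _) = suc zero
        num i (no ne) (no ne′) = suc (suc (pos-< (sp i ne ne′)))
        num-inj : ∀ i j d d₁ d′ d₁′ → num i d d₁ ≡ num j d′ d₁′ → i ≡ j
        num-inj i j (yes p) _ (yes q) _ _ = trans (sym p) q
        num-inj i j (no _) (yes p) (no _) (yes q) _ = trans (sym p) q
        num-inj i j (no n₁) (no n₂) (no n₃) (no n₄) eq with i Fin.≟ j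
        ... | yes p = p
        ... | no i≢j = ⊥-elim (pos-<-injective (sp i n₁ n₂) (sp j n₃ n₄) i≢j (Fin.suc-injective (Fin.suc-injective eq)))
        num-inj i j (yes _) _ (no _) (yes _) ()
        num-inj i j (yes _) _ (no _) (no _) ()
        num-inj i j (no _) (yes _) (yes _) _ ()
        num-inj i j (no _) (no _) (yes _) _ ()
        num-inj i j (no _) (yes _) (no _) (no _) ()
        num-inj i j (no _) (no _) (no _) (yes _) ()
        t≤ : t ≤ suc (suc (b κ))
        t≤ = Fin.injective⇒≤ {f = λ i → num i (i₀ Fin.≟ i) (i₁ Fin.≟ i)}
               λ {i} {j} → num-inj i j (i₀ Fin.≟ i) (i₁ Fin.≟ i) (i₀ Fin.≟ j) (i₁ Fin.≟ j)
        j₁ = avoid (i₀ ∷ i₁ ∷ j₀ ∷ []) 4≤t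
        s₁ = sp (proj₁ j₁) (λ eq → proj₂ j₁ (here (sym eq))) (λ eq → proj₂ j₁ (there (here (sym eq))))
        j₀≢j₁ : j₀ ≢ proj₁ j₁
        j₀≢j₁ eq = proj₂ j₁ (there (there (here (sym eq))))
        m₂ : m ≡ colour₂ κ
        m₂ = root-root-special (i₀≢i₁ , i₁≢j₀ , i₀≢j₀) root₀ r₁ special₀
        m₁ : m ≡ colour₁ κ
        m₁ = root-special-special (i₀≢j₀ , j₀≢j₁ , (λ eq → proj₂ j₁ (here (sym eq)))) root₀ special₀ s₁
        five : 5 ≤ t → top κ ≢ colour₁ κ → ⊥
        five 5≤t ne =
          let (j₂ , j₂∉) = avoid (i₀ ∷ i₁ ∷ j₀ ∷ proj₁ j₁ ∷ []) 5≤t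
              s₂ = sp j₂ (λ eq → j₂∉ (here (sym eq))) (λ eq → j₂∉ (there (here (sym eq))))
          in ne (trans (sym (specials-top (j₀≢j₁ , (λ eq → j₂∉ (there (there (there (here (sym eq)))))) ,
                                          (λ eq → j₂∉ (there (there (here (sym eq)))))) special₀ s₁ s₂)) m₁)

      some-roots : ⊥
      some-roots with any? (finite-Fin t) (λ i → ¬? (i₀ Fin.≟ i) ×-dec root? i)
      ... | no none = one-root λ i ne → [ (λ r → ⊥-elim (none (i , ne , r))) , id ]′ (others i ne)
      ... | yes (i₁ , i₀≢i₁ , r₁) with any? (finite-Fin t) (λ i → ¬? (i₀ Fin.≟ i) ×-dec ¬? (i₁ Fin.≟ i) ×-dec root? i)
      ...   | yes (i₂ , i₀≢i₂ , i₁≢i₂ , r₂) = three-roots i₁ i₂ (i₀≢i₁ , i₁≢i₂ , i₀≢i₂) r₁ r₂ (i≢j₀ r₁)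
        where
        i≢j₀ : ∀ {i} → Root i → i ≢ j₀
        i≢j₀ (x , gi) refl with () ← trans (sym gi) (proj₁ (proj₂ special₀))
      ...   | no none = two-roots i₁ i₀≢i₁ (i≢j₀ r₁) r₁ λ i ne ne′ → [ (λ r → ⊥-elim (none (i , ne , ne′ , r))) , id ]′ (others i ne)
        where
        i≢j₀ : ∀ {i} → Root i → i ≢ j₀
        i≢j₀ (x , gi) refl with () ← trans (sym gi) (proj₁ (proj₂ special₀))

    contradictory : ⊥
    contradictory with any? (finite-Fin t) root?
    ... | no none = no-roots λ i r → none (i , r)
    ... | yes (i₀ , r₀) with any? (finite-Fin t) (¬? ∘ root?)
    ...   | no none = all-roots λ i → decide i (root? i)
      where
      decide : ∀ i → Dec (Root i) → Root i
      decide i (yes r) = r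
      decide i (no ¬r) = ⊥-elim (none (i , ¬r))
    ...   | yes (j , ¬rj) with beside-root (λ { refl → ¬rj r₀ }) r₀
    ...     | inj₁ rj = ⊥-elim (¬rj rj)
    ...     | inj₂ (sj , val , _) = some-roots i₀ r₀ j (λ { refl → ¬rj r₀ }) sj val

-- Sorted triples and forced values

unordered : ∀ {t} {P : Fin t → Fin t → Fin t → Set} → (∀ {i j l} → P i j l → P j i l) → (∀ {i j l} → P i j l → P i l j) →
            (∀ i j l → i Fin.< j → j Fin.< l → P i j l) → ∀ i j l → Distinct i j l → P i j l
unordered {P = P} swap₁₂ swap₂₃ sorted i j l (i≢j , j≢l , i≢l) with Fin.<-cmp i j | Fin.<-cmp j l | Fin.<-cmp i l
... | tri≈ _ eq _ | _ | _ = ⊥-elim (i≢j eq)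
... | _ | tri≈ _ eq _ | _ = ⊥-elim (j≢l eq)
... | _ | _ | tri≈ _ eq _ = ⊥-elim (i≢l eq)
... | tri< i<j _ _ | tri< j<l _ _ | _            = sorted i j l i<j j<l
... | tri< i<j _ _ | tri> _ _ l<j | tri< i<l _ _ = swap₂₃ (sorted i l j i<l l<j)
... | tri< i<j _ _ | tri> _ _ l<j | tri> _ _ l<i = swap₂₃ (swap₁₂ (sorted l i j l<i i<j))
... | tri> _ _ j<i | tri< j<l _ _ | tri< i<l _ _ = swap₁₂ (sorted j i l j<i i<l)
... | tri> _ _ j<i | tri< j<l _ _ | tri> _ _ l<i = swap₁₂ (swap₂₃ (sorted j l i j<l l<i))
... | tri> _ _ j<i | tri> _ _ l<j | _            = swap₁₂ (swap₂₃ (swap₁₂ (sorted l j i l<j j<i)))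

forced-value : ∀ {k} (δ : Fin k → Fin k) → (∀ {i j} → i ≢ j → δ i ≢ δ j) → ∀ x j → (∀ i → i ≢ j → x ≡ δ i → ⊥) → x ≡ δ j
forced-value δ δ-inj x j avoids with injective⇒surjective δ δ-inj x
... | i , δi≡x with i Fin.≟ j
...   | yes refl = sym δi≡x
...   | no i≢j   = ⊥-elim (avoids i i≢j (sym δi≡x))

-- Special positions form an initial segment, so a sorted triple has one of only four sequences of
-- kinds.
data Specials (b : ℕ) (i j l : ℕ) : Set where
  specials₃ : l < b → Specials b i j l
  specials₂ : j < b → b ≤ l → Specials b i j l
  specials₁ : i < b → b ≤ j → Specials b i j l
  specials₀ : b ≤ i → Specials b i j l

specials-of : ∀ b i j l → Specials b i j l
specials-of b i j l with l <? b | j <? b | i <? b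
... | yes l<b | _       | _       = specials₃ l<b
... | no l≮b  | yes j<b | _       = specials₂ j<b (ℕ.≮⇒≥ l≮b)
... | no _    | no j≮b  | yes i<b = specials₁ i<b (ℕ.≮⇒≥ j≮b)
... | no _    | no _    | no i≮b  = specials₀ (ℕ.≮⇒≥ i≮b)

kindℕ-light : ∀ b e p → p < b + e → weight (kindℕ b e p) ≤ 1
kindℕ-light b e p p<b+e with p <? b | p <? b + e
... | yes _ | _     = z≤n
... | no _  | yes _ = s≤s z≤n
... | no _  | no ¬p = ⊥-elim (¬p p<b+e)

-- The disjoint union, over the roots, of all copies of all shapes, whose positions carry labels in Fin N.
module Base (k t n N : ℕ) (4≤t : 4 ≤ t) (H : Hyp3 n) (c : Fin n → Fin n → Fin n → Fin k) (good : GoodColoring H k t c) where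

  open Shapes k t n 4≤t H c good
  open Shape

  -- With the host in the label, the roots seen by a vertex are bounded by its label alone, which
  -- every copy preserves.
  Label : Set
  Label = Fin N × Host

  -- The clause for two roots becomes the condition on pairs of codegree zero in `H`; the clauses
  -- for a root and a label leave a new vertex at most three roots to see.
  Compatible : Fin n ⊎ Label → Fin n ⊎ Label → Set
  Compatible (inj₁ x)       (inj₁ y)       = ∃ λ z → E H x y z ≡ true
  Compatible (inj₁ x)       (inj₂ (_ , h)) = Sees h x
  Compatible (inj₂ (_ , h)) (inj₁ x)       = Sees h x
  Compatible (inj₂ _)       (inj₂ _)       = ⊤

  Adm : Fin n ⊎ Label → Fin n ⊎ Label → Set
  Adm u v = u ≢ v × Compatible u v

  open Partite n k t 4≤t (Prod.≡-dec Fin._≟_ (Finite._≟_ finite-Host)) Adm (λ a → proj₁ a refl) public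

  -- Without a host, a special position cannot be told from an ordinary one by its label; the
  -- injectivity of `δ` rests on this.
  hostOf : Shape → Kind → Host
  hostOf κ special  = host κ
  hostOf κ ordinary = nothing
  hostOf κ dummy    = nothing

  Sequence : Set
  Sequence = Vec (Fin N) (suc (suc t))

  W₀ V₀ : Set
  W₀ = Shape × Sequence × Position
  V₀ = Fin n ⊎ W₀

  finite-W₀ : Finite W₀
  finite-W₀ = finite-× finite-Shape (finite-× (finite-Vec (finite-Fin N) _) (finite-Fin _))

  label₀ : W₀ → Label
  label₀ (κ , s , p) = lookup s p , hostOf κ (kind κ p)

  labelV₀ : V₀ → Fin n ⊎ Label
  labelV₀ = Sum.map₂ label₀

  at : Shape → Sequence → Fin n ⊎ Position → V₀
  at κ s = Sum.map₂ (λ p → κ , s , p)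

  kindV : Shape → Fin n ⊎ Position → Fin n ⊎ Kind
  kindV κ = Sum.map₂ (kind κ)

  -- Sequences may repeat labels; requiring distinct labels in each edge keeps the union partite.
  Apart : V₀ → V₀ → V₀ → Set
  Apart u v w = labelV₀ u ≢ labelV₀ v × labelV₀ v ≢ labelV₀ w × labelV₀ u ≢ labelV₀ w

  Edge₀ : V₀ → V₀ → V₀ → Fin k → Set
  Edge₀ u v w m = Apart u v w × Σ Shape λ κ → Σ Sequence λ s →
    Σ (Fin n ⊎ Position) λ a → Σ (Fin n ⊎ Position) λ b → Σ (Fin n ⊎ Position) λ d →
    (at κ s a ≡ u × at κ s b ≡ v × at κ s d ≡ w) × colour κ (kindV κ a) (kindV κ b) (kindV κ d) ≡ just m

  edge₀? : ∀ u v w m → Dec (Edge₀ u v w m)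
  edge₀? u v w m = (¬? (labelV₀ u ≟L labelV₀ v) ×-dec ¬? (labelV₀ v ≟L labelV₀ w) ×-dec ¬? (labelV₀ u ≟L labelV₀ w)) ×-dec
    any? finite-Shape λ κ → any? (finite-Vec (finite-Fin N) _) λ s → any? F λ a → any? F λ b → any? F λ d →
      ((at κ s a ≟V u) ×-dec (at κ s b ≟V v) ×-dec (at κ s d ≟V w)) ×-dec
      Maybe.≡-dec Fin._≟_ (colour κ (kindV κ a) (kindV κ b) (kindV κ d)) (just m)
    where
    F = finite-⊎ (finite-Fin n) (finite-Fin (suc (suc t)))
    open Finite (finite-⊎ (finite-Fin n) finite-W₀) renaming (_≟_ to _≟V_)
    open Finite (finite-⊎ (finite-Fin n) (finite-× (finite-Fin N) finite-Host)) renaming (_≟_ to _≟L_)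

  opaque
    R₀ : V₀ → V₀ → V₀ → Fin k → Bool
    R₀ u v w m = does (edge₀? u v w m)

    R₀⇒ : ∀ {u v w m} → R₀ u v w m ≡ true → Edge₀ u v w m
    R₀⇒ {u} {v} {w} {m} = does⇒ (edge₀? u v w m)

    ⇒R₀ : ∀ {u v w m} → Edge₀ u v w m → R₀ u v w m ≡ true
    ⇒R₀ {u} {v} {w} {m} = ⇒does (edge₀? u v w m)

  at-overlap : ∀ {κ κ′ s s′} a a′ → at κ s a ≡ at κ′ s′ a′ →
               (Σ (Fin n) λ r → a ≡ inj₁ r × a′ ≡ inj₁ r) ⊎ (κ ≡ κ′ × s ≡ s′ × a ≡ a′)
  at-overlap (inj₁ r) (inj₁ .r) refl = inj₁ (r , refl , refl)
  at-overlap (inj₂ p) (inj₂ .p) refl = inj₂ (refl , refl , refl)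

  at-injective : ∀ {κ s} a a′ → at κ s a ≡ at κ s a′ → a ≡ a′
  at-injective (inj₁ r) (inj₁ .r) refl = refl
  at-injective (inj₂ p) (inj₂ .p) refl = refl

  -- The edge might come from another copy. A position in it determines the copy, and an edge of
  -- roots only is coloured by `c` in every shape.
  R₀-colour : ∀ {κ s a b d m} → R₀ (at κ s a) (at κ s b) (at κ s d) m ≡ true →
              Apart (at κ s a) (at κ s b) (at κ s d) × colour κ (kindV κ a) (kindV κ b) (kindV κ d) ≡ just m
  R₀-colour {κ} {s} {a} {b} {d} {m} r with R₀⇒ r
  ... | apart , κ′ , s′ , a′ , b′ , d′ , (ea , eb , ed) , col = apart , same (at-overlap a′ a ea) (at-overlap b′ b eb) (at-overlap d′ d ed)
    where
    Overlap : Fin n ⊎ Position → Fin n ⊎ Position → Set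
    Overlap a a′ = (Σ (Fin n) λ r → a ≡ inj₁ r × a′ ≡ inj₁ r) ⊎ (κ′ ≡ κ × s′ ≡ s × a ≡ a′)
    one-shape : κ′ ≡ κ → s′ ≡ s → colour κ (kindV κ a) (kindV κ b) (kindV κ d) ≡ just m
    one-shape refl refl with refl ← at-injective a′ a ea | refl ← at-injective b′ b eb | refl ← at-injective d′ d ed = col
    same : Overlap a′ a → Overlap b′ b → Overlap d′ d → colour κ (kindV κ a) (kindV κ b) (kindV κ d) ≡ just m
    same (inj₂ (eκ , es , _)) _ _ = one-shape eκ es
    same (inj₁ _) (inj₂ (eκ , es , _)) _ = one-shape eκ es
    same (inj₁ _) (inj₁ _) (inj₂ (eκ , es , _)) = one-shape eκ es
    same (inj₁ (_ , refl , refl)) (inj₁ (_ , refl , refl)) (inj₁ (_ , refl , refl)) = col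

  colour-R₀ : ∀ {κ s a b d m} → Apart (at κ s a) (at κ s b) (at κ s d) →
              colour κ (kindV κ a) (kindV κ b) (kindV κ d) ≡ just m → R₀ (at κ s a) (at κ s b) (at κ s d) m ≡ true
  colour-R₀ {κ} {s} {a} {b} {d} apart col = ⇒R₀ (apart , κ , s , a , b , d , (refl , refl , refl) , col)

  R₀-swap₁₂ : ∀ u v w m → R₀ u v w m ≡ true → R₀ v u w m ≡ true
  R₀-swap₁₂ u v w m r with R₀⇒ r
  ... | (uv , vw , uw) , κ , s , a , b , d , (ea , eb , ed) , col =
    ⇒R₀ ((uv ∘ sym , uw , vw) , κ , s , b , a , d , (eb , ea , ed) , trans (sym (colour-sym₁₂ κ (kindV κ a) (kindV κ b) (kindV κ d))) col)

  R₀-swap₂₃ : ∀ u v w m → R₀ u v w m ≡ true → R₀ u w v m ≡ true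
  R₀-swap₂₃ u v w m r with R₀⇒ r
  ... | (uv , vw , uw) , κ , s , a , b , d , (ea , eb , ed) , col =
    ⇒R₀ ((uw , vw ∘ sym , uv) , κ , s , a , d , b , (ea , ed , eb) , trans (sym (colour-sym₂₃ κ (kindV κ a) (kindV κ b) (kindV κ d))) col)

  R₀-functional : ∀ {u v w m m′} → R₀ u v w m ≡ true → R₀ u v w m′ ≡ true → m ≡ m′
  R₀-functional r r′ with R₀⇒ r
  ... | apart , κ , s , a , b , d , (refl , refl , refl) , col =
    Maybe.just-injective (trans (sym col) (proj₂ (R₀-colour {κ} {s} {a} {b} {d} r′)))

  compatible : ∀ {κ s} a b d {m} → Apart (at κ s a) (at κ s b) (at κ s d) → colour κ (kindV κ a) (kindV κ b) (kindV κ d) ≡ just m →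
               Compatible (labelV₀ (at κ s a)) (labelV₀ (at κ s b))
  compatible (inj₁ x) (inj₁ y) (inj₁ z) _ col = z , proj₁ (when-inv (E H x y z Bool.≟ true) col)
  compatible {κ} (inj₁ x) (inj₁ y) (inj₂ p) (x≢y , _) col =
    let (v , _ , sx , sy , _) = colour-HH-inv κ x y (kind κ p) col
    in host-pair (proj₁ (proj₂ (proj₂ v))) sx sy (λ eq → x≢y (cong inj₁ eq))
  compatible {κ} (inj₁ x) (inj₂ p) (inj₁ y) _ col =
    let (_ , sp , sx , _ , _) = colour-HH-inv κ x y (kind κ p) col
    in subst (λ u → Sees (hostOf κ u) x) (sym sp) sx
  compatible {κ} (inj₁ x) (inj₂ p) (inj₂ p′) _ col =
    let (_ , sp , _ , sx , _) = colour-H-inv κ x (kind κ p) (kind κ p′) col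
    in subst (λ u → Sees (hostOf κ u) x) (sym sp) sx
  compatible {κ} (inj₂ p) (inj₁ x) (inj₁ y) _ col =
    let (_ , sp , sx , _ , _) = colour-HH-inv κ x y (kind κ p) col
    in subst (λ u → Sees (hostOf κ u) x) (sym sp) sx
  compatible {κ} (inj₂ p) (inj₁ x) (inj₂ p′) _ col =
    let (_ , sp , _ , sx , _) = colour-H-inv κ x (kind κ p) (kind κ p′) col
    in subst (λ u → Sees (hostOf κ u) x) (sym sp) sx
  compatible (inj₂ p) (inj₂ p′) _ _ _ = tt

  R₀-adm : ∀ {u v w m} → R₀ u v w m ≡ true → Adm (labelV₀ u) (labelV₀ v)
  R₀-adm r with R₀⇒ r
  ... | apart , κ , s , a , b , d , (refl , refl , refl) , col = proj₁ apart , compatible {κ} {s} a b d apart col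

  module Clique₀ (g : Fin t → V₀) (m : Fin k) (mono : ∀ i j l → Distinct i j l → R₀ (g i) (g j) (g l) m ≡ true) where

    Within : Shape → Sequence → Fin t → Set
    Within κ s i = Σ (Fin n ⊎ Position) λ a → at κ s a ≡ g i

    pair : ∀ {i j} → i ≢ j → Σ Shape λ κ → Σ Sequence λ s → Within κ s i × Within κ s j
    pair {i} {j} i≢j with R₀⇒ (mono i j _ (proj₂ (third 4≤t i j i≢j)))
    ... | _ , κ , s , a , b , _ , (ea , eb , _) , _ = κ , s , (a , ea) , (b , eb)

    own : ∀ {κ s κ′ s′ p i} → g i ≡ inj₂ (κ′ , s′ , p) → Within κ s i → κ ≡ κ′ × s ≡ s′
    own gi (inj₁ r , eq) with () ← trans eq gi
    own gi (inj₂ p , eq) with refl ← trans eq gi = refl , refl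

    -- A position determines its copy, and all other vertices of the clique share an edge with it. A
    -- clique of roots lies in every copy.
    one-shape : Σ Shape λ κ → Σ Sequence λ s → ∀ i → Within κ s i
    one-shape = from (any? (finite-Fin t) nonroot?)
      where
      i₁ = avoid [] (ℕ.≤-trans (s≤s z≤n) 4≤t)
      NonRoot : Fin t → Set
      NonRoot i = Σ W₀ λ w → g i ≡ inj₂ w
      nonroot? : ∀ i → Dec (NonRoot i)
      nonroot? i with g i
      ... | inj₁ r = no λ { (_ , ()) }
      ... | inj₂ w = yes (w , refl)
      with-nonroot : ∀ i₀ κ s p → g i₀ ≡ inj₂ (κ , s , p) → ∀ i → Dec (i₀ ≡ i) → Within κ s i
      with-nonroot i₀ κ s p gi i (yes eq) = inj₂ p , trans (sym gi) (cong g eq)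
      with-nonroot i₀ κ s p gi i (no ne) with pair ne
      ... | κ′ , s′ , w₀ , w with own gi w₀
      ...   | refl , refl = w
      roots : (∀ i → ¬ NonRoot i) → ∀ κ s i → Within κ s i
      roots none κ s i = from-root (g i) refl
        where
        from-root : ∀ u → g i ≡ u → Within κ s i
        from-root (inj₁ r) eq = inj₁ r , sym eq
        from-root (inj₂ w) eq = ⊥-elim (none i (w , eq))
      from : Dec (∃ NonRoot) → Σ Shape λ κ → Σ Sequence λ s → ∀ i → Within κ s i
      from (yes (i₀ , (κ , s , p) , gi)) = κ , s , λ i → with-nonroot i₀ κ s p gi i (i₀ Fin.≟ i)
      from (no none) = let (κ , s , _) = pair (proj₂ (another 4≤t (proj₁ i₁)))
                       in κ , s , roots (λ i nr → none (i , nr)) κ s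

    contradictory : ⊥
    contradictory with one-shape
    ... | κ , s , within = ShapeClique.contradictory κ (proj₁ ∘ within) inj m λ i j l d → proj₂ (edge d)
      where
      edge : ∀ {i j l} → Distinct i j l → Apart (at κ s (proj₁ (within i))) (at κ s (proj₁ (within j))) (at κ s (proj₁ (within l))) ×
             colour κ (kindV κ (proj₁ (within i))) (kindV κ (proj₁ (within j))) (kindV κ (proj₁ (within l))) ≡ just m
      edge {i} {j} {l} d = R₀-colour {κ} {s} {proj₁ (within i)} {proj₁ (within j)} {proj₁ (within l)}
        (trans (cong₃ (λ u v w → R₀ u v w m) (proj₂ (within i)) (proj₂ (within j)) (proj₂ (within l))) (mono i j l d))
      inj : ∀ {i j} → i ≢ j → proj₁ (within i) ≢ proj₁ (within j)
      inj {i} {j} i≢j eq = proj₁ (proj₁ (edge (proj₂ (third 4≤t i j i≢j)))) (cong (labelV₀ ∘ at κ s) eq)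

  P₀ : System
  P₀ = record
    { W = W₀ ; finite-W = finite-W₀ ; label = label₀ ; R = R₀
    ; R-sym₁₂ = λ u v w m → true⇔⇒≡ (R₀-swap₁₂ u v w m) (R₀-swap₁₂ v u w m)
    ; R-sym₂₃ = λ u v w m → true⇔⇒≡ (R₀-swap₂₃ u v w m) (R₀-swap₂₃ u w v m)
    ; R-functional = R₀-functional ; R-adm = R₀-adm
    ; R-free = Clique₀.contradictory }

-- Sublists, and sequences with prescribed entries

triple-⊆ : ∀ {A : Set} (xs : List A) {i j l} → i Fin.< j → j Fin.< l →
           List.lookup xs i ∷ List.lookup xs j ∷ List.lookup xs l ∷ [] ⊆ xs
triple-⊆ (x ∷ xs) {suc i} {suc j} {suc l} (s≤s i<j) (s≤s j<l) = x ∷ʳ triple-⊆ xs i<j j<l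
triple-⊆ (x ∷ xs) {zero}  {suc j} {suc l} _         (s≤s j<l) = refl ∷ pair-⊆ xs j<l
  where
  single-⊆ : ∀ {A : Set} (xs : List A) i → List.lookup xs i ∷ [] ⊆ xs
  single-⊆ (x ∷ xs) zero    = refl ∷ Sub.[]⊆-universal xs
  single-⊆ (x ∷ xs) (suc i) = x ∷ʳ single-⊆ xs i
  pair-⊆ : ∀ {A : Set} (xs : List A) {i j} → i Fin.< j → List.lookup xs i ∷ List.lookup xs j ∷ [] ⊆ xs
  pair-⊆ (x ∷ xs) {suc i} {suc j} (s≤s i<j) = x ∷ʳ pair-⊆ xs i<j
  pair-⊆ (x ∷ xs) {zero}  {suc j} _         = refl ∷ single-⊆ xs j

unique-⊆ : ∀ {A : Set} {xs ys : List A} → xs ⊆ ys → Unique ys → Unique xs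
unique-⊆ []         u        = []
unique-⊆ (_ ∷ʳ s)   (_ ∷ u)  = unique-⊆ s u
unique-⊆ (refl ∷ s) (px ∷ u) = Sub.All-resp-⊆ s px ∷ unique-⊆ s u

module _ {A : Set} {m r : ℕ} (ps : Vec (Fin m) r) (xs : Vec A r) (default : A) where

  value : ∀ p → Dec (∃ λ i → p ≡ lookup ps i) → A
  value p (yes (i , _)) = lookup xs i
  value p (no _)        = default

  opaque
    -- Extends labels prescribed at three positions to a full sequence; the type of the triple at
    -- these positions does not see the other entries.
    interpolate : Vec A m
    interpolate = Vec.tabulate λ p → value p (any? (finite-Fin r) λ i → p Fin.≟ lookup ps i)

    interpolate-at : (∀ i j → lookup ps i ≡ lookup ps j → i ≡ j) → ∀ i → lookup interpolate (lookup ps i) ≡ lookup xs i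
    interpolate-at inj i = trans (Vec.lookup∘tabulate _ (lookup ps i)) (value-at (any? (finite-Fin r) λ j → lookup ps i Fin.≟ lookup ps j))
      where
      value-at : ∀ d → value (lookup ps i) d ≡ lookup xs i
      value-at (yes (j , eq)) = cong (lookup xs) (sym (inj i j eq))
      value-at (no none)      = ⊥-elim (none (i , refl))

-- Types of triples and the colours forced on them

module Forcing (k t′ n : ℕ) (2≤k : 2 ≤ k) (H : Hyp3 n) (c : Fin n → Fin n → Fin n → Fin k)
               (good : GoodColoring H k (4 + t′) c) where

  t : ℕ
  t = 4 + t′

  4≤t : 4 ≤ t
  4≤t = s≤s (s≤s (s≤s (s≤s z≤n)))

  open Shapes k t n 4≤t H c good public

  some-colour : Fin k
  some-colour = fromℕ< (ℕ.≤-trans (s≤s z≤n) 2≤k)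

  Place : Set
  Place = Fin 3 ⊎ Fin n

  opaque
    finite-Places : Finite (Place × Place × Place)
    finite-Places = finite-× finite-Place (finite-× finite-Place finite-Place)
      where
      finite-Place : Finite Place
      finite-Place = finite-⊎ (finite-Fin 3) (finite-Fin n)

    finite-Code : Finite (Shape × Vec Position 3)
    finite-Code = finite-× finite-Shape (finite-Vec (finite-Fin _) 3)

  -- The colours of all triples formed from three given positions and the roots. Making patterns
  -- homogeneous, rather than single colours, treats edges with any number of roots together.
  Pattern : Set
  Pattern = Vec (Fin k) (size finite-Places)

  finite-Pattern : Finite Pattern
  finite-Pattern = finite-Vec (finite-Fin k) (size finite-Places)

  finite-Patterns : Finite (Vec Pattern (size finite-Code))
  finite-Patterns = finite-Vec finite-Pattern (size finite-Code)

  opaque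
    -- A homogeneous set of `2 + t` labels is required, one for each position.
    N₀ : ℕ
    N₀ = proj₁ (ramsey finite-Patterns 3 (2 + t))

    homogeneous-list : (χ : List (Fin (suc N₀)) → Vec Pattern (size finite-Code)) →
      Σ (List (Fin (suc N₀))) λ ys → ys ⊆ allFin (suc N₀) × 2 + t ≤ length ys × Homogeneous finite-Patterns 3 χ ys
    homogeneous-list = proj₂ (ramsey finite-Patterns 3 (2 + t)) (allFin (suc N₀))
      (ℕ.≤-trans (ℕ.n≤1+n N₀) (ℕ.≤-reflexive (sym (List.length-tabulate {n = suc N₀} id))))

  N : ℕ
  N = suc N₀

  open Base k t n N 4≤t H c good public
  open Shape
  open System using (vertex)

  triple : Shape → Sequence → Vec Position 3 → Vec W₀ 3
  triple κ s ps = Vec.map (λ p → κ , s , p) ps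

  place : Vec Position 3 → Place → Fin n ⊎ Position
  place ps (inj₁ i) = inj₂ (lookup ps i)
  place ps (inj₂ r) = inj₁ r

  vertex-triple : ∀ κ s ps a → vertex P₀ (triple κ s ps) a ≡ at κ s (place ps a)
  vertex-triple κ s ps (inj₁ i) = cong inj₂ (Vec.lookup-map i _ ps)
  vertex-triple κ s ps (inj₂ r) = refl

  kindPlace : Vec Kind 3 → Place → Fin n ⊎ Kind
  kindPlace us (inj₁ i) = inj₂ (lookup us i)
  kindPlace us (inj₂ r) = inj₁ r

  kindV-place : ∀ κ ps a → kindV κ (place ps a) ≡ kindPlace (Vec.map (kind κ) ps) a
  kindV-place κ ps (inj₁ i) = cong inj₂ (sym (Vec.lookup-map i (kind κ) ps))
  kindV-place κ ps (inj₂ r) = refl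

  total : Vec Kind 3 → ℕ
  total us = weight (lookup us zero) + weight (lookup us (suc zero)) + weight (lookup us (suc (suc zero)))

  total-permuted : ∀ us {i j l} → Distinct i j l → weight (lookup us i) + weight (lookup us j) + weight (lookup us l) ≡ total us
  total-permuted us {i} {j} {l} = go i j l
    where
    w = λ i → weight (lookup us i)
    swap₁₂ : ∀ x y z → x + y + z ≡ y + x + z
    swap₁₂ x y z = cong (_+ z) (ℕ.+-comm x y)
    swap₂₃ : ∀ x y z → x + y + z ≡ x + z + y
    swap₂₃ x y z = trans (ℕ.+-assoc x y z) (trans (cong (x +_) (ℕ.+-comm y z)) (sym (ℕ.+-assoc x z y)))
    go : ∀ i j l → Distinct i j l → w i + w j + w l ≡ total us
    go zero zero _ (ne , _ , _) = ⊥-elim (ne refl)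
    go zero (suc zero) zero (_ , _ , ne) = ⊥-elim (ne refl)
    go zero (suc zero) (suc zero) (_ , ne , _) = ⊥-elim (ne refl)
    go zero (suc zero) (suc (suc zero)) _ = refl
    go zero (suc (suc zero)) zero (_ , _ , ne) = ⊥-elim (ne refl)
    go zero (suc (suc zero)) (suc zero) _ = swap₂₃ (w zero) _ _
    go zero (suc (suc zero)) (suc (suc zero)) (_ , ne , _) = ⊥-elim (ne refl)
    go (suc zero) zero zero (_ , ne , _) = ⊥-elim (ne refl)
    go (suc zero) zero (suc zero) (_ , _ , ne) = ⊥-elim (ne refl)
    go (suc zero) zero (suc (suc zero)) _ = swap₁₂ (w (suc zero)) _ _
    go (suc zero) (suc zero) _ (ne , _ , _) = ⊥-elim (ne refl)
    go (suc zero) (suc (suc zero)) zero _ = trans (swap₂₃ (w (suc zero)) _ _) (swap₁₂ (w (suc zero)) _ _)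
    go (suc zero) (suc (suc zero)) (suc zero) (_ , _ , ne) = ⊥-elim (ne refl)
    go (suc zero) (suc (suc zero)) (suc (suc zero)) (_ , ne , _) = ⊥-elim (ne refl)
    go (suc (suc zero)) zero zero (_ , ne , _) = ⊥-elim (ne refl)
    go (suc (suc zero)) zero (suc zero) _ = trans (swap₁₂ (w (suc (suc zero))) _ _) (swap₂₃ (w zero) _ _)
    go (suc (suc zero)) zero (suc (suc zero)) (_ , _ , ne) = ⊥-elim (ne refl)
    go (suc (suc zero)) (suc zero) zero _ =
      trans (swap₁₂ (w (suc (suc zero))) _ _) (trans (swap₂₃ (w (suc zero)) _ _) (swap₁₂ (w (suc zero)) _ _))
    go (suc (suc zero)) (suc zero) (suc zero) (_ , ne , _) = ⊥-elim (ne refl)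
    go (suc (suc zero)) (suc zero) (suc (suc zero)) (_ , _ , ne) = ⊥-elim (ne refl)
    go (suc (suc zero)) (suc (suc zero)) _ (ne , _ , _) = ⊥-elim (ne refl)

  -- Triples of kinds us in κ and vs in κ′ span, together with the roots, the same coloured 3-graph.
  record Agree (κ κ′ : Shape) (us vs : Vec Kind 3) : Set where
    field
      valid : Valid κ
      valid′ : Valid κ′
      hosts : ∀ i → hostOf κ (lookup us i) ≡ hostOf κ′ (lookup vs i)
      agree-HH : ∀ x y i → colour-HH κ x y (weight (lookup us i)) ≡ colour-HH κ′ x y (weight (lookup vs i))
      agree-H : ∀ x i j → i ≢ j → colour-H κ x (weight (lookup us i) + weight (lookup us j))
                                ≡ colour-H κ′ x (weight (lookup vs i) + weight (lookup vs j))
      agree-∅ : colour-∅ κ (total us) ≡ colour-∅ κ′ (total vs)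
  open Agree

  agree-sym : ∀ {κ κ′ us vs} → Agree κ κ′ us vs → Agree κ′ κ vs us
  agree-sym A = record
    { valid = valid′ A ; valid′ = valid A ; hosts = sym ∘ hosts A ; agree-HH = λ x y i → sym (agree-HH A x y i)
    ; agree-H = λ x i j ne → sym (agree-H A x i j ne) ; agree-∅ = sym (agree-∅ A) }

  agree-colour : ∀ {κ κ′ us vs} → Agree κ κ′ us vs → ∀ a b d → a ≢ b → b ≢ d → a ≢ d →
                 colour κ (kindPlace us a) (kindPlace us b) (kindPlace us d) ≡ colour κ′ (kindPlace vs a) (kindPlace vs b) (kindPlace vs d)
  agree-colour {κ} {κ′} {us} {vs} A = go
    where
    both : ∀ {x y : Maybe (Fin k)} → x ≡ y → when (valid? κ) x ≡ when (valid? κ′) y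
    both eq = trans (when-true (valid? κ) (valid A)) (trans eq (sym (when-true (valid? κ′) (valid′ A))))
    inj₁-≢ : ∀ {i j : Fin 3} → _≢_ {A = Place} (inj₁ i) (inj₁ j) → i ≢ j
    inj₁-≢ ne eq = ne (cong inj₁ eq)
    go : ∀ a b d → a ≢ b → b ≢ d → a ≢ d → colour κ (kindPlace us a) (kindPlace us b) (kindPlace us d)
                                             ≡ colour κ′ (kindPlace vs a) (kindPlace vs b) (kindPlace vs d)
    go (inj₂ x) (inj₂ y) (inj₂ z) _ _ _ = refl
    go (inj₂ x) (inj₂ y) (inj₁ i) _ _ _ = both (agree-HH A x y i)
    go (inj₂ x) (inj₁ i) (inj₂ y) _ _ _ = both (agree-HH A x y i)
    go (inj₁ i) (inj₂ x) (inj₂ y) _ _ _ = both (agree-HH A x y i)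
    go (inj₂ x) (inj₁ i) (inj₁ j) _ ne _ = both (agree-H A x i j (inj₁-≢ ne))
    go (inj₁ i) (inj₂ x) (inj₁ j) _ _ ne = both (agree-H A x i j (inj₁-≢ ne))
    go (inj₁ i) (inj₁ j) (inj₂ x) ne _ _ = both (agree-H A x i j (inj₁-≢ ne))
    go (inj₁ i) (inj₁ j) (inj₁ l) ne ne′ ne″ = both (trans (cong (colour-∅ κ) (total-permuted us d)) (trans (agree-∅ A)
                                                       (sym (cong (colour-∅ κ′) (total-permuted vs d)))))
      where d = inj₁-≢ ne , inj₁-≢ ne′ , inj₁-≢ ne″

  -- By `R₀-colour` and its converse, the edges among a triple and the roots depend only on its
  -- labels and on the colours of the kinds involved.
  agree-alike : ∀ {κ κ′} s s′ ps ps′ → (∀ i → lookup s (lookup ps i) ≡ lookup s′ (lookup ps′ i)) →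
                Agree κ κ′ (Vec.map (kind κ) ps) (Vec.map (kind κ′) ps′) → Alike P₀ P₀ (triple κ s ps) (triple κ′ s′ ps′)
  agree-alike {κ} {κ′} s s′ ps ps′ same A = labels , λ a b d m → true⇔⇒≡
      (transfer {κ} {κ′} s s′ ps ps′ A label-at a b d m)
      (transfer {κ′} {κ} s′ s ps′ ps (agree-sym A) (sym ∘ label-at) a b d m)
    where
    label-eq : ∀ i → label₀ (κ , s , lookup ps i) ≡ label₀ (κ′ , s′ , lookup ps′ i)
    label-eq i = cong₂ _,_ (same i) (trans (cong (hostOf κ) (sym (Vec.lookup-map i (kind κ) ps)))
      (trans (hosts A i) (cong (hostOf κ′) (Vec.lookup-map i (kind κ′) ps′))))
    labels : ∀ i → label₀ (lookup (triple κ s ps) i) ≡ label₀ (lookup (triple κ′ s′ ps′) i)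
    labels i = trans (cong label₀ (Vec.lookup-map i _ ps)) (trans (label-eq i) (sym (cong label₀ (Vec.lookup-map i _ ps′))))
    label-at : ∀ a → labelV₀ (at κ s (place ps a)) ≡ labelV₀ (at κ′ s′ (place ps′ a))
    label-at (inj₁ i) = cong inj₂ (label-eq i)
    label-at (inj₂ r) = refl
    transfer : ∀ {κ κ′} s s′ ps ps′ → Agree κ κ′ (Vec.map (kind κ) ps) (Vec.map (kind κ′) ps′) →
      (∀ a → labelV₀ (at κ s (place ps a)) ≡ labelV₀ (at κ′ s′ (place ps′ a))) → ∀ a b d m →
      R₀ (vertex P₀ (triple κ s ps) a) (vertex P₀ (triple κ s ps) b) (vertex P₀ (triple κ s ps) d) m ≡ true →
      R₀ (vertex P₀ (triple κ′ s′ ps′) a) (vertex P₀ (triple κ′ s′ ps′) b) (vertex P₀ (triple κ′ s′ ps′) d) m ≡ true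
    transfer {κ} {κ′} s s′ ps ps′ A lab a b d m r =
      let ((ab , bd , ad) , col) = R₀-colour {κ} {s} {place ps a} {place ps b} {place ps d} (trans (sym (vertices κ s ps)) r)
          col′ = trans (kinds κ′ ps′) (trans (sym (agree-colour A a b d (differ a b ab) (differ b d bd) (differ a d ad)))
                   (trans (sym (kinds κ ps)) col))
      in trans (vertices κ′ s′ ps′) (colour-R₀ {κ′} {s′} {place ps′ a} {place ps′ b} {place ps′ d}
                                       (apart a b ab , apart b d bd , apart a d ad) col′)
      where
      apart : ∀ x y → labelV₀ (at κ s (place ps x)) ≢ labelV₀ (at κ s (place ps y)) →
              labelV₀ (at κ′ s′ (place ps′ x)) ≢ labelV₀ (at κ′ s′ (place ps′ y))
      apart x y ne eq = ne (trans (lab x) (trans eq (sym (lab y))))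
      differ : ∀ x y → labelV₀ (at κ s (place ps x)) ≢ labelV₀ (at κ s (place ps y)) → x ≢ y
      differ x y ne eq = ne (cong (labelV₀ ∘ at κ s ∘ place ps) eq)
      vertices : ∀ κ s ps → R₀ (vertex P₀ (triple κ s ps) a) (vertex P₀ (triple κ s ps) b) (vertex P₀ (triple κ s ps) d) m
                          ≡ R₀ (at κ s (place ps a)) (at κ s (place ps b)) (at κ s (place ps d)) m
      vertices κ s ps = cong₃ (λ u v w → R₀ u v w m) (vertex-triple κ s ps a) (vertex-triple κ s ps b) (vertex-triple κ s ps d)
      kinds : ∀ κ ps → colour κ (kindV κ (place ps a)) (kindV κ (place ps b)) (kindV κ (place ps d))
        ≡ colour κ (kindPlace (Vec.map (kind κ) ps) a) (kindPlace (Vec.map (kind κ) ps) b) (kindPlace (Vec.map (kind κ) ps) d)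
      kinds κ ps = cong₃ (colour κ) (kindV-place κ ps a) (kindV-place κ ps b) (kindV-place κ ps d)

  agree-refl : ∀ {κ us} → Valid κ → Agree κ κ us us
  agree-refl v = record { valid = v ; valid′ = v ; hosts = λ _ → refl ; agree-HH = λ _ _ _ → refl
                        ; agree-H = λ _ _ _ _ → refl ; agree-∅ = refl }

  -- The numbers of positions and the colours `low` and `high` enter a type only through `colour-∅`.
  -- This permits exchanging a shape for one that spans a full clique.
  agree-same : ∀ {κ κ′} us → Valid κ → Valid κ′ → host κ ≡ host κ′ → colour₁ κ ≡ colour₁ κ′ → colour₂ κ ≡ colour₂ κ′ →
               colour-∅ κ (total us) ≡ colour-∅ κ′ (total us) → Agree κ κ′ us us
  agree-same {κ} {κ′} us v v′ h c₁ c₂ ∅ = record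
    { valid = v ; valid′ = v′ ; agree-∅ = ∅
    ; hosts = λ i → host-eq (lookup us i)
    ; agree-HH = λ x y i → HH x y (weight (lookup us i))
    ; agree-H = λ x i j _ → H-eq x (weight (lookup us i) + weight (lookup us j)) }
    where
    host-eq : ∀ u → hostOf κ u ≡ hostOf κ′ u
    host-eq special  = h
    host-eq ordinary = refl
    host-eq dummy    = refl
    HH : ∀ x y s → colour-HH κ x y s ≡ colour-HH κ′ x y s
    HH x y zero    = cong₂ (λ h q → when (sees? h x) (when (sees? h y) (just q))) h c₂
    HH x y (suc s) = refl
    H-eq : ∀ x s → colour-H κ x s ≡ colour-H κ′ x s
    H-eq x zero    = cong₂ (λ h p → when (sees? h x) (just p)) h c₁
    H-eq x (suc s) = refl

  Increasing : Vec Position 3 → Set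
  Increasing (p₀ ∷ p₁ ∷ p₂ ∷ []) = p₀ Fin.< p₁ × p₁ Fin.< p₂

  increasing-injective : ∀ ps → Increasing ps → ∀ i j → lookup ps i ≡ lookup ps j → i ≡ j
  increasing-injective (p₀ ∷ p₁ ∷ p₂ ∷ []) (p₀<p₁ , p₁<p₂) = go
    where
    ≢-01 : p₀ ≢ p₁
    ≢-01 = Fin.<⇒≢ p₀<p₁
    ≢-12 : p₁ ≢ p₂
    ≢-12 = Fin.<⇒≢ p₁<p₂
    ≢-02 : p₀ ≢ p₂
    ≢-02 = Fin.<⇒≢ (ℕ.<-trans p₀<p₁ p₁<p₂)
    go : ∀ i j → lookup (p₀ ∷ p₁ ∷ p₂ ∷ []) i ≡ lookup (p₀ ∷ p₁ ∷ p₂ ∷ []) j → i ≡ j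
    go zero zero _ = refl
    go zero (suc zero) eq = ⊥-elim (≢-01 eq)
    go zero (suc (suc zero)) eq = ⊥-elim (≢-02 eq)
    go (suc zero) zero eq = ⊥-elim (≢-01 (sym eq))
    go (suc zero) (suc zero) _ = refl
    go (suc zero) (suc (suc zero)) eq = ⊥-elim (≢-12 eq)
    go (suc (suc zero)) zero eq = ⊥-elim (≢-02 (sym eq))
    go (suc (suc zero)) (suc zero) eq = ⊥-elim (≢-12 (sym eq))
    go (suc (suc zero)) (suc (suc zero)) _ = refl

  top-constant : ∀ κ → low κ ≡ high κ → top κ ≡ high κ
  top-constant κ eq with does (b κ ≤? 3)
  ... | true  = refl
  ... | false = eq

  light : ∀ κ p → toℕ p < b κ + e κ → weight (kind κ p) ≤ 1
  light κ p = kindℕ-light (b κ) (e κ) (toℕ p)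

  colour-H-special : ∀ {κ x u v} → Valid κ → Sees (host κ) x → u ≡ special → v ≡ special →
                     when (valid? κ) (colour-H κ x (weight u + weight v)) ≡ just (colour₁ κ)
  colour-H-special {κ} {x} v sx refl refl = trans (when-true (valid? κ) v) (when-true (sees? (host κ) x) sx)

  colour-HH-special : ∀ {κ x y u} → Valid κ → Sees (host κ) x → Sees (host κ) y → u ≡ special →
                      when (valid? κ) (colour-HH κ x y (weight u)) ≡ just (colour₂ κ)
  colour-HH-special {κ} {x} {y} v sx sy refl =
    trans (when-true (valid? κ) v) (trans (when-true (sees? (host κ) x) sx) (when-true (sees? (host κ) y) sy))

  edge-distinct : ∀ {x y z} → E H x y z ≡ true → x ≢ y × y ≢ z × x ≢ z
  edge-distinct {x} {y} {z} xyz =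
    (λ { refl → loop xyz }) , (λ { refl → loop (trans (sym₁₂ H y y x) (trans (sym₂₃ H y y x) (trans (sym₁₂ H y x y) xyz))) }) ,
    (λ { refl → loop (trans (sym₂₃ H x x y) xyz) })
    where
    loop : ∀ {x z} → E H x x z ≢ true
    loop {x} {z} eq with () ← trans (sym eq) (irrefl H x z)

  root-distinct : ∀ {x y : Fin n} → x ≢ y → _≢_ {A = Fin n ⊎ Position} (inj₁ x) (inj₁ y)
  root-distinct ne eq = ne (Sum.inj₁-injective eq)

  root-apart : ∀ {x : Fin n} {p : Position} → inj₁ x ≢ inj₂ p
  root-apart ()

  each : {P : Fin 3 → Set} → P zero → P (suc zero) → P (suc (suc zero)) → ∀ i → P i
  each p₀ p₁ p₂ zero             = p₀
  each p₀ p₁ p₂ (suc zero)       = p₁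
  each p₀ p₁ p₂ (suc (suc zero)) = p₂

  each-pair : {P : Fin 3 → Fin 3 → Set} → P zero (suc zero) → P zero (suc (suc zero)) → P (suc zero) zero →
              P (suc zero) (suc (suc zero)) → P (suc (suc zero)) zero → P (suc (suc zero)) (suc zero) →
              ∀ i j → i ≢ j → P i j
  each-pair p₀₁ p₀₂ p₁₀ p₁₂ p₂₀ p₂₁ zero             zero             ne = ⊥-elim (ne refl)
  each-pair p₀₁ p₀₂ p₁₀ p₁₂ p₂₀ p₂₁ zero             (suc zero)       _  = p₀₁
  each-pair p₀₁ p₀₂ p₁₀ p₁₂ p₂₀ p₂₁ zero             (suc (suc zero)) _  = p₀₂
  each-pair p₀₁ p₀₂ p₁₀ p₁₂ p₂₀ p₂₁ (suc zero)       zero             _  = p₁₀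
  each-pair p₀₁ p₀₂ p₁₀ p₁₂ p₂₀ p₂₁ (suc zero)       (suc zero)       ne = ⊥-elim (ne refl)
  each-pair p₀₁ p₀₂ p₁₀ p₁₂ p₂₀ p₂₁ (suc zero)       (suc (suc zero)) _  = p₁₂
  each-pair p₀₁ p₀₂ p₁₀ p₁₂ p₂₀ p₂₁ (suc (suc zero)) zero             _  = p₂₀
  each-pair p₀₁ p₀₂ p₁₀ p₁₂ p₂₀ p₂₁ (suc (suc zero)) (suc zero)       _  = p₂₁
  each-pair p₀₁ p₀₂ p₁₀ p₁₂ p₂₀ p₂₁ (suc (suc zero)) (suc (suc zero)) ne = ⊥-elim (ne refl)

  -- Colours forced by a colouring without monochromatic cliques

  module Coloured (φ : V₀ → V₀ → V₀ → Fin k)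
    (φ-agree : ∀ {κ κ′} s s′ ps ps′ → (∀ i → lookup s (lookup ps i) ≡ lookup s′ (lookup ps′ i)) →
               (∀ i j → lookup s′ (lookup ps′ i) ≡ lookup s′ (lookup ps′ j) → i ≡ j) →
               Agree κ κ′ (Vec.map (kind κ) ps) (Vec.map (kind κ′) ps′) → ∀ a b d →
               φ (at κ s (place ps a)) (at κ s (place ps b)) (at κ s (place ps d)) ≡
               φ (at κ′ s′ (place ps′ a)) (at κ′ s′ (place ps′ b)) (at κ′ s′ (place ps′ d)))
    (φ-sym₁₂ : ∀ {u v w m} → R₀ u v w m ≡ true → φ u v w ≡ φ v u w)
    (φ-sym₂₃ : ∀ {u v w m} → R₀ u v w m ≡ true → φ u v w ≡ φ u w v)
    (φ-free : (g : Fin t → V₀) (α : Fin k) →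
              (∀ i j l → Distinct i j l → (∃ λ m → R₀ (g i) (g j) (g l) m ≡ true) × φ (g i) (g j) (g l) ≡ α) → ⊥) where

    pattern-of : Shape → Sequence → Vec Position 3 → Pattern
    pattern-of κ s ps = table finite-Places λ (a , b , d) → φ (at κ s (place ps a)) (at κ s (place ps b)) (at κ s (place ps d))

    -- All patterns over all shapes and all placements of three given labels, so that one
    -- application of Ramsey's theorem serves every type.
    χ : List (Fin N) → Vec Pattern (size finite-Code)
    χ (x ∷ y ∷ z ∷ []) = table finite-Code λ (κ , ps) → pattern-of κ (interpolate ps (x ∷ y ∷ z ∷ []) zero) ps
    χ _                = table finite-Code λ _ → table finite-Places λ _ → some-colour

    homogeneous : Σ (List (Fin N)) λ ys → ys ⊆ allFin N × 2 + t ≤ length ys × Homogeneous finite-Patterns 3 χ ys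
    homogeneous = homogeneous-list χ

    ys : List (Fin N)
    ys = proj₁ homogeneous

    y : Position → Fin N
    y p = List.lookup ys (Fin.inject≤ p (proj₁ (proj₂ (proj₂ homogeneous))))

    y-injective : ∀ {p p′} → y p ≡ y p′ → p ≡ p′
    y-injective {p} {p′} eq = Fin.inject≤-injective _ _ p p′
      (unique-lookup (unique-⊆ (proj₁ (proj₂ homogeneous)) (Unique.allFin⁺ N)) _ _ eq)

    y-homogeneous : ∀ {p₀ p₁ p₂ q₀ q₁ q₂} → Increasing (p₀ ∷ p₁ ∷ p₂ ∷ []) → Increasing (q₀ ∷ q₁ ∷ q₂ ∷ []) →
                    χ (y p₀ ∷ y p₁ ∷ y p₂ ∷ []) ≡ χ (y q₀ ∷ y q₁ ∷ y q₂ ∷ [])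
    y-homogeneous inc inc′ = trans (to-α inc) (sym (to-α inc′))
      where
      α = proj₁ (proj₂ (proj₂ (proj₂ homogeneous)))
      inject-< : ∀ {p q : Position} .(le : 2 + t ≤ length ys) → p Fin.< q → Fin.inject≤ p le Fin.< Fin.inject≤ q le
      inject-< {p} {q} le p<q = subst₂ _<_ (sym (Fin.toℕ-inject≤ p le)) (sym (Fin.toℕ-inject≤ q le)) p<q
      to-α : ∀ {p₀ p₁ p₂} → Increasing (p₀ ∷ p₁ ∷ p₂ ∷ []) → χ (y p₀ ∷ y p₁ ∷ y p₂ ∷ []) ≡ α
      to-α (lt , lt′) = proj₂ (proj₂ (proj₂ (proj₂ homogeneous))) _ (triple-⊆ ys (inject-< _ lt) (inject-< _ lt′)) refl

    main : Sequence
    main = Vec.tabulate y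

    main-at : ∀ p → lookup main p ≡ y p
    main-at = Vec.lookup∘tabulate y

    col : Shape → Fin n ⊎ Position → Fin n ⊎ Position → Fin n ⊎ Position → Fin k
    col κ a b d = φ (at κ main a) (at κ main b) (at κ main d)

    main-injective : ∀ {p p′} → lookup main p ≡ lookup main p′ → p ≡ p′
    main-injective {p} {p′} eq = y-injective (trans (sym (main-at p)) (trans eq (main-at p′)))

    patterns-agree : ∀ κ ps xs xs′ → χ (Vec.toList xs) ≡ χ (Vec.toList xs′) → ∀ a b d →
      let s = interpolate ps xs zero ; s′ = interpolate ps xs′ zero in
      φ (at κ s (place ps a)) (at κ s (place ps b)) (at κ s (place ps d)) ≡ φ (at κ s′ (place ps a)) (at κ s′ (place ps b)) (at κ s′ (place ps d))
    patterns-agree κ ps (_ ∷ _ ∷ _ ∷ []) (_ ∷ _ ∷ _ ∷ []) eq a b d =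
      table-injective finite-Places (table-injective finite-Code eq (κ , ps)) (a , b , d)

    interpolate-main : ∀ ps qs → Increasing ps → ∀ i →
                       lookup (interpolate ps (Vec.map y qs) zero) (lookup ps i) ≡ lookup main (lookup qs i)
    interpolate-main ps qs inc i = trans (interpolate-at ps (Vec.map y qs) zero (increasing-injective ps inc) i)
                                         (trans (Vec.lookup-map i y qs) (sym (main-at (lookup qs i))))

    -- Three changes: from `main` to a sequence with the same labels at `ps`; then, by homogeneity,
    -- to the labels of `ps′` at the same positions; then, the labels now being equal, to `ps′` in
    -- `main` by agreement. Homogeneity compares sorted triples, hence `Increasing`.
    agree-col : ∀ {κ κ′} ps ps′ → Increasing ps → Increasing ps′ → Agree κ κ′ (Vec.map (kind κ) ps) (Vec.map (kind κ′) ps′) →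
                ∀ a b d → col κ (place ps a) (place ps b) (place ps d) ≡ col κ′ (place ps′ a) (place ps′ b) (place ps′ d)
    agree-col {κ} {κ′} ps@(_ ∷ _ ∷ _ ∷ []) ps′@(_ ∷ _ ∷ _ ∷ []) inc inc′ A a b d =
      trans (sym (φ-agree (interpolate ps (Vec.map y ps) zero) main ps ps (interpolate-main ps ps inc) (distinct ps inc) (agree-refl (Agree.valid A)) a b d))
        (trans (patterns-agree κ ps (Vec.map y ps) (Vec.map y ps′) (y-homogeneous inc inc′) a b d)
          (φ-agree (interpolate ps (Vec.map y ps′) zero) main ps ps′ (interpolate-main ps ps′ inc) (distinct ps′ inc′) A a b d))
      where
      distinct : ∀ ps → Increasing ps → ∀ i j → lookup main (lookup ps i) ≡ lookup main (lookup ps j) → i ≡ j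
      distinct ps inc i j eq = increasing-injective ps inc i j (main-injective eq)

    label-apart : ∀ κ a a′ → a ≢ a′ → labelV₀ (at κ main a) ≢ labelV₀ (at κ main a′)
    label-apart κ (inj₁ r) (inj₁ r′) ne eq = ne (cong inj₁ (Sum.inj₁-injective eq))
    label-apart κ (inj₂ p) (inj₂ p′) ne eq = ne (cong inj₂ (main-injective (cong proj₁ (Sum.inj₂-injective eq))))

    ColouredEdge : Shape → Fin k → Fin n ⊎ Position → Fin n ⊎ Position → Fin n ⊎ Position → Set
    ColouredEdge κ α a b d = (a ≢ b × b ≢ d × a ≢ d) ×
      (∃ λ m → colour κ (kindV κ a) (kindV κ b) (kindV κ d) ≡ just m) × col κ a b d ≡ α

    clique-free : ∀ κ (g : Fin t → Fin n ⊎ Position) α →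
                  (∀ i j l → i Fin.< j → j Fin.< l → ColouredEdge κ α (g i) (g j) (g l)) → ⊥
    clique-free κ g α sorted = φ-free (at κ main ∘ g) α (unordered swap₁₂ swap₂₃ λ i j l i<j j<l → edge (sorted i j l i<j j<l))
      where
      P : Fin t → Fin t → Fin t → Set
      P i j l = (∃ λ m → R₀ (at κ main (g i)) (at κ main (g j)) (at κ main (g l)) m ≡ true) × col κ (g i) (g j) (g l) ≡ α
      swap₁₂ : ∀ {i j l} → P i j l → P j i l
      swap₁₂ ((m , r) , eq) = (m , R₀-swap₁₂ _ _ _ m r) , trans (sym (φ-sym₁₂ r)) eq
      swap₂₃ : ∀ {i j l} → P i j l → P i l j
      swap₂₃ ((m , r) , eq) = (m , R₀-swap₂₃ _ _ _ m r) , trans (sym (φ-sym₂₃ r)) eq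
      edge : ∀ {a b d} → ColouredEdge κ α a b d → (∃ λ m → R₀ (at κ main a) (at κ main b) (at κ main d) m ≡ true) × col κ a b d ≡ α
      edge {a} {b} {d} ((ab , bd , ad) , (m , eq) , colα) =
        (m , colour-R₀ {κ} {main} {a} {b} {d} (label-apart κ a b ab , label-apart κ b d bd , label-apart κ a d ad) eq) , colα

    colourAt : Shape → Vec Position 3 → Fin k
    colourAt κ ps = col κ (place ps (inj₁ zero)) (place ps (inj₁ (suc zero))) (place ps (inj₁ (suc (suc zero))))

    HasKinds : Shape → Vec Position 3 → Vec Kind 3 → Set
    HasKinds κ ps us = Vec.map (kind κ) ps ≡ us

    has-kinds : ∀ κ {p₀ p₁ p₂ u₀ u₁ u₂} → kind κ p₀ ≡ u₀ → kind κ p₁ ≡ u₁ → kind κ p₂ ≡ u₂ →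
                HasKinds κ (p₀ ∷ p₁ ∷ p₂ ∷ []) (u₀ ∷ u₁ ∷ u₂ ∷ [])
    has-kinds κ refl refl refl = refl

    agree-col′ : ∀ {κ κ′ us vs} ps ps′ → Increasing ps → Increasing ps′ → HasKinds κ ps us → HasKinds κ′ ps′ vs → Agree κ κ′ us vs →
                 ∀ a b d → col κ (place ps a) (place ps b) (place ps d) ≡ col κ′ (place ps′ a) (place ps′ b) (place ps′ d)
    agree-col′ ps ps′ inc inc′ ks ks′ A = agree-col ps ps′ inc inc′ (subst₂ (Agree _ _) (sym ks) (sym ks′) A)

    mkValid : ∀ κ {x z} → b κ ≡ x → e κ ≡ z → x + z ≤ t → (x + z < t ⊎ (low κ ≢ high κ × 1 ≤ x × x ≤ 3)) →
              ValidHost (host κ) (colour₂ κ) → (suc x < t ⊎ top κ ≢ colour₁ κ) →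
              (suc (suc x) < t ⊎ colour₁ κ ≢ colour₂ κ ⊎ (5 ≤ t × top κ ≢ colour₁ κ)) → Valid κ
    mkValid κ refl refl v₁ v₂ v₃ v₄ v₅ = v₁ , v₂ , v₃ , v₄ , v₅

    shapeℕ : Host → ∀ x z → x ≤ t → z ≤ t → Fin k → Fin k → Fin k → Fin k → Shape
    shapeℕ h x z x≤t z≤t = shape h (fromℕ< (s≤s x≤t)) (fromℕ< (s≤s z≤t))

    pos : Fin t → Position
    pos i = Fin.inject₁ (Fin.inject₁ i)

    toℕ-pos : ∀ i → toℕ (pos i) ≡ toℕ i
    toℕ-pos i = trans (Fin.toℕ-inject₁ (Fin.inject₁ i)) (Fin.toℕ-inject₁ i)

    pos-< : ∀ {i j} → i Fin.< j → pos i Fin.< pos j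
    pos-< {i} {j} = subst₂ _<_ (sym (toℕ-pos i)) (sym (toℕ-pos j))

    -- The positions `t` and `suc t` are dummies in every valid shape. Types are defined for triples
    -- of positions, so one or two special positions beside roots are padded with dummies; this is
    -- why a shape has `t + 2` positions.
    dummy₁ dummy₂ : Position
    dummy₁ = Fin.inject₁ (Fin.fromℕ t)
    dummy₂ = Fin.fromℕ (suc t)

    toℕ-dummy₁ : toℕ dummy₁ ≡ t
    toℕ-dummy₁ = trans (Fin.toℕ-inject₁ (Fin.fromℕ t)) (Fin.toℕ-fromℕ t)

    toℕ-dummy₂ : toℕ dummy₂ ≡ suc t
    toℕ-dummy₂ = Fin.toℕ-fromℕ (suc t)

    kind-dummy₁ : ∀ {κ} → Valid κ → kind κ dummy₁ ≡ dummy
    kind-dummy₁ {κ} v = kindℕ-dummy (subst (b κ + e κ ≤_) (sym toℕ-dummy₁) (proj₁ v))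

    kind-dummy₂ : ∀ {κ} → Valid κ → kind κ dummy₂ ≡ dummy
    kind-dummy₂ {κ} v = kindℕ-dummy (subst (b κ + e κ ≤_) (sym toℕ-dummy₂) (ℕ.m≤n⇒m≤1+n (proj₁ v)))

    special-below : ∀ {κ p} → kind κ p ≡ special → toℕ p < b κ
    special-below {κ} = special⇒< (b κ) (e κ) _

    special<dummy₁ : ∀ {κ p} → Valid κ → kind κ p ≡ special → p Fin.< dummy₁
    special<dummy₁ {κ} {p} v ks = subst (toℕ p <_) (sym toℕ-dummy₁)
      (ℕ.<-≤-trans (special-below {κ} ks) (ℕ.≤-trans (ℕ.m≤m+n (b κ) (e κ)) (proj₁ v)))

    dummy₁<dummy₂ : dummy₁ Fin.< dummy₂
    dummy₁<dummy₂ = subst₂ _<_ (sym toℕ-dummy₁) (sym toℕ-dummy₂) ℕ.≤-refl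

    <⇒apart : ∀ {p p′ : Position} → p Fin.< p′ → _≢_ {A = Fin n ⊎ Position} (inj₂ p) (inj₂ p′)
    <⇒apart p<p′ eq = Fin.<⇒≢ p<p′ (Sum.inj₂-injective eq)

    positions-coloured : ∀ {κ α} p₀ p₁ p₂ → Valid κ → p₀ Fin.< p₁ → p₁ Fin.< p₂ → toℕ p₂ < b κ + e κ →
                         colourAt κ (p₀ ∷ p₁ ∷ p₂ ∷ []) ≡ α → ColouredEdge κ α (inj₂ p₀) (inj₂ p₁) (inj₂ p₂)
    positions-coloured {κ} p₀ p₁ p₂ v lt lt′ below eq =
      (<⇒apart lt , <⇒apart lt′ , <⇒apart (ℕ.<-trans lt lt′)) ,
      (_ , trans (when-true (valid? κ) v) (when-true (_ ≤? 3)
        (ℕ.+-mono-≤ (ℕ.+-mono-≤ (light κ p₀ (ℕ.<-trans lt (ℕ.<-trans lt′ below))) (light κ p₁ (ℕ.<-trans lt′ below))) (light κ p₂ below)))) , eq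

    -- The first `t` positions span a clique, and `cases` covers the four sequences of kinds of its
    -- sorted triples. The lower bounds on `b κ` let impossible sequences be discarded.
    full-shape-free : ∀ {κ α} → Valid κ → b κ + e κ ≡ t →
      (∀ ps → Increasing ps →
         (HasKinds κ ps (special ∷ special ∷ special ∷ []) → 3 ≤ b κ → colourAt κ ps ≡ α)
       × (HasKinds κ ps (special ∷ special ∷ ordinary ∷ []) → 2 ≤ b κ → colourAt κ ps ≡ α)
       × (HasKinds κ ps (special ∷ ordinary ∷ ordinary ∷ []) → 1 ≤ b κ → colourAt κ ps ≡ α)
       × (HasKinds κ ps (ordinary ∷ ordinary ∷ ordinary ∷ []) → colourAt κ ps ≡ α)) → ⊥
    full-shape-free {κ} {α} v full cases = clique-free κ (inj₂ ∘ pos) α λ i j l i<j j<l →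
      positions-coloured (pos i) (pos j) (pos l) v (pos-< i<j) (pos-< j<l) (inside l) (coloured i j l i<j j<l)
      where
      inside : ∀ i → toℕ (pos i) < b κ + e κ
      inside i = subst₂ _<_ (sym (toℕ-pos i)) (sym full) (Fin.toℕ<n i)
      sp : ∀ i → toℕ i < b κ → kind κ (pos i) ≡ special
      sp i i<b = kindℕ-special (e κ) (subst (_< b κ) (sym (toℕ-pos i)) i<b)
      or : ∀ i → b κ ≤ toℕ i → kind κ (pos i) ≡ ordinary
      or i b≤i = kindℕ-ordinary (subst (b κ ≤_) (sym (toℕ-pos i)) b≤i) (inside i)
      coloured : ∀ i j l → i Fin.< j → j Fin.< l → colourAt κ (pos i ∷ pos j ∷ pos l ∷ []) ≡ α
      coloured i j l i<j j<l = dispatch (cases (pos i ∷ pos j ∷ pos l ∷ []) (pos-< i<j , pos-< j<l)) (specials-of (b κ) (toℕ i) (toℕ j) (toℕ l))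
        where
        C = colourAt κ (pos i ∷ pos j ∷ pos l ∷ []) ≡ α
        K = HasKinds κ (pos i ∷ pos j ∷ pos l ∷ [])
        dispatch : (K (special ∷ special ∷ special ∷ []) → 3 ≤ b κ → C) × (K (special ∷ special ∷ ordinary ∷ []) → 2 ≤ b κ → C)
                 × (K (special ∷ ordinary ∷ ordinary ∷ []) → 1 ≤ b κ → C) × (K (ordinary ∷ ordinary ∷ ordinary ∷ []) → C) →
                   Specials (b κ) (toℕ i) (toℕ j) (toℕ l) → C
        dispatch (sss , _) (specials₃ l<b) = sss (has-kinds κ (sp i (ℕ.<-trans i<j (ℕ.<-trans j<l l<b))) (sp j (ℕ.<-trans j<l l<b)) (sp l l<b))
                                      (ℕ.≤-trans (s≤s (ℕ.≤-trans (s≤s (ℕ.≤-trans (s≤s z≤n) i<j)) j<l)) l<b)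
        dispatch (_ , sso , _) (specials₂ j<b b≤l) = sso (has-kinds κ (sp i (ℕ.<-trans i<j j<b)) (sp j j<b) (or l b≤l))
                                            (ℕ.≤-trans (s≤s (ℕ.≤-trans (s≤s z≤n) i<j)) j<b)
        dispatch (_ , _ , soo , _) (specials₁ i<b b≤j) =
          soo (has-kinds κ (sp i i<b) (or j b≤j) (or l (ℕ.≤-trans b≤j (ℕ.<⇒≤ j<l)))) (ℕ.≤-trans (s≤s z≤n) i<b)
        dispatch (_ , _ , _ , ooo) (specials₀ b≤i) =
          ooo (has-kinds κ (or i b≤i) (or j (ℕ.≤-trans b≤i (ℕ.<⇒≤ i<j))) (or l (ℕ.≤-trans b≤i (ℕ.<⇒≤ (ℕ.<-trans i<j j<l)))))

    -- Three ordinary positions are too few for a clique, so the shape is valid for every colour.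
    base : Fin k → Shape
    base i = shape nothing zero (suc (suc (suc zero))) i i i i

    base-valid : ∀ i → Valid (base i)
    base-valid i = s≤s (s≤s (s≤s z≤n)) , inj₁ (s≤s (s≤s (s≤s (s≤s z≤n)))) , tt , inj₁ (s≤s (s≤s z≤n)) , inj₁ (s≤s (s≤s (s≤s z≤n)))

    first-three : Vec Position 3
    first-three = zero ∷ suc zero ∷ suc (suc zero) ∷ []

    first-three-increasing : Increasing first-three
    first-three-increasing = s≤s z≤n , s≤s (s≤s z≤n)

    δ : Fin k → Fin k
    δ i = colourAt (base i) first-three

    ordinaries-δ : ∀ {κ i} ps → Increasing ps → Valid κ → HasKinds κ ps (ordinary ∷ ordinary ∷ ordinary ∷ []) →
                   colour-∅ κ 3 ≡ just i → colourAt κ ps ≡ δ i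
    ordinaries-δ {κ} {i} ps inc v ks eq = agree-col′ ps first-three inc first-three-increasing ks refl (record
      { valid = v ; valid′ = base-valid i ; hosts = each refl refl refl
      ; agree-HH = λ x y → each refl refl refl
      ; agree-H = λ x → each-pair refl refl refl refl refl refl
      ; agree-∅ = eq }) (inj₁ zero) (inj₁ (suc zero)) (inj₁ (suc (suc zero)))

    -- The special vertex has no host, so its triples look like triples of ordinary vertices.
    δ-injective : ∀ {i j} → i ≢ j → δ i ≢ δ j
    δ-injective {i} {j} i≢j δi≡δj = full-shape-free {κ} v full λ ps inc →
        (λ _ 3≤b → ⊥-elim (b-small 3≤b)) , (λ _ 2≤b → ⊥-elim (b-small 2≤b)) ,
        (λ ks _ → trans (agree-col′ ps first-three inc first-three-increasing ks refl (record
          { valid = v ; valid′ = base-valid j ; hosts = each refl refl refl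
          ; agree-HH = λ x y → each refl refl refl
          ; agree-H = λ x → each-pair refl refl refl refl refl refl
          ; agree-∅ = refl }) (inj₁ zero) (inj₁ (suc zero)) (inj₁ (suc (suc zero)))) (sym δi≡δj)) ,
        (λ ks → ordinaries-δ ps inc v ks refl)
      where
      κ = shapeℕ nothing 1 (3 + t′) (s≤s z≤n) (ℕ.n≤1+n _) i j i i
      e≡ : e κ ≡ 3 + t′
      e≡ = Fin.toℕ-fromℕ< (s≤s (ℕ.n≤1+n (3 + t′)))
      full : b κ + e κ ≡ t
      full = cong suc e≡
      b-small : ∀ {m} → ¬ suc (suc m) ≤ 1
      b-small (s≤s ())
      v : Valid κ
      v = mkValid κ refl e≡ ℕ.≤-refl (inj₂ (i≢j , s≤s z≤n , s≤s z≤n)) tt (inj₁ (s≤s (s≤s (s≤s z≤n)))) (inj₁ (s≤s (s≤s (s≤s (s≤s z≤n)))))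

    -- δ is a bijection, so a colour is determined once it is known to differ from δ i for all i ≢ j.
    forced : ∀ {x j} → (∀ i → i ≢ j → x ≡ δ i → ⊥) → x ≡ δ j
    forced {x} {j} = forced-value δ δ-injective x j

    same-col : ∀ {κ κ′} us ps ps′ → Increasing ps → Increasing ps′ → HasKinds κ ps us → HasKinds κ′ ps′ us → Valid κ → Valid κ′ →
               host κ ≡ host κ′ → colour₁ κ ≡ colour₁ κ′ → colour₂ κ ≡ colour₂ κ′ → colour-∅ κ (total us) ≡ colour-∅ κ′ (total us) →
               ∀ a b d → col κ (place ps a) (place ps b) (place ps d) ≡ col κ′ (place ps′ a) (place ps′ b) (place ps′ d)
    same-col us ps ps′ inc inc′ ks ks′ v v′ h c₁ c₂ ∅ = agree-col′ ps ps′ inc inc′ ks ks′ (agree-same us v v′ h c₁ c₂ ∅)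

    -- For the value `δ i`, take one special and `t ∸ 1` ordinary positions with `low` = i and
    -- `high` = j. Ordinary triples have φ-colour `δ i`, and triples with the special position have
    -- the type of `ps`: a monochromatic clique.
    one-special-δ : ∀ {κ j} ps → Increasing ps → Valid κ → HasKinds κ ps (special ∷ ordinary ∷ ordinary ∷ []) →
                    colour-∅ κ 2 ≡ just j → colourAt κ ps ≡ δ j
    one-special-δ {κ} {j} ps inc v ks eq = forced λ i i≢j x≡δi →
      let κ′ = shapeℕ (host κ) 1 (3 + t′) (s≤s z≤n) (ℕ.n≤1+n _) i j (colour₁ κ) (colour₂ κ)
          e≡ : e κ′ ≡ 3 + t′
          e≡ = Fin.toℕ-fromℕ< (s≤s (ℕ.n≤1+n (3 + t′)))
          v′ = mkValid κ′ refl e≡ ℕ.≤-refl (inj₂ (i≢j , s≤s z≤n , s≤s z≤n)) (proj₁ (proj₂ (proj₂ v)))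
                 (inj₁ (s≤s (s≤s (s≤s z≤n)))) (inj₁ (s≤s (s≤s (s≤s (s≤s z≤n)))))
      in full-shape-free {κ′} v′ (cong (1 +_) e≡) λ qs inc′ →
        (λ _ 3≤b → ⊥-elim (b-small 3≤b)) , (λ _ 2≤b → ⊥-elim (b-small 2≤b)) ,
        (λ ks′ _ → trans (same-col _ qs ps inc′ inc ks′ ks v′ v refl refl refl (sym eq) (inj₁ zero) (inj₁ (suc zero)) (inj₁ (suc (suc zero)))) x≡δi) ,
        (λ ks′ → ordinaries-δ qs inc′ v′ ks′ refl)
      where
      b-small : ∀ {m} → ¬ suc (suc m) ≤ 1
      b-small (s≤s ())

    increasing-last : ∀ {p₀ p₁ p₂} → Increasing (p₀ ∷ p₁ ∷ p₂ ∷ []) → 1 ≤ toℕ p₁ × 2 ≤ toℕ p₂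
    increasing-last (lt , lt′) = 1≤p₁ , ℕ.≤-trans (s≤s 1≤p₁) lt′
      where 1≤p₁ = ℕ.≤-trans (s≤s z≤n) lt

    -- The same argument with two special positions: triples with fewer of them have colour `low` =
    -- i and are known. Validity is inherited, because two special positions in `κ` give `2 ≤ b κ`,
    -- so `κ′` has no more of them.
    two-specials-δ : ∀ {κ j p₀ p₁ p₂} → Increasing (p₀ ∷ p₁ ∷ p₂ ∷ []) → Valid κ →
                     HasKinds κ (p₀ ∷ p₁ ∷ p₂ ∷ []) (special ∷ special ∷ ordinary ∷ []) →
                     colour-∅ κ 1 ≡ just j → colourAt κ (p₀ ∷ p₁ ∷ p₂ ∷ []) ≡ δ j
    two-specials-δ {κ} {j} {p₀} {p₁} {p₂} inc v ks eq = forced λ i i≢j x≡δi →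
      let κ′ = shapeℕ (host κ) 2 (2 + t′) (s≤s (s≤s z≤n)) (ℕ.m≤n+m _ 2) i j (colour₁ κ) (colour₂ κ)
          e≡ : e κ′ ≡ 2 + t′
          e≡ = Fin.toℕ-fromℕ< (s≤s (ℕ.m≤n+m (2 + t′) 2))
          v′ = mkValid κ′ refl e≡ ℕ.≤-refl (inj₂ (i≢j , s≤s z≤n , s≤s (s≤s z≤n))) (proj₁ (proj₂ (proj₂ v)))
                 (inj₁ (s≤s (s≤s (s≤s (s≤s z≤n))))) (two-roots (proj₂ (proj₂ (proj₂ (proj₂ v)))))
      in full-shape-free {κ′} v′ (cong (2 +_) e≡) λ qs inc′ →
        (λ _ 3≤b → ⊥-elim (b-small 3≤b)) ,
        (λ ks′ _ → trans (same-col _ qs (p₀ ∷ p₁ ∷ p₂ ∷ []) inc′ inc ks′ ks v′ v refl refl refl (sym eq)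
                            (inj₁ zero) (inj₁ (suc zero)) (inj₁ (suc (suc zero)))) x≡δi) ,
        (λ ks′ _ → one-special-δ qs inc′ v′ ks′ refl) ,
        (λ ks′ → ordinaries-δ qs inc′ v′ ks′ refl)
      where
      2≤b : 2 ≤ b κ
      2≤b = ℕ.≤-trans (s≤s (proj₁ (increasing-last inc))) (special-below {κ} (Vec.∷-injectiveˡ (Vec.∷-injectiveʳ ks)))
      b-small : ¬ 3 ≤ 2
      b-small (s≤s (s≤s ()))
      two-roots : ∀ {q : Fin k} → suc (suc (b κ)) < t ⊎ colour₁ κ ≢ colour₂ κ ⊎ (5 ≤ t × top κ ≢ colour₁ κ) →
                  4 < t ⊎ colour₁ κ ≢ colour₂ κ ⊎ (5 ≤ t × q ≢ colour₁ κ)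
      two-roots (inj₁ lt)               = inj₁ (ℕ.≤-trans (s≤s (s≤s (s≤s 2≤b))) lt)
      two-roots (inj₂ (inj₁ ne))        = inj₂ (inj₁ ne)
      two-roots (inj₂ (inj₂ (5≤t , _))) = inj₁ 5≤t

    -- Again the same, with three special positions. Choosing `high` = `top κ` keeps the type and
    -- the value of `top`, so the conditions on one and two roots carry over from `κ`.
    specials-δ : ∀ {κ p₀ p₁ p₂} → Increasing (p₀ ∷ p₁ ∷ p₂ ∷ []) → Valid κ →
                 HasKinds κ (p₀ ∷ p₁ ∷ p₂ ∷ []) (special ∷ special ∷ special ∷ []) → colourAt κ (p₀ ∷ p₁ ∷ p₂ ∷ []) ≡ δ (top κ)
    specials-δ {κ} {p₀} {p₁} {p₂} inc v ks = forced λ i i≢j x≡δi →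
      let κ′ = shapeℕ (host κ) 3 (1 + t′) (s≤s (s≤s (s≤s z≤n))) (ℕ.m≤n+m _ 3) i (top κ) (colour₁ κ) (colour₂ κ)
          e≡ : e κ′ ≡ 1 + t′
          e≡ = Fin.toℕ-fromℕ< (s≤s (ℕ.m≤n+m (1 + t′) 3))
          v′ = mkValid κ′ refl e≡ ℕ.≤-refl (inj₂ (i≢j , s≤s z≤n , ℕ.≤-refl)) (proj₁ (proj₂ (proj₂ v)))
                 (Sum.map₁ (ℕ.≤-trans (s≤s (s≤s 3≤b))) (proj₁ (proj₂ (proj₂ (proj₂ v)))))
                 (Sum.map₁ (ℕ.≤-trans (s≤s (s≤s (s≤s 3≤b)))) (proj₂ (proj₂ (proj₂ (proj₂ v)))))
      in full-shape-free {κ′} v′ (cong (3 +_) e≡) λ where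
        qs@(_ ∷ _ ∷ _ ∷ []) inc′ →
          (λ ks′ _ → trans (same-col _ qs (p₀ ∷ p₁ ∷ p₂ ∷ []) inc′ inc ks′ ks v′ v refl refl refl refl
                              (inj₁ zero) (inj₁ (suc zero)) (inj₁ (suc (suc zero)))) x≡δi) ,
          (λ ks′ _ → two-specials-δ inc′ v′ ks′ refl) ,
          (λ ks′ _ → one-special-δ qs inc′ v′ ks′ refl) ,
          (λ ks′ → ordinaries-δ qs inc′ v′ ks′ refl)
      where
      3≤b : 3 ≤ b κ
      3≤b = ℕ.≤-trans (s≤s (proj₂ (increasing-last inc))) (special-below {κ} (Vec.∷-injectiveˡ (Vec.∷-injectiveʳ (Vec.∷-injectiveʳ ks))))

    -- Shapes without ordinary vertices, for cliques consisting of 1, 2 or 3 roots and special vertices.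
    rooted : Host → ∀ x → x < t → Fin k → Fin k → Fin k → Shape
    rooted h x x<t i p q = shapeℕ h x 0 (ℕ.<⇒≤ x<t) z≤n i i p q

    rooted-b : ∀ h x (x<t : x < t) i p q → b (rooted h x x<t i p q) ≡ x
    rooted-b h x x<t i p q = Fin.toℕ-fromℕ< _

    rooted-top : ∀ h x (x<t : x < t) i p q → top (rooted h x x<t i p q) ≡ i
    rooted-top h x x<t i p q = top-constant (rooted h x x<t i p q) refl

    rooted-valid : ∀ h x (x<t : x < t) i p q → ValidHost h q → (suc x < t ⊎ i ≢ p) →
                   (suc (suc x) < t ⊎ p ≢ q ⊎ (5 ≤ t × i ≢ p)) → Valid (rooted h x x<t i p q)
    rooted-valid h x x<t i p q vh v₄ v₅ = mkValid κ (rooted-b h x x<t i p q) refl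
        (subst (_≤ t) (sym (ℕ.+-identityʳ x)) (ℕ.<⇒≤ x<t)) (inj₁ (subst (_< t) (sym (ℕ.+-identityʳ x)) x<t)) vh
        (Sum.map₂ (λ ne → ne ∘ trans (sym top≡)) v₄) (Sum.map₂ (Sum.map₂ (Prod.map₂ λ ne → ne ∘ trans (sym top≡))) v₅)
      where
      κ = rooted h x x<t i p q
      top≡ : top κ ≡ i
      top≡ = rooted-top h x x<t i p q

    low-pos : ∀ {x} → x ≤ t → Fin x → Position
    low-pos x≤t i = pos (Fin.inject≤ i x≤t)

    toℕ-low-pos : ∀ {x} (x≤t : x ≤ t) i → toℕ (low-pos x≤t i) ≡ toℕ i
    toℕ-low-pos x≤t i = trans (toℕ-pos _) (Fin.toℕ-inject≤ i x≤t)

    low-pos-< : ∀ {x} (x≤t : x ≤ t) {i j} → i Fin.< j → low-pos x≤t i Fin.< low-pos x≤t j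
    low-pos-< x≤t {i} {j} = subst₂ _<_ (sym (toℕ-low-pos x≤t i)) (sym (toℕ-low-pos x≤t j))

    low-pos-special : ∀ {κ x} (x≤t : x ≤ t) → b κ ≡ x → ∀ i → kind κ (low-pos x≤t i) ≡ special
    low-pos-special {κ} x≤t refl i = kindℕ-special (e κ) (subst (_< b κ) (sym (toℕ-low-pos x≤t i)) (Fin.toℕ<n i))

    special-edge : ∀ {κ α p₀ p₁ p₂} → Valid κ → p₀ Fin.< p₁ → p₁ Fin.< p₂ → kind κ p₀ ≡ special → kind κ p₁ ≡ special → kind κ p₂ ≡ special →
                   δ (top κ) ≡ α → ColouredEdge κ α (inj₂ p₀) (inj₂ p₁) (inj₂ p₂)
    special-edge {κ} {α} {p₀} {p₁} {p₂} v lt lt′ k₀ k₁ k₂ eq = positions-coloured p₀ p₁ p₂ v lt lt′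
      (ℕ.<-≤-trans (special-below {κ} k₂) (ℕ.m≤m+n (b κ) (e κ))) (trans (specials-δ (lt , lt′) v (has-kinds κ k₀ k₁ k₂)) eq)

    root-specials-edge : ∀ {κ α x p₀ p₁} → Valid κ → Sees (host κ) x → p₀ Fin.< p₁ → kind κ p₀ ≡ special → kind κ p₁ ≡ special →
                         col κ (inj₁ x) (inj₂ p₀) (inj₂ p₁) ≡ α → ColouredEdge κ α (inj₁ x) (inj₂ p₀) (inj₂ p₁)
    root-specials-edge {κ} {x = x} v sx lt k₀ k₁ eq = (root-apart , <⇒apart lt , root-apart) , (colour₁ κ , colour-H-special v sx k₀ k₁) , eq

    roots-special-edge : ∀ {κ α x y p} → Valid κ → Sees (host κ) x → Sees (host κ) y → x ≢ y → kind κ p ≡ special →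
                         col κ (inj₁ x) (inj₁ y) (inj₂ p) ≡ α → ColouredEdge κ α (inj₁ x) (inj₁ y) (inj₂ p)
    roots-special-edge {κ} {x = x} {y} v sx sy x≢y k₀ eq = (root-distinct x≢y , root-apart , root-apart) , (colour₂ κ , colour-HH-special v sx sy k₀) , eq

    -- A root and `t ∸ 1` special positions form a clique. With all triples of special positions of
    -- colour i, only the edges at the root are undetermined; the shape is valid because i differs
    -- from `colour₁ κ`.
    root-specials-δ : ∀ {κ x p₀ p₁} → p₀ Fin.< p₁ → Valid κ → kind κ p₀ ≡ special → kind κ p₁ ≡ special → Sees (host κ) x →
                      col κ (inj₁ x) (inj₂ p₀) (inj₂ p₁) ≡ δ (colour₁ κ)
    root-specials-δ {κ} {x} {p₀} {p₁} lt v k₀ k₁ sx = forced avoids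
      where
      2≤b : 2 ≤ b κ
      2≤b = ℕ.≤-trans (s≤s (ℕ.≤-trans (s≤s z≤n) lt)) (special-below {κ} k₁)
      avoids : ∀ i → i ≢ colour₁ κ → col κ (inj₁ x) (inj₂ p₀) (inj₂ p₁) ≡ δ i → ⊥
      avoids i i≢ x≡δi = clique-free κ′ g (δ i) edges
        where
        κ′ = rooted (host κ) (3 + t′) ℕ.≤-refl i (colour₁ κ) (colour₂ κ)
        two-roots : suc (suc (b κ)) < t ⊎ colour₁ κ ≢ colour₂ κ ⊎ (5 ≤ t × top κ ≢ colour₁ κ) →
                    suc (suc (3 + t′)) < t ⊎ colour₁ κ ≢ colour₂ κ ⊎ (5 ≤ t × i ≢ colour₁ κ)
        -- As `2 ≤ b κ`, this case gives `5 ≤ t`, so the difference between i and `colour₁`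
        -- suffices. For t = 4, the difference of `colour₁` and `colour₂` is inherited from `κ`.
        two-roots (inj₁ 2+b<t)            = inj₂ (inj₂ (ℕ.≤-trans (s≤s (s≤s (s≤s 2≤b))) 2+b<t , i≢))
        two-roots (inj₂ (inj₁ ne))        = inj₂ (inj₁ ne)
        two-roots (inj₂ (inj₂ (5≤t , _))) = inj₂ (inj₂ (5≤t , i≢))
        v′ : Valid κ′
        v′ = rooted-valid (host κ) (3 + t′) ℕ.≤-refl i (colour₁ κ) (colour₂ κ) (proj₁ (proj₂ (proj₂ v))) (inj₂ i≢)
               (two-roots (proj₂ (proj₂ (proj₂ (proj₂ v)))))
        b≡ = rooted-b (host κ) (3 + t′) ℕ.≤-refl i (colour₁ κ) (colour₂ κ)
        q = low-pos (ℕ.n≤1+n (3 + t′))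
        ks = low-pos-special {κ′} (ℕ.n≤1+n (3 + t′)) b≡
        q-< = low-pos-< (ℕ.n≤1+n (3 + t′))
        g : Fin t → Fin n ⊎ Position
        g zero    = inj₁ x
        g (suc i) = inj₂ (q i)
        edges : ∀ a b d → a Fin.< b → b Fin.< d → ColouredEdge κ′ (δ i) (g a) (g b) (g d)
        edges zero (suc b) (suc d) _ (s≤s b<d) = root-specials-edge v′ sx (q-< b<d) (ks b) (ks d)
          (trans (same-col (special ∷ special ∷ dummy ∷ []) (q b ∷ q d ∷ dummy₁ ∷ []) (p₀ ∷ p₁ ∷ dummy₁ ∷ [])
                   (q-< b<d , special<dummy₁ v′ (ks d)) (lt , special<dummy₁ v k₁)
                   (has-kinds κ′ (ks b) (ks d) (kind-dummy₁ v′)) (has-kinds κ k₀ k₁ (kind-dummy₁ v)) v′ v refl refl refl refl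
                   (inj₂ x) (inj₁ zero) (inj₁ (suc zero))) x≡δi)
        edges (suc a) (suc b) (suc d) (s≤s a<b) (s≤s b<d) =
          special-edge v′ (q-< a<b) (q-< b<d) (ks a) (ks b) (ks d) (cong δ (rooted-top (host κ) (3 + t′) ℕ.≤-refl i (colour₁ κ) (colour₂ κ)))

    -- Two roots and `t ∸ 2` special positions: with `colour₁` also equal to i, only the edges
    -- through both roots remain, and i differing from `colour₂ κ` gives validity.
    roots-special-δ : ∀ {κ x y p} → Valid κ → kind κ p ≡ special → Sees (host κ) x → Sees (host κ) y → x ≢ y →
                      col κ (inj₁ x) (inj₁ y) (inj₂ p) ≡ δ (colour₂ κ)
    roots-special-δ {κ} {x} {y} {p} v k₀ sx sy x≢y = forced avoids
      where
      avoids : ∀ i → i ≢ colour₂ κ → col κ (inj₁ x) (inj₁ y) (inj₂ p) ≡ δ i → ⊥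
      avoids i i≢ x≡δi = clique-free κ′ g (δ i) edges
        where
        x< : 2 + t′ < t
        x< = ℕ.n≤1+n (3 + t′)
        x≤ : 2 + t′ ≤ t
        x≤ = ℕ.<⇒≤ x<
        κ′ = rooted (host κ) (2 + t′) x< i i (colour₂ κ)
        v′ : Valid κ′
        v′ = rooted-valid (host κ) (2 + t′) x< i i (colour₂ κ) (proj₁ (proj₂ (proj₂ v))) (inj₁ ℕ.≤-refl) (inj₂ (inj₁ i≢))
        q = low-pos x≤
        ks = low-pos-special {κ′} x≤ (rooted-b (host κ) (2 + t′) x< i i (colour₂ κ))
        q-< = low-pos-< x≤
        g : Fin t → Fin n ⊎ Position
        g zero          = inj₁ x
        g (suc zero)    = inj₁ y
        g (suc (suc i)) = inj₂ (q i)
        -- Beside two dummies a single special position does not reveal `colour₁` or `top`, so both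
        -- may be changed to i.
        agree : Agree κ′ κ (special ∷ dummy ∷ dummy ∷ []) (special ∷ dummy ∷ dummy ∷ [])
        agree = record
          { valid = v′ ; valid′ = v ; hosts = each refl refl refl ; agree-HH = λ x y → each refl refl refl
          ; agree-H = λ x → each-pair refl refl refl refl refl refl
          ; agree-∅ = refl }
        edges : ∀ a b d → a Fin.< b → b Fin.< d → ColouredEdge κ′ (δ i) (g a) (g b) (g d)
        edges zero (suc zero) (suc (suc d)) _ _ = roots-special-edge v′ sx sy x≢y (ks d)
          (trans (agree-col′ (q d ∷ dummy₁ ∷ dummy₂ ∷ []) (p ∷ dummy₁ ∷ dummy₂ ∷ [])
                   (special<dummy₁ v′ (ks d) , dummy₁<dummy₂) (special<dummy₁ v k₀ , dummy₁<dummy₂)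
                   (has-kinds κ′ (ks d) (kind-dummy₁ v′) (kind-dummy₂ v′)) (has-kinds κ k₀ (kind-dummy₁ v) (kind-dummy₂ v)) agree
                   (inj₂ x) (inj₂ y) (inj₁ zero)) x≡δi)
        edges zero (suc (suc b)) (suc (suc d)) _ (s≤s (s≤s b<d)) =
          root-specials-edge v′ sx (q-< b<d) (ks b) (ks d) (root-specials-δ (q-< b<d) v′ (ks b) (ks d) sx)
        edges (suc zero) (suc (suc b)) (suc (suc d)) _ (s≤s (s≤s b<d)) =
          root-specials-edge v′ sy (q-< b<d) (ks b) (ks d) (root-specials-δ (q-< b<d) v′ (ks b) (ks d) sy)
        edges (suc (suc a)) (suc (suc b)) (suc (suc d)) (s≤s (s≤s a<b)) (s≤s (s≤s b<d)) =
          special-edge v′ (q-< a<b) (q-< b<d) (ks a) (ks b) (ks d) (cong δ (rooted-top (host κ) (2 + t′) x< i i (colour₂ κ)))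
        edges zero (suc zero) (suc zero) _ (s≤s ())
        edges zero (suc (suc b)) (suc zero) _ (s≤s ())
        edges (suc zero) (suc zero) d (s≤s ()) _
        edges (suc zero) (suc (suc b)) (suc zero) _ (s≤s ())
        edges (suc (suc a)) (suc zero) d (s≤s ()) _
        edges (suc (suc a)) (suc (suc b)) (suc zero) _ (s≤s ())

    -- The clique consists of x, y, z and `t ∸ 3` special positions hosted by this edge, with every
    -- other triple of colour i. `ValidHost` allows `colour₂` = i exactly because i differs from
    -- `c x y z`.
    roots-δ : ∀ {x y z} → E H x y z ≡ true → φ (inj₁ x) (inj₁ y) (inj₁ z) ≡ δ (c x y z)
    roots-δ {x} {y} {z} xyz = forced avoids
      where
      distinct = edge-distinct xyz
      x≢y = proj₁ distinct
      y≢z = proj₁ (proj₂ distinct)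
      x≢z = proj₂ (proj₂ distinct)
      avoids : ∀ i → i ≢ c x y z → φ (inj₁ x) (inj₁ y) (inj₁ z) ≡ δ i → ⊥
      avoids i i≢ x≡δi = clique-free κ′ g (δ i) edges
        where
        h : Host
        h = just (x , y , z)
        x< : 1 + t′ < t
        x< = ℕ.m≤n+m (2 + t′) 2
        x≤ : 1 + t′ ≤ t
        x≤ = ℕ.<⇒≤ x<
        κ′ = rooted h (1 + t′) x< i i i
        v′ : Valid κ′
        v′ = rooted-valid h (1 + t′) x< i i i (xyz , i≢) (inj₁ (ℕ.n≤1+n (3 + t′))) (inj₁ ℕ.≤-refl)
        q = low-pos x≤
        ks = low-pos-special {κ′} x≤ (rooted-b h (1 + t′) x< i i i)
        q-< = low-pos-< x≤
        sx : Sees h x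
        sx = inj₁ refl
        sy : Sees h y
        sy = inj₂ (inj₁ refl)
        sz : Sees h z
        sz = inj₂ (inj₂ refl)
        g : Fin t → Fin n ⊎ Position
        g zero                = inj₁ x
        g (suc zero)          = inj₁ y
        g (suc (suc zero))    = inj₁ z
        g (suc (suc (suc i))) = inj₂ (q i)
        pair : ∀ {x y} → Sees h x → Sees h y → x ≢ y → ∀ d → ColouredEdge κ′ (δ i) (inj₁ x) (inj₁ y) (inj₂ (q d))
        pair sx sy x≢y d = roots-special-edge v′ sx sy x≢y (ks d) (roots-special-δ v′ (ks d) sx sy x≢y)
        single : ∀ {x} → Sees h x → ∀ {b d} → b Fin.< d → ColouredEdge κ′ (δ i) (inj₁ x) (inj₂ (q b)) (inj₂ (q d))
        single sx {b} {d} b<d = root-specials-edge v′ sx (q-< b<d) (ks b) (ks d) (root-specials-δ (q-< b<d) v′ (ks b) (ks d) sx)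
        edges : ∀ a b d → a Fin.< b → b Fin.< d → ColouredEdge κ′ (δ i) (g a) (g b) (g d)
        edges zero (suc zero) (suc (suc zero)) _ _ =
          (root-distinct x≢y , root-distinct y≢z , root-distinct x≢z) ,
          (c x y z , when-true (E H x y z Bool.≟ true) xyz) , x≡δi
        edges zero (suc zero) (suc (suc (suc d))) _ _ = pair sx sy x≢y d
        edges zero (suc (suc zero)) (suc (suc (suc d))) _ _ = pair sx sz x≢z d
        edges (suc zero) (suc (suc zero)) (suc (suc (suc d))) _ _ = pair sy sz y≢z d
        edges zero (suc (suc (suc b))) (suc (suc (suc d))) _ (s≤s (s≤s (s≤s b<d))) = single sx b<d
        edges (suc zero) (suc (suc (suc b))) (suc (suc (suc d))) _ (s≤s (s≤s (s≤s b<d))) = single sy b<d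
        edges (suc (suc zero)) (suc (suc (suc b))) (suc (suc (suc d))) _ (s≤s (s≤s (s≤s b<d))) = single sz b<d
        edges (suc (suc (suc a))) (suc (suc (suc b))) (suc (suc (suc d))) (s≤s (s≤s (s≤s a<b))) (s≤s (s≤s (s≤s b<d))) =
          special-edge v′ (q-< a<b) (q-< b<d) (ks a) (ks b) (ks d) (cong δ (rooted-top h (1 + t′) x< i i i))
        edges zero (suc zero) (suc zero) _ (s≤s ())
        edges zero (suc (suc b)) (suc zero) _ (s≤s ())
        edges zero (suc (suc zero)) (suc (suc zero)) _ (s≤s (s≤s ()))
        edges zero (suc (suc (suc b))) (suc (suc zero)) _ (s≤s (s≤s ()))
        edges (suc zero) (suc zero) d (s≤s ()) _
        edges (suc zero) (suc (suc b)) (suc zero) _ (s≤s ())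
        edges (suc zero) (suc (suc zero)) (suc (suc zero)) _ (s≤s (s≤s ()))
        edges (suc zero) (suc (suc (suc b))) (suc (suc zero)) _ (s≤s (s≤s ()))
        edges (suc (suc a)) (suc zero) d (s≤s ()) _
        edges (suc (suc a)) (suc (suc zero)) d (s≤s (s≤s ())) _
        edges (suc (suc a)) (suc (suc (suc b))) (suc zero) _ (s≤s ())
        edges (suc (suc a)) (suc (suc (suc b))) (suc (suc zero)) _ (s≤s (s≤s ()))

-- Vanishing codegrees and permutations of the colours

¬true⇒false : ∀ {b} → b ≢ true → b ≡ false
¬true⇒false {true}  ne = ⊥-elim (ne refl)
¬true⇒false {false} _  = refl

sum-zero : ∀ {A : Set} (f : A → Bool) xs → (∀ x → f x ≡ false) → sum (List.map (λ x → if f x then 1 else 0) xs) ≡ 0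
sum-zero f []       _  = refl
sum-zero f (x ∷ xs) eq rewrite eq x = sum-zero f xs eq

zero-sum : ∀ {A : Set} (f : A → Bool) xs → sum (List.map (λ x → if f x then 1 else 0) xs) ≡ 0 → ∀ {x} → x ∈ xs → f x ≡ false
zero-sum f (x ∷ xs) eq (here refl) with f x | eq
... | false | _ = refl
zero-sum f (x ∷ xs) eq (there p) with f x | eq
... | false | eq′ = zero-sum f xs eq′ p

codeg-zero : ∀ {n} (H : Hyp3 n) u v → (∀ w → E H u v w ≡ false) → codeg H u v ≡ 0
codeg-zero {n} H u v = sum-zero (E H u v) (allFin n)

zero-codeg : ∀ {n} (H : Hyp3 n) u v → codeg H u v ≡ 0 → ∀ w → E H u v w ≡ false
zero-codeg {n} H u v eq w = zero-sum (E H u v) (allFin n) eq (∈-allFin w)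

from-just : ∀ {k} {P : Fin k → Set} → Dec (∃ P) → Fin k → Fin k
from-just (yes (m , _)) _ = m
from-just (no _)        d = d

from-just-unique : ∀ {k} {P : Fin k → Set} (d : Dec (∃ P)) z {m} → P m → (∀ {m m′} → P m → P m′ → m ≡ m′) → from-just d z ≡ m
from-just-unique (yes (_ , p)) z q unique = unique p q
from-just-unique (no none)     z q unique = ⊥-elim (none (_ , q))

injection⇒permutation : ∀ {k} (δ : Fin k → Fin k) → (∀ {i j} → i ≢ j → δ i ≢ δ j) → Σ (Permutation′ k) λ π → ∀ i → π ⟨$⟩ʳ i ≡ δ i
injection⇒permutation δ δ-inj = permutation δ (proj₁ ∘ onto) (proj₂ ∘ onto) inverse , λ _ → refl
  where
  onto = injective⇒surjective δ δ-inj
  inverse : ∀ i → proj₁ (onto (δ i)) ≡ i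
  inverse i with proj₁ (onto (δ i)) Fin.≟ i
  ... | yes eq = eq
  ... | no ne  = ⊥-elim (δ-inj ne (proj₂ (onto (δ i))))

-- The final hypergraph and its properties

module Gadget (k t′ n : ℕ) (2≤k : 2 ≤ k) (H : Hyp3 n) (c : Fin n → Fin n → Fin n → Fin k)
              (good : GoodColoring H k (4 + t′) c) where

  open Forcing k t′ n 2≤k H c good
  open System using (W; V; R; label; labelV; vertex; finite-W; R-sym₁₂; R-sym₂₃; R-functional; R-adm; R-free)
  open Embedding using (emb; hat; emb-R; hat-vertex)

  opaque
    partite-gadget : Σ System λ Q → (Φ : Vec (W Q) 3 → Pattern) → Σ (Embedding P₀ Q) λ e →
      ∀ r → DistinctLabels P₀ finite-Pattern r → ∀ x → Alike P₀ P₀ x r → Φ (Vec.map (emb e) x) ≡ Φ (Vec.map (emb e) r)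
    partite-gadget = partite P₀ finite-Pattern

  Q : System
  Q = proj₁ partite-gadget

  ws : List (W Q)
  ws = elems (finite-W Q)

  m : ℕ
  m = n + length ws

  root : Fin n → Fin m
  root r = r Fin.↑ˡ length ws

  -- The enumeration may repeat a vertex, which then has twins in `𝓗`. Twins carry the same label
  -- and share no edge; `fromV` selects one of them.
  toV : Fin m → V Q
  toV i = Sum.map₂ (List.lookup ws) (Fin.splitAt n i)

  fromV : V Q → Fin m
  fromV (inj₁ r) = root r
  fromV (inj₂ w) = n Fin.↑ʳ index (complete (finite-W Q) w)

  toV-root : ∀ r → toV (root r) ≡ inj₁ r
  toV-root r = cong (Sum.map₂ (List.lookup ws)) (Fin.splitAt-↑ˡ n r (length ws))

  toV-fromV : ∀ v → toV (fromV v) ≡ v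
  toV-fromV (inj₁ r) = toV-root r
  toV-fromV (inj₂ w) = trans (cong (Sum.map₂ (List.lookup ws)) (Fin.splitAt-↑ʳ n (length ws) _))
                             (cong inj₂ (sym (Any.lookup-index (complete (finite-W Q) w))))

  toV-new : ∀ x → (∀ r → root r ≢ x) → Σ (W Q) λ w → toV x ≡ inj₂ w
  toV-new x new = from (Fin.splitAt n x) refl
    where
    from : ∀ s → Fin.splitAt n x ≡ s → Σ (W Q) λ w → Sum.map₂ (List.lookup ws) s ≡ inj₂ w
    from (inj₁ r) eq = ⊥-elim (new r (Fin.splitAt⁻¹-↑ˡ eq))
    from (inj₂ i) eq = List.lookup ws i , refl

  opaque
    edge : V Q → V Q → V Q → Bool
    edge u v w = does (any? (finite-Fin k) λ m → R Q u v w m Bool.≟ true)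

    edge⇒ : ∀ {u v w} → edge u v w ≡ true → ∃ λ m → R Q u v w m ≡ true
    edge⇒ {u} {v} {w} = does⇒ (any? (finite-Fin k) λ m → R Q u v w m Bool.≟ true)

    ⇒edge : ∀ {u v w m} → R Q u v w m ≡ true → edge u v w ≡ true
    ⇒edge {u} {v} {w} r = ⇒does (any? (finite-Fin k) λ m → R Q u v w m Bool.≟ true) (_ , r)

    colourOf : V Q → V Q → V Q → Fin k
    colourOf u v w = from-just (any? (finite-Fin k) λ m → R Q u v w m Bool.≟ true) some-colour

    colourOf-R : ∀ {u v w m} → R Q u v w m ≡ true → colourOf u v w ≡ m
    colourOf-R {u} {v} {w} r =
      from-just-unique (any? (finite-Fin k) λ m → R Q u v w m Bool.≟ true) some-colour r (λ p q → R-functional Q {u} {v} {w} p q)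

  R-swap₁₂ : ∀ {u v w m} → R Q u v w m ≡ true → R Q v u w m ≡ true
  R-swap₁₂ r = trans (sym (R-sym₁₂ Q _ _ _ _)) r

  R-swap₂₃ : ∀ {u v w m} → R Q u v w m ≡ true → R Q u w v m ≡ true
  R-swap₂₃ r = trans (sym (R-sym₂₃ Q _ _ _ _)) r

  edge-swap₁₂ : ∀ {u v w} → edge u v w ≡ true → edge v u w ≡ true
  edge-swap₁₂ {u} {v} {w} e = ⇒edge {v} {u} {w} (R-swap₁₂ {u} {v} {w} (proj₂ (edge⇒ {u} {v} {w} e)))

  edge-swap₂₃ : ∀ {u v w} → edge u v w ≡ true → edge u w v ≡ true
  edge-swap₂₃ {u} {v} {w} e = ⇒edge {u} {w} {v} (R-swap₂₃ {u} {v} {w} (proj₂ (edge⇒ {u} {v} {w} e)))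

  edge-adm : ∀ {u v w} → edge u v w ≡ true → Adm (labelV Q u) (labelV Q v)
  edge-adm {u} {v} {w} e = R-adm Q {u} {v} {w} (proj₂ (edge⇒ {u} {v} {w} e))

  𝓗 : Hyp3 m
  𝓗 = record
    { E = λ a b d → edge (toV a) (toV b) (toV d)
    ; sym₁₂ = λ a b d → true⇔⇒≡ (edge-swap₁₂ {toV a} {toV b} {toV d}) (edge-swap₁₂ {toV b} {toV a} {toV d})
    ; sym₂₃ = λ a b d → true⇔⇒≡ (edge-swap₂₃ {toV a} {toV b} {toV d}) (edge-swap₂₃ {toV a} {toV d} {toV b})
    ; irrefl = λ a b → ¬true⇒false λ e → proj₁ (edge-adm {toV a} {toV a} {toV b} e) refl }

  ψ : Fin m → Fin m → Fin m → Fin k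
  ψ a b d = colourOf (toV a) (toV b) (toV d)

  ψ-good : GoodColoring 𝓗 k t ψ
  ψ-good = symmetric , no-clique
    where
    symmetric : IsColoring 𝓗 k ψ
    symmetric a b d e = let (m , r) = edge⇒ {toV a} {toV b} {toV d} (T⇒true e) in
      trans (colourOf-R {toV a} {toV b} {toV d} r) (sym (colourOf-R {toV b} {toV a} {toV d} (R-swap₁₂ {toV a} {toV b} {toV d} r))) ,
      trans (colourOf-R {toV a} {toV b} {toV d} r) (sym (colourOf-R {toV a} {toV d} {toV b} (R-swap₂₃ {toV a} {toV b} {toV d} r)))
    no-clique : MonoClique 𝓗 ψ t → ⊥
    no-clique (g , _ , α , mono) = R-free Q (toV ∘ g) α λ i j l (i≢j , j≢l , i≢l) →
      let (e , eq) = mono i j l i≢j j≢l i≢l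
          (m , r) = edge⇒ {toV (g i)} {toV (g j)} {toV (g l)} (T⇒true e)
      in subst (λ m → R Q (toV (g i)) (toV (g j)) (toV (g l)) m ≡ true)
           (trans (sym (colourOf-R {toV (g i)} {toV (g j)} {toV (g l)} r)) eq) r

  root-injective : Injective _≡_ _≡_ root
  root-injective = Fin.↑ˡ-injective (length ws) _ _

  roots-R₀ : ∀ {x y z} → E H x y z ≡ true → R₀ (inj₁ x) (inj₁ y) (inj₁ z) (c x y z) ≡ true
  -- Any shape and sequence will do, as every copy contains `H`.
  roots-R₀ {x} {y} {z} xyz = colour-R₀ {shape nothing zero zero some-colour some-colour some-colour some-colour} {Vec.replicate _ zero}
      {inj₁ x} {inj₁ y} {inj₁ z} (apart (proj₁ d) , apart (proj₁ (proj₂ d)) , apart (proj₂ (proj₂ d)))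
      (when-true (E H x y z Bool.≟ true) xyz)
    where
    d = edge-distinct xyz
    apart : ∀ {x y : Fin n} → x ≢ y → _≢_ {A = Fin n ⊎ Label} (inj₁ x) (inj₁ y)
    apart ne eq = ne (Sum.inj₁-injective eq)

  R₀-roots : ∀ {x y z m} → R₀ (inj₁ x) (inj₁ y) (inj₁ z) m ≡ true → E H x y z ≡ true
  R₀-roots {x} {y} {z} r = proj₁ (when-inv (E H x y z Bool.≟ true)
    (proj₂ (R₀-colour {shape nothing zero zero some-colour some-colour some-colour some-colour} {Vec.replicate _ zero} {inj₁ x} {inj₁ y} {inj₁ z} r)))

  induced : ∀ x y z → E H x y z ≡ E 𝓗 (root x) (root y) (root z)
  induced x y z = trans (true⇔⇒≡ forth back) (sym (cong₃ edge (toV-root x) (toV-root y) (toV-root z)))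
    where
    -- A constant `Φ` suffices: only some copy of `P₀` over the roots is wanted.
    e : Embedding P₀ Q
    e = proj₁ (proj₂ partite-gadget λ _ → Vec.replicate _ some-colour)
    forth : E H x y z ≡ true → edge (inj₁ x) (inj₁ y) (inj₁ z) ≡ true
    forth xyz = ⇒edge {inj₁ x} {inj₁ y} {inj₁ z} (trans (emb-R e (inj₁ x) (inj₁ y) (inj₁ z) (c x y z)) (roots-R₀ xyz))
    back : edge (inj₁ x) (inj₁ y) (inj₁ z) ≡ true → E H x y z ≡ true
    back xyz = let (m , r) = edge⇒ {inj₁ x} {inj₁ y} {inj₁ z} xyz
               in R₀-roots {x} {y} {z} (trans (sym (emb-R e (inj₁ x) (inj₁ y) (inj₁ z) m)) r)

  -- An edge of `𝓗` through two roots makes their labels admissible, and for roots this supplies an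
  -- edge of `H`.
  codeg-old : ∀ x y → codeg H x y ≡ 0 → codeg 𝓗 (root x) (root y) ≡ 0
  codeg-old x y zero-H = codeg-zero 𝓗 (root x) (root y) λ w → ¬true⇒false λ e →
    let (z , xyz) = covered w e in absurd (trans (sym xyz) (zero-codeg H x y zero-H z))
    where
    absurd : true ≢ false
    absurd ()
    covered : ∀ w → edge (toV (root x)) (toV (root y)) (toV w) ≡ true → ∃ λ z → E H x y z ≡ true
    covered w e = proj₂ (edge-adm {inj₁ x} {inj₁ y} {toV w}
      (trans (sym (cong₂ (λ u v → edge u v (toV w)) (toV-root x) (toV-root y))) e))

  unseen : 4 ≤ n → ∀ h → Σ (Fin n) λ y → ¬ Sees h y
  unseen 4≤n nothing = proj₁ (avoid [] (ℕ.≤-trans (s≤s z≤n) 4≤n)) , λ ()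
  unseen 4≤n (just (x , y , z)) = let (r , r∉) = avoid (x ∷ y ∷ z ∷ []) 4≤n in r , λ where
    (inj₁ eq)        → r∉ (here eq)
    (inj₂ (inj₁ eq)) → r∉ (there (here eq))
    (inj₂ (inj₂ eq)) → r∉ (there (there (here eq)))

  -- The host in the label of x contains at most three roots, so among four roots one is unseen.
  codeg-new : 4 ≤ n → ∀ x → (∀ r → root r ≢ x) → Σ (Fin n) λ y → codeg 𝓗 x (root y) ≡ 0
  codeg-new 4≤n x new = proj₁ missed , codeg-zero 𝓗 x (root (proj₁ missed)) λ w → ¬true⇒false λ e → proj₂ missed (seen w e)
    where
    w₀ = toV-new x new
    missed = unseen 4≤n (proj₂ (label Q (proj₁ w₀)))
    seen : ∀ w → edge (toV x) (toV (root (proj₁ missed))) (toV w) ≡ true → Sees (proj₂ (label Q (proj₁ w₀))) (proj₁ missed)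
    seen w e = proj₂ (edge-adm {inj₂ (proj₁ w₀)} {inj₁ (proj₁ missed)} {toV w}
      (trans (sym (cong₂ (λ u v → edge u v (toV w)) (proj₂ w₀) (toV-root (proj₁ missed)))) e))

  module Restriction (φ : Fin m → Fin m → Fin m → Fin k) (φ-good : GoodColoring 𝓗 k t φ) where

    φV : V Q → V Q → V Q → Fin k
    φV u v w = φ (fromV u) (fromV v) (fromV w)

    R-edge : ∀ {u v w m} → R Q u v w m ≡ true → E 𝓗 (fromV u) (fromV v) (fromV w) ≡ true
    R-edge {u} {v} {w} r = trans (cong₃ edge (toV-fromV u) (toV-fromV v) (toV-fromV w)) (⇒edge {u} {v} {w} r)

    pattern-of : Vec (W Q) 3 → Pattern
    pattern-of x = table finite-Places λ (a , b , d) → φV (vertex Q x a) (vertex Q x b) (vertex Q x d)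

    copy : Embedding P₀ Q
    copy = proj₁ (proj₂ partite-gadget pattern-of)

    φ₀ : V₀ → V₀ → V₀ → Fin k
    φ₀ u v w = φV (hat copy u) (hat copy v) (hat copy w)

    R₀-R : ∀ {u v w m} → R₀ u v w m ≡ true → R Q (hat copy u) (hat copy v) (hat copy w) m ≡ true
    R₀-R {u} {v} {w} {m} r = trans (emb-R copy u v w m) r

    φ₀-alike : ∀ x r → (∀ i j → label₀ (lookup r i) ≡ label₀ (lookup r j) → i ≡ j) → Alike P₀ P₀ x r → ∀ a b d →
      φ₀ (vertex P₀ x a) (vertex P₀ x b) (vertex P₀ x d) ≡ φ₀ (vertex P₀ r a) (vertex P₀ r b) (vertex P₀ r d)
    φ₀-alike x r distinct alike a b d = trans (sym (pulled x)) (trans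
        (table-injective finite-Places (proj₂ (proj₂ partite-gadget pattern-of) r distinct x alike) (a , b , d)) (pulled r))
      where
      pulled : ∀ x → φV (vertex Q (Vec.map (emb copy) x) a) (vertex Q (Vec.map (emb copy) x) b) (vertex Q (Vec.map (emb copy) x) d)
                   ≡ φ₀ (vertex P₀ x a) (vertex P₀ x b) (vertex P₀ x d)
      pulled x = cong₃ φV (hat-vertex copy x a) (hat-vertex copy x b) (hat-vertex copy x d)

    φ₀-agree : ∀ {κ κ′} s s′ ps ps′ → (∀ i → lookup s (lookup ps i) ≡ lookup s′ (lookup ps′ i)) →
      (∀ i j → lookup s′ (lookup ps′ i) ≡ lookup s′ (lookup ps′ j) → i ≡ j) →
      Agree κ κ′ (Vec.map (kind κ) ps) (Vec.map (kind κ′) ps′) → ∀ a b d →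
      φ₀ (at κ s (place ps a)) (at κ s (place ps b)) (at κ s (place ps d)) ≡
      φ₀ (at κ′ s′ (place ps′ a)) (at κ′ s′ (place ps′ b)) (at κ′ s′ (place ps′ d))
    φ₀-agree {κ} {κ′} s s′ ps ps′ same distinct A a b d =
      trans (sym (vertices κ s ps)) (trans (φ₀-alike (triple κ s ps) (triple κ′ s′ ps′) labels (agree-alike s s′ ps ps′ same A) a b d)
                                           (vertices κ′ s′ ps′))
      where
      vertices : ∀ κ s ps → φ₀ (vertex P₀ (triple κ s ps) a) (vertex P₀ (triple κ s ps) b) (vertex P₀ (triple κ s ps) d)
                          ≡ φ₀ (at κ s (place ps a)) (at κ s (place ps b)) (at κ s (place ps d))
      vertices κ s ps = cong₃ φ₀ (vertex-triple κ s ps a) (vertex-triple κ s ps b) (vertex-triple κ s ps d)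
      labels : ∀ i j → label₀ (lookup (triple κ′ s′ ps′) i) ≡ label₀ (lookup (triple κ′ s′ ps′) j) → i ≡ j
      labels i j eq = distinct i j (cong proj₁ (trans (sym (label-triple i)) (trans eq (label-triple j))))
        where
        label-triple : ∀ i → label₀ (lookup (triple κ′ s′ ps′) i) ≡ label₀ (κ′ , s′ , lookup ps′ i)
        label-triple i = cong label₀ (Vec.lookup-map i (λ p → κ′ , s′ , p) ps′)

    φ₀-sym₁₂ : ∀ {u v w m} → R₀ u v w m ≡ true → φ₀ u v w ≡ φ₀ v u w
    φ₀-sym₁₂ {u} {v} {w} r = proj₁ (proj₁ φ-good _ _ _ (true⇒T (R-edge {hat copy u} {hat copy v} {hat copy w} (R₀-R {u} {v} {w} r))))

    φ₀-sym₂₃ : ∀ {u v w m} → R₀ u v w m ≡ true → φ₀ u v w ≡ φ₀ u w v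
    φ₀-sym₂₃ {u} {v} {w} r = proj₂ (proj₁ φ-good _ _ _ (true⇒T (R-edge {hat copy u} {hat copy v} {hat copy w} (R₀-R {u} {v} {w} r))))

    -- A `MonoClique` needs distinct vertices. Any two vertices of `g` share an edge, so `Adm`
    -- separates their labels.
    φ₀-free : (g : Fin t → V₀) (α : Fin k) →
              (∀ i j l → Distinct i j l → (∃ λ m → R₀ (g i) (g j) (g l) m ≡ true) × φ₀ (g i) (g j) (g l) ≡ α) → ⊥
    φ₀-free g α mono = proj₂ φ-good (fromV ∘ hat copy ∘ g , (λ {i} {j} → injective i j (i Fin.≟ j)) , α , λ i j l i≢j j≢l i≢l →
      let ((_ , r) , eq) = mono i j l (i≢j , j≢l , i≢l)
      in true⇒T (R-edge {hat copy (g i)} {hat copy (g j)} {hat copy (g l)} (R₀-R {g i} {g j} {g l} r)) , eq)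
      where
      injective : ∀ i j → Dec (i ≡ j) → fromV (hat copy (g i)) ≡ fromV (hat copy (g j)) → i ≡ j
      injective i j (yes i≡j) _ = i≡j
      injective i j (no i≢j) eq =
        let (l , l∉) = avoid (i ∷ j ∷ []) (s≤s (s≤s (s≤s z≤n)))
            ((_ , r) , _) = mono i j l (i≢j , (λ eq → l∉ (there (here (sym eq)))) , (λ eq → l∉ (here (sym eq))))
            same = trans (sym (toV-fromV (hat copy (g i)))) (trans (cong toV eq) (toV-fromV (hat copy (g j))))
        in ⊥-elim (proj₁ (R-adm Q {hat copy (g i)} {hat copy (g j)} {hat copy (g l)} (R₀-R {g i} {g j} {g l} r)) (cong (labelV Q) same))

    open Coloured φ₀ φ₀-agree φ₀-sym₁₂ φ₀-sym₂₃ φ₀-free using (δ; δ-injective; roots-δ)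

    restriction : Σ (Permutation′ k) λ π → ∀ x y z → T (E H x y z) → φ (root x) (root y) (root z) ≡ π ⟨$⟩ʳ c x y z
    restriction = let (π , eq) = injection⇒permutation δ δ-injective in
      π , λ x y z xyz → trans (roots-δ (T⇒true xyz)) (sym (eq (c x y z)))

theorem2p5 : (k t : ℕ) → 2 ≤ k → 4 ≤ t →
    (n : ℕ) (H : Hyp3 n) (c : Fin n → Fin n → Fin n → Fin k) →
    GoodColoring H k t c →
    Σ ℕ λ m → Σ (Hyp3 m) λ 𝓗 → Σ (Fin m → Fin m → Fin m → Fin k) λ ψ →
    Σ (Fin n → Fin m) λ f →
    GoodColoring 𝓗 k t ψ
    × Injective _≡_ _≡_ f
    × (∀ a b d → E H a b d ≡ E 𝓗 (f a) (f b) (f d))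
    × (∀ φ → GoodColoring 𝓗 k t φ →
    Σ (Permutation′ k) λ π →
    ∀ a b d → T (E H a b d) → φ (f a) (f b) (f d) ≡ π ⟨$⟩ʳ c a b d)
    × (∀ a b → codeg H a b ≡ 0 → codeg 𝓗 (f a) (f b) ≡ 0)
    × (4 ≤ n → ∀ x → (∀ a → f a ≢ x) → Σ (Fin n) λ y → codeg 𝓗 x (f y) ≡ 0)
theorem2p5 k (suc (suc (suc (suc t′)))) 2≤k (s≤s (s≤s (s≤s (s≤s z≤n)))) n H c good =
  m , 𝓗 , ψ , root , ψ-good , root-injective , induced , Restriction.restriction , codeg-old , codeg-new
  where open Gadget k t′ n 2≤k H c good
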